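{- Let $B$ be a set of cells of an $m\times n$ array that contains exactly $h\geq 3$ cells in each row and exactly $k\geq 3$ cells in each column, and assume that $B$ admits two compatible orderings $\alpha_r$ and $\alpha_c$. Given $\Omega\subset\mathbb{Z}_{2nk+t}$ such that $[\pm x\mid x\in\Omega]$ contains each element of $\mathbb{Z}_{2nk+t}\setminus\frac{2nk+t}{t}\mathbb{Z}_{2nk+t}$ exactly once, let $\mathcal{D}$ be the set of all the $\mathrm{NH}_t(m,n;h,k)$, $D$, such that $\mathrm{skel}(D)=B$ and $\mathcal{E}(D)=\Omega$. Choose $D\in\mathcal{D}$ uniformly at random, denote by $\omega_r$ and $\omega_c$ the compatible orderings of $D$ that correspond to $\alpha_r$ and $\alpha_c$, and by $\Pi$ the Archdeacon embedding of $K_{\frac{2nk+t}{t}\times t}$ defined by $D$ (with these orderings). Then the probability that there exists $\sigma\in \mathrm{Aut}(\Pi)$ that is not a translation (i.e. that $\mathrm{Aut}(\Pi)\neq\mathbb{Z}_{2nk+t}$) is, considering $t$ fixed, $O\left(\frac{1}{nk}\right)$.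
   Context: Asymptotic convention: "$O(\cdot)$, considering $t$ fixed" means that the implied constant depends only on $t$ (not on $m,n,h,k,B,\alpha_r,\alpha_c,\Omega$). Arrays. A partially filled (p.f.) array is a matrix in which some cells may be empty. Let $v=2nk+t$ where $t$ divides $2nk$, and let $J=\frac{v}{t}\mathbb{Z}_v$ be the subgroup of $\mathbb{Z}_v$ of order $t$. A quasi-Heffter array $\mathrm{QH}_t(m,n;h,k)$ is an $m\times n$ p.f. array $A$ with entries in $\mathbb{Z}_v$ such that each row contains exactly $h$ filled cells, each column contains exactly $k$ filled cells, and the multiset $[\pm x\mid x\in A]$ contains each element of $\mathbb{Z}_v\setminus J$ exactly once. A non-zero sum Heffter array $\mathrm{NH}_t(m,n;h,k)$ is a $\mathrm{QH}_t(m,n;h,k)$ in which, moreover, the sum of the elements of every row and of every column is different from $0$ in $\mathbb{Z}_v$. $\mathcal{E}(A)$ is the list (set) of entries of $A$; $\mathrm{skel}(A)$ is the set of filled cells of $A$. Orderings. An ordering $\alpha_r$ of the rows of $B$ is a permutation of $B$ that is the product of one cyclic permutation for each row, acting on all cells of $B$ in that row; an ordering $\alpha_c$ of the columns is defined similarly. They are compatible if $\alpha_r\circ\alpha_c$ (equivalently $\alpha_c\circ\alpha_r$) is a single cycle of length $|B|$. If $\mathrm{skel}(A)=B$ and $p(x)\in B$ is the cell of $A$ containing $x\in\mathcal{E}(A)$, the corresponding orderings of $A$ are the permutations of $\mathcal{E}(A)$ given by $\omega_r=p^{ -1}\circ\alpha_r\circ p$ and $\omega_c=p^{ -1}\circ\alpha_c\circ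 p$. Embeddings. A combinatorial embedding (into an orientable surface) of a connected graph $\Gamma$ is a pair $(\Gamma,\rho)$ where $\rho$ is a permutation of the oriented edges with $\rho(x,y)=(x,\rho_x(y))$, each $\rho_x$ being a cyclic permutation of all neighbours of $x$. $K_{\frac{v}{t}\times t}$ is the complete multipartite graph with $v/t$ parts of size $t$; its vertex set is identified with $\mathbb{Z}_v$, two vertices being adjacent iff their difference is not in $J$. The Archdeacon embedding defined by $A,\omega_r,\omega_c$ is $\Pi=(K_{\frac{v}{t}\times t},\rho)$ with $\rho(x,x+a)=(x,x+\rho_0(a))$, where $\rho_0$ is the permutation of $\pm\mathcal{E}(A)=\mathbb{Z}_v\setminus J$ given by $\rho_0(a)=-\omega_r(a)$ if $a\in\mathcal{E}(A)$ and $\rho_0(a)=\omega_c(-a)$ if $a\in-\mathcal{E}(A)$. Automorphisms. $\mathrm{Aut}(\Pi)$ is the group of graph automorphisms $\sigma$ (acting on oriented edges by $\sigma(x,y)=(\sigma(x),\sigma(y))$) such that either $\sigma\circ\rho=\rho\circ\sigma$ or $\sigma\circ\rho=\rho^{ -1}\circ\sigma$. All translations $\tau_g(x)=x+g$, $g\in\mathbb{Z}_v$, belong to $\mathrm{Aut}(\Pi)$, and $\mathrm{Aut}(\Pi)=\mathbb{Z}_v$ means that it consists exactly of the translations. -}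

module Defs where

open import Algebra.Bundles using (CommutativeRing)
open import Algebra.Consequences.Propositional using (comm∧idˡ⇒id; comm∧invˡ⇒inv; comm∧distrˡ⇒distrʳ)
open import Data.Bool.Properties using () renaming (_≟_ to _≟ᵇ_)
open import Data.Empty using (⊥-elim; ⊥-elim-irr)
open import Data.Fin.Base using (Fin; toℕ; finToFun; funToFin)
open import Data.Fin.Properties
  using (all?; any?; _≟_; toℕ<n; toℕ-fromℕ<; toℕ-injective; finToFun-funToFin)
open import Data.Fin.Subset using (Subset; _∈_; ∣_∣; inside)
open import Data.Fin.Subset.Properties using (_∈?_)
import Data.Integer.Base as ℤ
open import Data.List.Base
  using (List; []; _∷_; _++_; [_]; length; map; filter; mapMaybe; allFin; cartesianProduct; cartesianProductWith)
open import Data.List.Properties using (length-++; filter-++)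
import Data.List.Membership.Propositional as List
open import Data.List.Membership.DecPropositional using () renaming (_∈?_ to member?)
open import Data.List.Membership.Propositional.Properties
  using (∈-++⁻; ∈-allFin; ∈-cartesianProduct⁺; ∈-cartesianProductWith⁺; ∈-map⁺; ∈-map⁻)
open import Data.List.Relation.Unary.All using ([]; _∷_)
open import Data.List.Relation.Unary.Any using (here; there)
open import Data.List.Relation.Unary.AllPairs using ([]; _∷_)
open import Data.List.Relation.Unary.Unique.Propositional using (Unique)
import Data.List.Relation.Unary.Unique.Propositional.Properties as Unique
open import Data.Maybe.Base using (Maybe; just; nothing; is-just; fromMaybe)
open import Data.Maybe.Properties using (just-injective)
open import Data.Nat.Base as ℕ using (ℕ; zero; suc; NonZero; _≤_; z≤n; s≤s)
open import Data.Nat.DivMod using (_%_; _mod_; %-distribˡ-+; %-distribˡ-*; m%n%n≡m%n; m<n⇒m%n≡m; n%n≡0; m%n<n)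
open import Data.Nat.GeneralisedArithmetic using (fold)
import Data.Nat.Properties as ℕₚ
open import Data.Product using (Σ; Σ-syntax; ∃; ∃-syntax; _×_; _,_; proj₁; proj₂)
open import Data.Rational.Unnormalised.Base using (ℚᵘ; _/_)
open import Data.Sum using (_⊎_; inj₁; inj₂)
open import Data.Vec.Base as Vec using (Vec; []; _∷_; lookup)
open import Data.Vec.Properties using (∷-injective; lookup-map; []=⇒lookup; lookup⇒[]=; ≡-dec)
open import Data.Vec.Properties.WithK using ([]=-irrelevant)
open import Function using (_∘_; id; _↔_; mk↔ₛ′; _⇔_; mk⇔; Inverse; Equivalence)
open import Level using (0ℓ)
open import Relation.Binary.PropositionalEquality hiding ([_]; J)
open import Relation.Nullary using (¬_; Dec; yes; no; contradiction)
open import Relation.Nullary.Decidable using (map′; _×-dec_; _⊎-dec_; _→-dec_; ¬?)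
open import Relation.Unary using (Decidable)

-- π is a product of disjoint cycles whose supports are exactly the
-- nonempty fibres of f.
record CyclesAlong {A I : Set} (f : A → I) (π : A ↔ A) : Set where
  open Inverse π using (to)
  field
    preserves  : ∀ x → f (to x) ≡ f x
    transitive : ∀ x y → f x ≡ f y → ∃[ s ] fold x to s ≡ y

-- On a finite type A: f is one cycle, of length the size of A.
SingleCycle : {A : Set} → (A → A) → Set
SingleCycle f = ∀ x y → ∃[ s ] fold x f s ≡ y

fold-suc : ∀ {A : Set} (f : A → A) x s → fold (f x) f s ≡ fold x f (suc s)
fold-suc f x zero    = refl
fold-suc f x (suc s) = cong f (fold-suc f x s)

fold-twice : ∀ {A B : Set} (f : A → A) (g : B → B) (h : B → A) → (∀ b → f (f (h b)) ≡ h (g b)) →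
             ∀ b s → fold (h b) f (s ℕ.+ s) ≡ h (fold b g s)
fold-twice f g h eq b zero    = refl
fold-twice f g h eq b (suc s) = trans (cong (λ z → f (fold (h b) f z)) (ℕₚ.+-suc s s))
  (trans (cong (f ∘ f) (fold-twice f g h eq b s)) (eq (fold b g s)))

dec-pairs-of-functions : ∀ {k n} {P : (f g : Fin k → Fin n) → Set} →
  (∀ {f f′ g g′} → f ≗ f′ → g ≗ g′ → P f g → P f′ g′) → (∀ f g → Dec (P f g)) → Dec (∃[ f ] ∃[ g ] P f g)
dec-pairs-of-functions resp P? = map′
  (λ (i , j , pij) → finToFun i , finToFun j , pij)
  (λ (f , g , pfg) → funToFin f , funToFin g ,
    resp (λ x → sym (finToFun-funToFin f x)) (λ x → sym (finToFun-funToFin g x)) pfg)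
  (any? λ i → any? λ j → P? (finToFun i) (finToFun j))

Cells : ℕ → ℕ → Set
Cells m n = Vec (Subset n) m

column : ∀ {m n} → Cells m n → Fin n → Subset m
column B j = Vec.map (λ r → lookup r j) B

record Cell {m n : ℕ} (B : Cells m n) : Set where
  constructor cell
  field
    row    : Fin m
    col    : Fin n
    filled : col ∈ lookup B row

  position : Fin m × Fin n
  position = row , col

open Cell using (row; col; position)

Cell-≡ : ∀ {m n} {B : Cells m n} {a b : Cell B} → position a ≡ position b → a ≡ b
Cell-≡ {a = cell _ _ p} {cell _ _ q} refl = cong (cell _ _) ([]=-irrelevant p q)

RowOrdering : ∀ {m n} → Cells m n → Set
RowOrdering B = Σ[ α ∈ Cell B ↔ Cell B ] CyclesAlong row α

ColumnOrdering : ∀ {m n} → Cells m n → Set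
ColumnOrdering B = Σ[ α ∈ Cell B ↔ Cell B ] CyclesAlong col α

Compatible : ∀ {m n} {B : Cells m n} → RowOrdering B → ColumnOrdering B → Set
Compatible (αr , _) (αc , _) = SingleCycle (Inverse.to αr ∘ Inverse.to αc)

record Graph : Set₁ where
  field
    Vertex : Set
    Adj    : Vertex → Vertex → Set
    symm   : ∀ {x y} → Adj x y → Adj y x
    irrefl : ∀ {x} → ¬ Adj x x

record OrientedEdge (Γ : Graph) : Set where
  constructor edge
  open Graph Γ
  field
    tail head : Vertex
    .adjacent : Adj tail head

open OrientedEdge using (tail; head)

edge-≡ : ∀ {Γ} {e e′ : OrientedEdge Γ} → tail e ≡ tail e′ → head e ≡ head e′ → e ≡ e′
edge-≡ refl refl = refl

record Embedding (Γ : Graph) : Set where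
  field
    ρ        : OrientedEdge Γ ↔ OrientedEdge Γ
    rotation : CyclesAlong tail ρ

record GraphAutomorphism (Γ : Graph) : Set where
  open Graph Γ
  field
    perm : Vertex ↔ Vertex
  open Inverse perm using (to)
  field
    adj⇔ : ∀ {x y} → Adj x y ⇔ Adj (to x) (to y)

  onEdges : OrientedEdge Γ → OrientedEdge Γ
  onEdges (edge x y xy) = edge (to x) (to y) (Equivalence.to adj⇔ xy)

module _ {Γ : Graph} (Π : Embedding Γ) (σ : GraphAutomorphism Γ) where
  open Inverse (Embedding.ρ Π) renaming (to to ρ; from to ρ⁻¹)
  open GraphAutomorphism σ using (onEdges)

  InAut : Set
  InAut = (∀ e → onEdges (ρ e) ≡ ρ (onEdges e)) ⊎ (∀ e → onEdges (ρ e) ≡ ρ⁻¹ (onEdges e))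

module ModularArithmetic (v : ℕ) .{{_ : NonZero v}} where

  infixl 6 _⊕_
  infixl 7 _⊗_

  _⊕_ _⊗_ : Fin v → Fin v → Fin v
  x ⊕ y = (toℕ x ℕ.+ toℕ y) mod v
  x ⊗ y = (toℕ x ℕ.* toℕ y) mod v

  ⊝_ : Fin v → Fin v
  ⊝ x = (v ℕ.∸ toℕ x) mod v

  toℕ-mod : ∀ a → toℕ (a mod v) ≡ a % v
  toℕ-mod a = toℕ-fromℕ< (m%n<n a v)

  mod-cong : ∀ {a b} → a % v ≡ b % v → a mod v ≡ b mod v
  mod-cong {a} {b} eq = toℕ-injective (trans (toℕ-mod a) (trans eq (sym (toℕ-mod b))))

  mod-toℕ : ∀ x → toℕ x mod v ≡ x
  mod-toℕ x = toℕ-injective (trans (toℕ-mod (toℕ x)) (m<n⇒m%n≡m (toℕ<n x)))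

  +-modˡ : ∀ a b → (a % v ℕ.+ b) % v ≡ (a ℕ.+ b) % v
  +-modˡ a b = begin
    (a % v ℕ.+ b) % v             ≡⟨ %-distribˡ-+ (a % v) b v ⟩
    (a % v % v ℕ.+ b % v) % v     ≡⟨ cong (λ z → (z ℕ.+ b % v) % v) (m%n%n≡m%n a v) ⟩
    (a % v ℕ.+ b % v) % v         ≡⟨ %-distribˡ-+ a b v ⟨
    (a ℕ.+ b) % v                 ∎
    where open ≡-Reasoning

  *-modˡ : ∀ a b → (a % v ℕ.* b) % v ≡ (a ℕ.* b) % v
  *-modˡ a b = begin
    (a % v ℕ.* b) % v             ≡⟨ %-distribˡ-* (a % v) b v ⟩
    (a % v % v ℕ.* (b % v)) % v   ≡⟨ cong (λ z → (z ℕ.* (b % v)) % v) (m%n%n≡m%n a v) ⟩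
    (a % v ℕ.* (b % v)) % v       ≡⟨ %-distribˡ-* a b v ⟨
    (a ℕ.* b) % v                 ∎
    where open ≡-Reasoning

  ⊕-comm : ∀ x y → x ⊕ y ≡ y ⊕ x
  ⊕-comm x y = cong (_mod v) (ℕₚ.+-comm (toℕ x) (toℕ y))

  ⊗-comm : ∀ x y → x ⊗ y ≡ y ⊗ x
  ⊗-comm x y = cong (_mod v) (ℕₚ.*-comm (toℕ x) (toℕ y))

  mod-⊕ : ∀ a y → a mod v ⊕ y ≡ (a ℕ.+ toℕ y) mod v
  mod-⊕ a y = mod-cong (trans (cong (λ z → (z ℕ.+ toℕ y) % v) (toℕ-mod a)) (+-modˡ a (toℕ y)))

  ⊕-mod : ∀ x b → x ⊕ b mod v ≡ (toℕ x ℕ.+ b) mod v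
  ⊕-mod x b = trans (⊕-comm x (b mod v))
    (trans (mod-⊕ b x) (cong (_mod v) (ℕₚ.+-comm b (toℕ x))))

  mod-⊗ : ∀ a y → a mod v ⊗ y ≡ (a ℕ.* toℕ y) mod v
  mod-⊗ a y = mod-cong (trans (cong (λ z → (z ℕ.* toℕ y) % v) (toℕ-mod a)) (*-modˡ a (toℕ y)))

  ⊗-mod : ∀ x b → x ⊗ (b mod v) ≡ (toℕ x ℕ.* b) mod v
  ⊗-mod x b = trans (⊗-comm x (b mod v))
    (trans (mod-⊗ b x) (cong (_mod v) (ℕₚ.*-comm b (toℕ x))))

  ⊕-assoc : ∀ x y z → (x ⊕ y) ⊕ z ≡ x ⊕ (y ⊕ z)
  ⊕-assoc x y z = trans (mod-⊕ (toℕ x ℕ.+ toℕ y) z)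
    (trans (cong (_mod v) (ℕₚ.+-assoc (toℕ x) (toℕ y) (toℕ z))) (sym (⊕-mod x (toℕ y ℕ.+ toℕ z))))

  ⊗-assoc : ∀ x y z → (x ⊗ y) ⊗ z ≡ x ⊗ (y ⊗ z)
  ⊗-assoc x y z = trans (mod-⊗ (toℕ x ℕ.* toℕ y) z)
    (trans (cong (_mod v) (ℕₚ.*-assoc (toℕ x) (toℕ y) (toℕ z))) (sym (⊗-mod x (toℕ y ℕ.* toℕ z))))

  ⊕-identityˡ : ∀ x → 0 mod v ⊕ x ≡ x
  ⊕-identityˡ x = trans (mod-⊕ 0 x) (mod-toℕ x)

  ⊗-identityˡ : ∀ x → 1 mod v ⊗ x ≡ x
  ⊗-identityˡ x = trans (mod-⊗ 1 x) (trans (cong (_mod v) (ℕₚ.*-identityˡ (toℕ x))) (mod-toℕ x))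

  ⊝-inverseˡ : ∀ x → ⊝ x ⊕ x ≡ 0 mod v
  ⊝-inverseˡ x = trans (mod-⊕ (v ℕ.∸ toℕ x) x) (trans
    (cong (_mod v) (ℕₚ.m∸n+n≡m (ℕₚ.<⇒≤ (toℕ<n x))))
    (mod-cong (trans (n%n≡0 v) (sym (m<n⇒m%n≡m (ℕ.>-nonZero⁻¹ v))))))

  ⊗-distribˡ-⊕ : ∀ x y z → x ⊗ (y ⊕ z) ≡ x ⊗ y ⊕ x ⊗ z
  ⊗-distribˡ-⊕ x y z = begin
    x ⊗ (y ⊕ z)                                              ≡⟨ ⊗-mod x (toℕ y ℕ.+ toℕ z) ⟩
    (toℕ x ℕ.* (toℕ y ℕ.+ toℕ z)) mod v                      ≡⟨ cong (_mod v) (ℕₚ.*-distribˡ-+ (toℕ x) (toℕ y) (toℕ z)) ⟩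
    (toℕ x ℕ.* toℕ y ℕ.+ toℕ x ℕ.* toℕ z) mod v              ≡⟨ mod-cong (+-modˡ (toℕ x ℕ.* toℕ y) _) ⟨
    ((toℕ x ℕ.* toℕ y) % v ℕ.+ toℕ x ℕ.* toℕ z) mod v        ≡⟨ cong (λ w → (w ℕ.+ toℕ x ℕ.* toℕ z) mod v) (toℕ-mod (toℕ x ℕ.* toℕ y)) ⟨
    (toℕ (x ⊗ y) ℕ.+ toℕ x ℕ.* toℕ z) mod v                  ≡⟨ ⊕-mod (x ⊗ y) (toℕ x ℕ.* toℕ z) ⟨
    x ⊗ y ⊕ x ⊗ z                                            ∎
    where open ≡-Reasoning

  ℤ/ : CommutativeRing 0ℓ 0ℓ
  ℤ/ = record
    { Carrier = Fin v
    ; _≈_ = _≡_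
    ; _+_ = _⊕_
    ; _*_ = _⊗_
    ; -_ = ⊝_
    ; 0# = 0 mod v
    ; 1# = 1 mod v
    ; isCommutativeRing = record
      { isRing = record
        { +-isAbelianGroup = record
          { isGroup = record
            { isMonoid = record
              { isSemigroup = record
                { isMagma = record { isEquivalence = isEquivalence ; ∙-cong = cong₂ _⊕_ }
                ; assoc = ⊕-assoc }
              ; identity = comm∧idˡ⇒id ⊕-comm ⊕-identityˡ }
            ; inverse = comm∧invˡ⇒inv ⊕-comm ⊝-inverseˡ
            ; ⁻¹-cong = cong ⊝_ }
          ; comm = ⊕-comm }
        ; *-cong = cong₂ _⊗_
        ; *-assoc = ⊗-assoc
        ; *-identity = comm∧idˡ⇒id ⊗-comm ⊗-identityˡ
        ; distrib = ⊗-distribˡ-⊕ , comm∧distrˡ⇒distrʳ ⊗-comm ⊗-distribˡ-⊕ }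
      ; *-comm = ⊗-comm } }

module _ {A : Set} (_≟ₐ_ : ∀ (x y : A) → Dec (x ≡ y)) where

  occurrences : A → List A → ℕ
  occurrences x xs = length (filter (x ≟ₐ_) xs)

  occurrences-++ : ∀ x xs ys → occurrences x (xs ++ ys) ≡ occurrences x xs ℕ.+ occurrences x ys
  occurrences-++ x xs ys = trans (cong length (filter-++ (x ≟ₐ_) xs ys)) (length-++ (filter (x ≟ₐ_) xs))

  ∈⇒occurs : ∀ {x xs} → x List.∈ xs → 1 ≤ occurrences x xs
  ∈⇒occurs {x} {y ∷ xs} x∈ with x ≟ₐ y | x∈
  ... | yes _   | _         = s≤s z≤n
  ... | no x≢y  | here x≡y  = contradiction x≡y x≢y
  ... | no _    | there x∈′ = ∈⇒occurs x∈′

  occurs⇒∈ : ∀ {x} xs → 1 ≤ occurrences x xs → x List.∈ xs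
  occurs⇒∈ {x} (y ∷ xs) 1≤ with x ≟ₐ y
  ... | yes x≡y = here x≡y
  ... | no _    = there (occurs⇒∈ xs 1≤)

  module _ {I : Set} (f : I → Maybe A) where

    ∈-mapMaybe⁺ : ∀ {i x is} → i List.∈ is → f i ≡ just x → x List.∈ mapMaybe f is
    ∈-mapMaybe⁺ {is = i ∷ is} (here refl) fi≡ with f i | fi≡
    ... | just _ | refl = here refl
    ∈-mapMaybe⁺ {is = i ∷ is} (there i∈) fi≡ with f i
    ... | just _  = there (∈-mapMaybe⁺ i∈ fi≡)
    ... | nothing = ∈-mapMaybe⁺ i∈ fi≡

    ∈-mapMaybe⁻ : ∀ {x} is → x List.∈ mapMaybe f is → ∃[ i ] f i ≡ just x
    ∈-mapMaybe⁻ (i ∷ is) x∈ with f i in eq | x∈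
    ... | just _  | here refl = i , eq
    ... | just _  | there x∈′ = ∈-mapMaybe⁻ is x∈′
    ... | nothing | x∈′       = ∈-mapMaybe⁻ is x∈′

    occurs-twice : ∀ {i j x is} → i List.∈ is → j List.∈ is → i ≢ j →
                   f i ≡ just x → f j ≡ just x → 2 ≤ occurrences x (mapMaybe f is)
    occurs-twice (here refl) (here refl) i≢j _ _ = contradiction refl i≢j
    occurs-twice {x = x} {is = i ∷ is} (here refl) (there j∈) _ fi≡ fj≡ with f i | fi≡
    ... | just _ | refl with x ≟ₐ x
    ...   | yes _  = s≤s (∈⇒occurs (∈-mapMaybe⁺ j∈ fj≡))
    ...   | no x≢x = contradiction refl x≢x
    occurs-twice {x = x} {is = i ∷ is} (there j∈) (here refl) _ fj≡ fi≡ with f i | fi≡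
    ... | just _ | refl with x ≟ₐ x
    ...   | yes _  = s≤s (∈⇒occurs (∈-mapMaybe⁺ j∈ fj≡))
    ...   | no x≢x = contradiction refl x≢x
    occurs-twice {x = x} {is = k ∷ is} (there i∈) (there j∈) i≢j fi≡ fj≡ with f k
    ... | nothing = occurs-twice i∈ j∈ i≢j fi≡ fj≡
    ... | just y with x ≟ₐ y
    ...   | yes _ = ℕₚ.m≤n⇒m≤1+n (occurs-twice i∈ j∈ i≢j fi≡ fj≡)
    ...   | no _  = occurs-twice i∈ j∈ i≢j fi≡ fj≡

vectors : {A : Set} → List A → (n : ℕ) → List (Vec A n)
vectors xs zero    = [ [] ]
vectors xs (suc n) = cartesianProductWith _∷_ xs (vectors xs n)

∈-vectors : {A : Set} {xs : List A} → (∀ x → x List.∈ xs) → ∀ {n} (w : Vec A n) → w List.∈ vectors xs n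
∈-vectors all []      = here refl
∈-vectors all (x ∷ w) = ∈-cartesianProductWith⁺ _∷_ (all x) (∈-vectors all w)

vectors-unique : {A : Set} {xs : List A} → Unique xs → ∀ n → Unique (vectors xs n)
vectors-unique xs! zero    = [] ∷ []
vectors-unique xs! (suc n) = Unique.cartesianProductWith⁺ _∷_ ∷-injective xs! (vectors-unique xs! n)

-- The probability of P under the uniform distribution on a nonempty list
-- without repetitions.
Pr : {A : Set} {P : A → Set} → Decidable P → (xs : List A) .{{_ : NonZero (length xs)}} → ℚᵘ
Pr P? xs = ℤ.+ length (filter P? xs) / length xs

-- Used with v = 2nk + t and t ∣ 2nk, so that J is the subgroup of order t.
module Heffter (v t : ℕ) .{{_ : NonZero v}} .{{_ : NonZero t}} where

  open ModularArithmetic v using (ℤ/)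
  open CommutativeRing ℤ/ hiding (refl; sym; trans)
  open import Algebra.Properties.CommutativeMonoid.Sum +-commutativeMonoid using (sum)
  open import Algebra.Properties.Ring ring using (-‿involutive; -‿+-comm; -‿distribˡ-*; -0#≈0#)

  ℤᵥ : Set
  ℤᵥ = Fin v

  J : ℤᵥ → Set
  J x = ∃[ c ] x ≡ c * ((v ℕ./ t) mod v)

  J? : Decidable J
  J? x = any? λ c → x ≟ c * ((v ℕ./ t) mod v)

  J-0# : J 0#
  J-0# = 0# , sym (zeroˡ _)

  J-neg : ∀ {x} → J x → J (- x)
  J-neg (c , refl) = - c , -‿distribˡ-* c _

  x+[y-x]≡y : ∀ x y → x + (y - x) ≡ y
  x+[y-x]≡y x y = trans (+-comm x (y - x)) (trans (+-assoc y (- x) x)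
    (trans (cong (y +_) (-‿inverseˡ x)) (+-identityʳ y)))

  [x+a]-x≡a : ∀ x a → (x + a) - x ≡ a
  [x+a]-x≡a x a = trans (cong (_- x) (+-comm x a)) (trans (+-assoc a x (- x))
    (trans (cong (a +_) (-‿inverseʳ x)) (+-identityʳ a)))

  -[y-x]≡x-y : ∀ x y → - (y - x) ≡ x - y
  -[y-x]≡x-y x y = trans (sym (-‿+-comm y (- x)))
    (trans (cong (- y +_) (-‿involutive x)) (+-comm (- y) x))

  -- The complete multipartite graph whose parts are the v / t cosets of J.
  K : Graph
  K = record
    { Vertex = ℤᵥ
    ; Adj    = λ x y → ¬ J (y - x)
    ; symm   = λ {x} {y} ¬j j → ¬j (subst J (-[y-x]≡x-y y x) (J-neg j))
    ; irrefl = λ {x} ¬j → ¬j (subst J (sym (-‿inverseʳ x)) J-0#)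
    }

  signed : List ℤᵥ → List ℤᵥ
  signed xs = xs ++ map -_ xs

  elements : Subset v → List ℤᵥ
  elements Ω = filter (_∈? Ω) (allFin v)

  -- The multiset [±x | x ∈ xs] is the set ℤᵥ ∖ J.
  CoversOnce : List ℤᵥ → Set
  CoversOnce xs = ∀ x →
    (¬ J x → occurrences _≟_ x (signed xs) ≡ 1) × (J x → occurrences _≟_ x (signed xs) ≡ 0)

  PFArray : ℕ → ℕ → Set
  PFArray m n = Vec (Vec (Maybe ℤᵥ) n) m

  module _ {m n : ℕ} where

    entry : PFArray m n → Fin m × Fin n → Maybe ℤᵥ
    entry A (i , j) = lookup (lookup A i) j

    skel : PFArray m n → Cells m n
    skel = Vec.map (Vec.map is-just)

    entries : PFArray m n → List ℤᵥ
    entries A = mapMaybe (entry A) (cartesianProduct (allFin m) (allFin n))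

    -- An empty cell counts as 0 here, which does not change the sums; elsewhere
    -- value is only applied to filled cells.
    value : PFArray m n → Fin m × Fin n → ℤᵥ
    value A ij = fromMaybe 0# (entry A ij)

    rowSum : PFArray m n → Fin m → ℤᵥ
    rowSum A i = sum λ j → value A (i , j)

    columnSum : PFArray m n → Fin n → ℤᵥ
    columnSum A j = sum λ i → value A (i , j)

    Regular : ℕ → ℕ → Cells m n → Set
    Regular h k B = (∀ i → ∣ lookup B i ∣ ≡ h) × (∀ j → ∣ column B j ∣ ≡ k)

    IsQH : ℕ → ℕ → PFArray m n → Set
    IsQH h k A = Regular h k (skel A) × CoversOnce (entries A)

    IsNH : ℕ → ℕ → PFArray m n → Set
    IsNH h k A = IsQH h k A × (∀ i → rowSum A i ≢ 0#) × (∀ j → columnSum A j ≢ 0#)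

    InFamily : ℕ → ℕ → Cells m n → Subset v → PFArray m n → Set
    InFamily h k B Ω D = IsNH h k D × skel D ≡ B × (∀ x → x List.∈ entries D ⇔ x ∈ Ω)

  CoversOnce? : Decidable CoversOnce
  CoversOnce? xs = all? λ x →
    (¬? (J? x) →-dec (occurrences _≟_ x (signed xs) ℕₚ.≟ 1)) ×-dec
    (J? x →-dec (occurrences _≟_ x (signed xs) ℕₚ.≟ 0))

  module _ {m n : ℕ} where

    skel≟ : ∀ (A : PFArray m n) B → Dec (skel A ≡ B)
    skel≟ A = ≡-dec (≡-dec _≟ᵇ_) (skel A)

    IsQH? : ∀ h k → Decidable (IsQH {m} {n} h k)
    IsQH? h k A =
      ((all? λ i → ∣ lookup (skel A) i ∣ ℕₚ.≟ h) ×-dec (all? λ j → ∣ column (skel A) j ∣ ℕₚ.≟ k))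
      ×-dec CoversOnce? (entries A)

    IsNH? : ∀ h k → Decidable (IsNH {m} {n} h k)
    IsNH? h k A = IsQH? h k A ×-dec
      (all? λ i → ¬? (rowSum A i ≟ 0#)) ×-dec (all? λ j → ¬? (columnSum A j ≟ 0#))

    InFamily? : ∀ h k B Ω → Decidable (InFamily {m} {n} h k B Ω)
    InFamily? h k B Ω D = IsNH? h k D ×-dec skel≟ D B ×-dec
      (all? λ x → map′ (λ (f , g) → mk⇔ f g) (λ e → Equivalence.to e , Equivalence.from e)
        ((member? _≟_ x (entries D) →-dec (x ∈? Ω)) ×-dec ((x ∈? Ω) →-dec member? _≟_ x (entries D))))

  contents : List (Maybe ℤᵥ)
  contents = nothing ∷ map just (allFin v)

  ∈-contents : ∀ a → a List.∈ contents
  ∈-contents nothing  = here refl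
  ∈-contents (just x) = there (∈-map⁺ just (∈-allFin x))

  contents-unique : Unique contents
  contents-unique = tabulate-≢ ∷ Unique.map⁺ just-injective (Unique.allFin⁺ v)
    where
    import Data.List.Relation.Unary.All.Properties as All
    import Data.List.Relation.Unary.All as All
    tabulate-≢ : All.All (nothing ≢_) (map just (allFin v))
    tabulate-≢ = All.map⁺ (All.universal (λ _ ()) (allFin v))

  arrays : ∀ m n → List (PFArray m n)
  arrays m n = vectors (vectors contents n) m

  ∈-arrays : ∀ {m n} (A : PFArray m n) → A List.∈ arrays m n
  ∈-arrays = ∈-vectors (∈-vectors ∈-contents)

  arrays-unique : ∀ m n → Unique (arrays m n)
  arrays-unique m n = vectors-unique (vectors-unique contents-unique n) m

  family : ∀ {m n} → ℕ → ℕ → Cells m n → Subset v → List (PFArray m n)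
  family h k B Ω = filter (InFamily? h k B Ω) (arrays _ _)

  module Archdeacon {m n : ℕ} (D : PFArray m n) {B : Cells m n}
                    (αr : RowOrdering B) (αc : ColumnOrdering B) where

    private
      val : Cell B → ℤᵥ
      val a = value D (position a)

      to from : Cell B ↔ Cell B → Cell B → Cell B
      to = Inverse.to
      from = Inverse.from

      r c : Cell B ↔ Cell B
      r = proj₁ αr
      c = proj₁ αc

    -- For skel D ≡ B this is membership in the set of entries of D; a proof
    -- records the cell containing the entry.
    _∈𝓔 : ℤᵥ → Set
    x ∈𝓔 = Σ[ a ∈ Cell B ] val a ≡ x

    _∈𝓔? : Decidable _∈𝓔
    x ∈𝓔? = map′ (λ (i , j , j∈ , eq) → cell i j j∈ , eq) (λ (cell i j j∈ , eq) → i , j , j∈ , eq)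
      (any? λ i → any? λ j → (j ∈? lookup B i) ×-dec (value D (i , j) ≟ x))

    p : ∀ {x} → x ∈𝓔 → Cell B
    p = proj₁

    ω : Cell B ↔ Cell B → ∀ {x} → x ∈𝓔 → ℤᵥ
    ω α x∈ = val (to α (p x∈))

    ω⁻¹ : Cell B ↔ Cell B → ∀ {x} → x ∈𝓔 → ℤᵥ
    ω⁻¹ α x∈ = val (from α (p x∈))

    -- If D is a quasi-Heffter array with skeleton B, the last clauses of choose
    -- and choose⁻¹ only concern elements of J, on which ρ₀ is irrelevant.
    choose : ∀ a → Dec (a ∈𝓔) → Dec ((- a) ∈𝓔) → ℤᵥ
    choose a (yes a∈) _         = - ω r a∈
    choose a (no _)   (yes -a∈) = ω c -a∈
    choose a (no _)   (no _)    = a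

    choose⁻¹ : ∀ b → Dec ((- b) ∈𝓔) → Dec (b ∈𝓔) → ℤᵥ
    choose⁻¹ b (yes -b∈) _        = ω⁻¹ r -b∈
    choose⁻¹ b (no _)    (yes b∈) = - ω⁻¹ c b∈
    choose⁻¹ b (no _)    (no _)   = b

    ρ₀ ρ₀⁻¹ : ℤᵥ → ℤᵥ
    ρ₀ a   = choose a (a ∈𝓔?) ((- a) ∈𝓔?)
    ρ₀⁻¹ b = choose⁻¹ b ((- b) ∈𝓔?) (b ∈𝓔?)

    module _ {h k} (qh : IsQH h k D) (skel≡B : skel D ≡ B) where

      covers = proj₂ qh

      occ : ℤᵥ → List ℤᵥ → ℕ
      occ = occurrences _≟_

      occ-split : ∀ x → occ x (signed (entries D)) ≡ occ x (entries D) ℕ.+ occ x (map -_ (entries D))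
      occ-split x = occurrences-++ _≟_ x (entries D) (map -_ (entries D))

      occ≤1 : ∀ x → occ x (signed (entries D)) ≤ 1
      occ≤1 x with J? x
      ... | yes j = ℕₚ.≤-trans (ℕₚ.≤-reflexive (proj₂ (covers x) j)) z≤n
      ... | no ¬j = ℕₚ.≤-reflexive (proj₁ (covers x) ¬j)

      side : ∀ i j → lookup (lookup B i) j ≡ is-just (entry D (i , j))
      side i j = trans (cong (λ S → lookup (lookup S i) j) (sym skel≡B))
        (trans (cong (λ w → lookup w j) (lookup-map i (Vec.map is-just) D))
               (lookup-map j is-just (lookup D i)))

      filled : ∀ (a : Cell B) → entry D (position a) ≡ just (val a)
      filled (cell i j j∈) with entry D (i , j) | trans (sym ([]=⇒lookup j∈)) (side i j)
      ... | just _ | _ = refl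

      cellOf : ∀ ij {x} → entry D ij ≡ just x → x ∈𝓔
      cellOf (i , j) eq =
        cell i j (lookup⇒[]= j (lookup B i) (trans (side i j) (cong is-just eq))) , cong (fromMaybe 0#) eq

      listed : ∀ (ij : Fin m × Fin n) → ij List.∈ cartesianProduct (allFin m) (allFin n)
      listed (i , j) = ∈-cartesianProduct⁺ (∈-allFin i) (∈-allFin j)

      val∈ : ∀ a → val a List.∈ entries D
      val∈ a = ∈-mapMaybe⁺ _≟_ (entry D) (listed (position a)) (filled a)

      -val∈ : ∀ a → - val a List.∈ map -_ (entries D)
      -val∈ a = ∈-map⁺ -_ (val∈ a)

      index-≟ : ∀ (ij kl : Fin m × Fin n) → Dec (ij ≡ kl)
      index-≟ (i , j) (k , l) = map′ (λ { (refl , refl) → refl }) (λ { refl → refl , refl })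
        ((i ≟ k) ×-dec (j ≟ l))

      val-injective : ∀ {a b} → val a ≡ val b → a ≡ b
      val-injective {a} {b} eq with index-≟ (position a) (position b)
      ... | yes same = Cell-≡ same
      ... | no a≢b   = contradiction
        (ℕₚ.≤-trans (occurs-twice _≟_ (entry D) (listed (position a)) (listed (position b)) a≢b
            (filled a) (trans (filled b) (cong just (sym eq))))
          (ℕₚ.≤-trans (ℕₚ.m≤m+n _ _)
            (ℕₚ.≤-trans (ℕₚ.≤-reflexive (sym (occ-split (val a)))) (occ≤1 (val a)))))
        (λ { (s≤s ()) })

      val≢-val : ∀ {a b} → val a ≢ - val b
      val≢-val {a} {b} eq = contradiction
        (ℕₚ.≤-trans (ℕₚ.+-mono-≤ (∈⇒occurs _≟_ (val∈ a))
                                  (∈⇒occurs _≟_ (subst (List._∈ map -_ (entries D)) (sym eq) (-val∈ b))))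
          (ℕₚ.≤-trans (ℕₚ.≤-reflexive (sym (occ-split (val a)))) (occ≤1 (val a))))
        (λ { (s≤s ()) })

      val∉J : ∀ a → ¬ J (val a)
      val∉J a j = contradiction
        (ℕₚ.≤-trans (ℕₚ.≤-trans (∈⇒occurs _≟_ (val∈ a)) (ℕₚ.m≤m+n _ _))
          (ℕₚ.≤-reflexive (trans (sym (occ-split (val a))) (proj₂ (covers (val a)) j))))
        (λ ())

      -val∉J : ∀ a → ¬ J (- val a)
      -val∉J a j = val∉J a (subst J (-‿involutive (val a)) (J-neg j))

      data Signed : ℤᵥ → Set where
        pos : ∀ a → Signed (val a)
        neg : ∀ a → Signed (- val a)

      signed-entry : ∀ {x} → x List.∈ entries D → x ∈𝓔
      signed-entry x∈ with ∈-mapMaybe⁻ _≟_ (entry D) (cartesianProduct (allFin m) (allFin n)) x∈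
      ... | ij , eq = cellOf ij eq

      ∉J⇒signed : ∀ {x} → ¬ J x → Signed x
      ∉J⇒signed {x} ¬j with member? _≟_ x (entries D)
      ... | yes x∈ with signed-entry x∈
      ...   | a , refl = pos a
      ∉J⇒signed {x} ¬j | no x∉
        with ∈-++⁻ (entries D) (occurs⇒∈ _≟_ (signed (entries D)) (ℕₚ.≤-reflexive (sym (proj₁ (covers x) ¬j))))
      ... | inj₁ x∈ = contradiction x∈ x∉
      ... | inj₂ x∈ with ∈-map⁻ -_ x∈
      ...   | y , y∈ , refl with signed-entry y∈
      ...     | a , refl = neg a

      choose-pos : ∀ a d d′ → choose (val a) d d′ ≡ - val (to r a)
      choose-pos a (yes (b , eq)) _ = cong (λ z → - val (to r z)) (val-injective eq)
      choose-pos a (no a∉)        _ = contradiction (a , refl) a∉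

      choose-neg : ∀ a d d′ → choose (- val a) d d′ ≡ val (to c a)
      choose-neg a (yes (b , eq)) _              = contradiction eq (val≢-val {b} {a})
      choose-neg a (no _)         (yes (b , eq)) =
        cong (λ z → val (to c z)) (val-injective (trans eq (-‿involutive (val a))))
      choose-neg a (no _)         (no a∉)        = contradiction (a , sym (-‿involutive (val a))) a∉

      choose⁻¹-neg : ∀ a d d′ → choose⁻¹ (- val a) d d′ ≡ val (from r a)
      choose⁻¹-neg a (yes (b , eq)) _ =
        cong (λ z → val (from r z)) (val-injective (trans eq (-‿involutive (val a))))
      choose⁻¹-neg a (no a∉)        _ = contradiction (a , sym (-‿involutive (val a))) a∉

      choose⁻¹-pos : ∀ a d d′ → choose⁻¹ (val a) d d′ ≡ - val (from c a)
      choose⁻¹-pos a (yes (b , eq)) _              = contradiction eq (val≢-val {b} {a})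
      choose⁻¹-pos a (no _)         (yes (b , eq)) = cong (λ z → - val (from c z)) (val-injective eq)
      choose⁻¹-pos a (no _)         (no a∉)        = contradiction (a , refl) a∉

      ρ₀-pos : ∀ a → ρ₀ (val a) ≡ - val (to r a)
      ρ₀-pos a = choose-pos a (val a ∈𝓔?) ((- val a) ∈𝓔?)

      ρ₀-neg : ∀ a → ρ₀ (- val a) ≡ val (to c a)
      ρ₀-neg a = choose-neg a ((- val a) ∈𝓔?) ((- (- val a)) ∈𝓔?)

      ρ₀⁻¹-neg : ∀ a → ρ₀⁻¹ (- val a) ≡ val (from r a)
      ρ₀⁻¹-neg a = choose⁻¹-neg a ((- (- val a)) ∈𝓔?) ((- val a) ∈𝓔?)

      ρ₀⁻¹-pos : ∀ a → ρ₀⁻¹ (val a) ≡ - val (from c a)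
      ρ₀⁻¹-pos a = choose⁻¹-pos a ((- val a) ∈𝓔?) (val a ∈𝓔?)

      ρ₀∉J : ∀ {x} → ¬ J x → ¬ J (ρ₀ x)
      ρ₀∉J ¬j with ∉J⇒signed ¬j
      ... | pos a = subst (¬_ ∘ J) (sym (ρ₀-pos a)) (-val∉J (to r a))
      ... | neg a = subst (¬_ ∘ J) (sym (ρ₀-neg a)) (val∉J (to c a))

      ρ₀⁻¹∉J : ∀ {x} → ¬ J x → ¬ J (ρ₀⁻¹ x)
      ρ₀⁻¹∉J ¬j with ∉J⇒signed ¬j
      ... | pos a = subst (¬_ ∘ J) (sym (ρ₀⁻¹-pos a)) (-val∉J (from c a))
      ... | neg a = subst (¬_ ∘ J) (sym (ρ₀⁻¹-neg a)) (val∉J (from r a))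

      ρ₀∘ρ₀⁻¹ : ∀ {x} → ¬ J x → ρ₀ (ρ₀⁻¹ x) ≡ x
      ρ₀∘ρ₀⁻¹ ¬j with ∉J⇒signed ¬j
      ... | pos a = trans (cong ρ₀ (ρ₀⁻¹-pos a)) (trans (ρ₀-neg _) (cong val (Inverse.strictlyInverseˡ c a)))
      ... | neg a = trans (cong ρ₀ (ρ₀⁻¹-neg a)) (trans (ρ₀-pos _) (cong (-_ ∘ val) (Inverse.strictlyInverseˡ r a)))

      ρ₀⁻¹∘ρ₀ : ∀ {x} → ¬ J x → ρ₀⁻¹ (ρ₀ x) ≡ x
      ρ₀⁻¹∘ρ₀ ¬j with ∉J⇒signed ¬j
      ... | pos a = trans (cong ρ₀⁻¹ (ρ₀-pos a)) (trans (ρ₀⁻¹-neg _) (cong val (Inverse.strictlyInverseʳ r a)))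
      ... | neg a = trans (cong ρ₀⁻¹ (ρ₀-neg a)) (trans (ρ₀⁻¹-pos _) (cong (-_ ∘ val) (Inverse.strictlyInverseʳ c a)))

      relevant : ∀ {x} → .(¬ J x) → ¬ J x
      relevant ¬j j = ⊥-elim-irr (¬j j)

      rotate unrotate : OrientedEdge K → OrientedEdge K
      rotate (edge x y xy) = edge x (x + ρ₀ (y - x))
        (λ j → ρ₀∉J xy (subst J ([x+a]-x≡a x (ρ₀ (y - x))) j))
      unrotate (edge x y xy) = edge x (x + ρ₀⁻¹ (y - x))
        (λ j → ρ₀⁻¹∉J xy (subst J ([x+a]-x≡a x (ρ₀⁻¹ (y - x))) j))

      rotate-unrotate : ∀ e → rotate (unrotate e) ≡ e
      rotate-unrotate (edge x y xy) = edge-≡ refl (trans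
        (cong (x +_) (trans (cong ρ₀ ([x+a]-x≡a x _)) (ρ₀∘ρ₀⁻¹ (relevant xy)))) (x+[y-x]≡y x y))

      unrotate-rotate : ∀ e → unrotate (rotate e) ≡ e
      unrotate-rotate (edge x y xy) = edge-≡ refl (trans
        (cong (x +_) (trans (cong ρ₀⁻¹ ([x+a]-x≡a x _)) (ρ₀⁻¹∘ρ₀ (relevant xy)))) (x+[y-x]≡y x y))

      diff : OrientedEdge K → ℤᵥ
      diff e = head e - tail e

      fold-tail : ∀ e s → tail (fold e rotate s) ≡ tail e
      fold-tail e zero    = refl
      fold-tail e (suc s) = fold-tail e s

      fold-diff : ∀ e s → diff (fold e rotate s) ≡ fold (diff e) ρ₀ s
      fold-diff e zero    = refl
      fold-diff e (suc s) = trans ([x+a]-x≡a _ _) (cong ρ₀ (fold-diff e s))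

      module _ (compatible : Compatible αr αc) where

        rc : Cell B → Cell B
        rc a = to r (to c a)

        -- ρ₀ ∘ ρ₀ acts on the entries as αc ∘ αr, which c conjugates to αr ∘ αc.
        ρ₀-twice : ∀ a → ρ₀ (ρ₀ (val (to c a))) ≡ val (to c (rc a))
        ρ₀-twice a = trans (cong ρ₀ (ρ₀-pos (to c a))) (ρ₀-neg (rc a))

        reach : ∀ a b → ∃[ s ] fold (val (to c a)) ρ₀ s ≡ val (to c b)
        reach a b with compatible a b
        ... | s , eq = s ℕ.+ s , trans (fold-twice ρ₀ rc (val ∘ to c) ρ₀-twice a s) (cong (val ∘ to c) eq)

        reach-val : ∀ a b → ∃[ s ] fold (val a) ρ₀ s ≡ val b
        reach-val a b with reach (from c a) (from c b)
        ... | s , eq = s , trans (cong (λ z → fold (val z) ρ₀ s) (sym (Inverse.strictlyInverseˡ c a)))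
                                 (trans eq (cong val (Inverse.strictlyInverseˡ c b)))

        reach-pos : ∀ a {y} → ¬ J y → ∃[ s ] fold (val a) ρ₀ s ≡ y
        reach-pos a ¬j with ∉J⇒signed ¬j
        ... | pos b = reach-val a b
        ... | neg b with reach-val a (from r b)
        ...   | s , eq = suc s , trans (cong ρ₀ eq)
                (trans (ρ₀-pos _) (cong (-_ ∘ val) (Inverse.strictlyInverseˡ r b)))

        ρ₀-cyclic : ∀ {x y} → ¬ J x → ¬ J y → ∃[ s ] fold x ρ₀ s ≡ y
        ρ₀-cyclic ¬j ¬j′ with ∉J⇒signed ¬j
        ... | pos a = reach-pos a ¬j′
        ... | neg a with reach-pos (to c a) ¬j′
        ...   | s , eq = suc s , trans (sym (fold-suc ρ₀ (- val a) s))
                (trans (cong (λ z → fold z ρ₀ s) (ρ₀-neg a)) eq)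

        archdeacon : Embedding K
        archdeacon = record
          { ρ = mk↔ₛ′ rotate unrotate rotate-unrotate unrotate-rotate
          ; rotation = record { preserves = λ _ → refl ; transitive = cyclic } }
          where
          cyclic : ∀ e e′ → tail e ≡ tail e′ → ∃[ s ] fold e rotate s ≡ e′
          cyclic e@(edge x y xy) e′@(edge _ z xz) refl with ρ₀-cyclic (relevant xy) (relevant xz)
          ... | s , eq = s , edge-≡ (fold-tail e s) (trans (sym (x+[y-x]≡y (tail (fold e rotate s)) _))
                (trans (cong₂ _+_ (fold-tail e s) (trans (fold-diff e s) eq)) (x+[y-x]≡y x z)))

  IsTranslation : GraphAutomorphism K → Set
  IsTranslation σ = ∃[ g ] ∀ x → Inverse.to (GraphAutomorphism.perm σ) x ≡ x + g

  module _ {m n : ℕ} (h k : ℕ) {B : Cells m n} (αr : RowOrdering B) (αc : ColumnOrdering B)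
           (compatible : Compatible αr αc) where

    HasNonTranslation : PFArray m n → Set
    HasNonTranslation D =
      Σ[ qh ∈ IsQH h k D ] Σ[ skel≡B ∈ skel D ≡ B ]
        ∃[ σ ] InAut (Archdeacon.archdeacon D αr αc qh skel≡B compatible) σ × ¬ IsTranslation σ

    module Search (D : PFArray m n) (qh : IsQH h k D) (skel≡B : skel D ≡ B) where

      open Archdeacon D αr αc using (ρ₀; ρ₀⁻¹; archdeacon)

      Π : Embedding K
      Π = archdeacon qh skel≡B compatible

      Commutes : (ℤᵥ → ℤᵥ) → (ℤᵥ → ℤᵥ) → Set
      Commutes f φ = ∀ x y → ¬ J (y - x) → f (x + ρ₀ (y - x)) ≡ f x + φ (f y - f x)

      -- InAut and being a non-translation, for a permutation f with inverse g.
      Raw : (ℤᵥ → ℤᵥ) → (ℤᵥ → ℤᵥ) → Set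
      Raw f g = ((∀ x → f (g x) ≡ x) × (∀ x → g (f x) ≡ x))
        × (∀ x y → (¬ J (y - x) → ¬ J (f y - f x)) × (¬ J (f y - f x) → ¬ J (y - x)))
        × (Commutes f ρ₀ ⊎ Commutes f ρ₀⁻¹)
        × ¬ (∃[ a ] ∀ x → f x ≡ x + a)

      Commutes? : ∀ f φ → Dec (Commutes f φ)
      Commutes? f φ = all? λ x → all? λ y → ¬? (J? (y - x)) →-dec (f (x + ρ₀ (y - x)) ≟ f x + φ (f y - f x))

      Raw? : ∀ f g → Dec (Raw f g)
      Raw? f g = ((all? λ x → f (g x) ≟ x) ×-dec (all? λ x → g (f x) ≟ x))
        ×-dec (all? λ x → all? λ y → (¬? (J? (y - x)) →-dec ¬? (J? (f y - f x)))
                               ×-dec (¬? (J? (f y - f x)) →-dec ¬? (J? (y - x))))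
        ×-dec (Commutes? f ρ₀ ⊎-dec Commutes? f ρ₀⁻¹)
        ×-dec ¬? (any? λ a → all? λ x → f x ≟ x + a)

      Commutes-resp : ∀ {f f′} φ → f ≗ f′ → Commutes f φ → Commutes f′ φ
      Commutes-resp φ ff com x y xy = trans (sym (ff _)) (trans (com x y xy)
        (cong₂ (λ a b → a + φ (b - a)) (ff x) (ff y)))

      Raw-resp : ∀ {f f′ g g′} → f ≗ f′ → g ≗ g′ → Raw f g → Raw f′ g′
      Raw-resp {f} {f′} {g} {g′} ff gg ((fg , gf) , adj , com , ¬tr) =
        ( (λ x → trans (sym (trans (ff (g x)) (cong f′ (gg x)))) (fg x))
        , (λ x → trans (sym (trans (gg (f x)) (cong g′ (ff x)))) (gf x)) )
        , (λ x y → (λ xy → subst (¬_ ∘ J) (diff′ x y) (proj₁ (adj x y) xy))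
                 , (λ xy → proj₂ (adj x y) (subst (¬_ ∘ J) (sym (diff′ x y)) xy)))
        , comm com
        , λ (a , tr) → ¬tr (a , λ x → trans (ff x) (tr x))
        where
        diff′ : ∀ x y → f y - f x ≡ f′ y - f′ x
        diff′ x y = cong₂ _-_ (ff y) (ff x)
        comm : Commutes f ρ₀ ⊎ Commutes f ρ₀⁻¹ → Commutes f′ ρ₀ ⊎ Commutes f′ ρ₀⁻¹
        comm (inj₁ com) = inj₁ (Commutes-resp ρ₀ ff com)
        comm (inj₂ com) = inj₂ (Commutes-resp ρ₀⁻¹ ff com)

      fromRaw : ∀ {f g} → Raw f g → ∃[ σ ] InAut Π σ × ¬ IsTranslation σ
      fromRaw {f} {g} ((fg , gf) , adj , com , ¬tr) = σ , aut com , ¬tr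
        where
        σ : GraphAutomorphism K
        σ = record { perm = mk↔ₛ′ f g fg gf
                   ; adj⇔ = λ {x} {y} → mk⇔ (proj₁ (adj x y)) (proj₂ (adj x y)) }
        aut : Commutes f ρ₀ ⊎ Commutes f ρ₀⁻¹ → InAut Π σ
        aut (inj₁ com) = inj₁ λ { (edge x y xy) → edge-≡ refl (com x y (λ j → ⊥-elim-irr (xy j))) }
        aut (inj₂ com) = inj₂ λ { (edge x y xy) → edge-≡ refl (com x y (λ j → ⊥-elim-irr (xy j))) }

      toRaw : ∀ σ → InAut Π σ → ¬ IsTranslation σ →
              Raw (Inverse.to (GraphAutomorphism.perm σ)) (Inverse.from (GraphAutomorphism.perm σ))
      toRaw σ aut ¬tr = (strictlyInverseˡ , strictlyInverseʳ)
        , (λ x y → Equivalence.to adj⇔ , Equivalence.from adj⇔)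
        , com aut , ¬tr
        where
        open GraphAutomorphism σ
        open Inverse perm
        com : InAut Π σ → Commutes to ρ₀ ⊎ Commutes to ρ₀⁻¹
        com (inj₁ eq) = inj₁ λ x y xy → cong head (eq (edge x y xy))
        com (inj₂ eq) = inj₂ λ x y xy → cong head (eq (edge x y xy))

      search : Dec (∃[ σ ] InAut Π σ × ¬ IsTranslation σ)
      search = map′ (λ (_ , _ , raw) → fromRaw raw)
                    (λ (σ , aut , ¬tr) → _ , _ , toRaw σ aut ¬tr)
                    (dec-pairs-of-functions Raw-resp Raw?)

    decide : ∀ D → Dec (IsQH h k D) → Dec (skel D ≡ B) → Dec (HasNonTranslation D)
    decide D (no ¬qh)  _            = no λ (qh , _) → ¬qh qh
    decide D (yes _)   (no skel≢B)  = no λ (_ , skel≡B , _) → skel≢B skel≡B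
    decide D (yes qh)  (yes skel≡B) = map′
      (λ nt → qh , skel≡B , nt)
      (λ (_ , _ , σ , aut , ¬tr) → σ , aut , ¬tr)
      (Search.search D qh skel≡B)

    HasNonTranslation? : Decidable HasNonTranslation
    HasNonTranslation? D = decide D (IsQH? h k D) (skel≟ D B)

modulus-nonZero : ∀ {a t} .{{_ : NonZero t}} → NonZero (a ℕ.+ t)
modulus-nonZero {a} {t} = ℕ.>-nonZero (ℕₚ.<-≤-trans (ℕ.>-nonZero⁻¹ t) (ℕₚ.m≤n+m t a))

{-# OPTIONS --safe #-}
-- Compose an automorphism with a translation so that it fixes 0.  It then permutes
-- the neighbours of 0, that is the signed entries s(x), x = ± a cell, by a map φ
-- that commutes with the rotation at 0 or reverses it; as that rotation is one
-- cycle, only 4nk maps φ are possible.  At the vertex s(u) the automorphism f acts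
-- through the map φᵤ of the same kind with φᵤ(-u) = -φ(u), so reading
-- f(s(u) + s(i)) from the vertices s(u) and s(i) gives
--     s(φ(u)) + s(φᵤ(i)) = s(φ(i)) + s(φᵢ(u))      for all u and i.
-- If φ(-u) ≠ -φ(u) for some u, these equations are not identities, and two of
-- them are used.  Otherwise φᵤ = φ for all u, so f is additive, f(x) = c x, and
-- three equations s(φ(i)) = c s(i) are used for each of the v ≤ (2 + t) nk values
-- of c.  An equation costs a factor O(1/nk): exchanging the entry of a fixed cell
-- with that of another cell stays within the family for a sixth of all cells, and
-- at most three of these exchanges lead to a solution.  Hence each φ has probability
-- O(1/(nk)²), and the union over φ gives O(1/nk).
module Submission where

open import Defs
open import Algebra.Bundles using (CommutativeRing)
open import Data.Bool.Base using (Bool; true; false; not)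
open import Data.Empty using (⊥)
open import Data.Fin.Base using (Fin; zero; suc; toℕ; punchIn)
open import Data.Fin.Permutation using (permutation)
open import Data.Fin.Properties using (any?; punchInᵢ≢i; toℕ-injective; toℕ<n) renaming (_≟_ to _≟ᶠ_)
open import Data.Fin.Subset as Subset using (Subset; ∣_∣)
import Data.Integer.Base as ℤ
import Data.Integer.Properties as ℤₚ
open import Data.List.Base
  using (List; []; _∷_; _++_; length; map; filter; concatMap; cartesianProduct; allFin; upTo)
open import Data.List.Membership.DecPropositional using () renaming (_∈?_ to member?)
open import Data.List.Membership.Propositional using (_∈_; _∉_; find; lose)
open import Data.List.Membership.Propositional.Properties
  using ( ∈-∃++; ∈-++⁻; ∈-++⁺ˡ; ∈-++⁺ʳ; ∈-filter⁺; ∈-filter⁻; ∈-concatMap⁺; ∈-concatMap⁻; ∈-map⁺; ∈-map⁻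
        ; ∈-cartesianProduct⁺; ∈-cartesianProduct⁻; ∈-allFin; ∈-upTo⁺ )
open import Data.List.Membership.Propositional.Properties.WithK using (unique∧set⇒bag)
open import Data.List.Properties
  using ( length-++; length-map; length-filter; length-tabulate; length-upTo; filter-all; filter-none
        ; mapMaybe-cong; mapMaybe-map )
open import Data.List.Relation.Binary.BagAndSetEquality using (∼bag⇒↭)
open import Data.List.Relation.Binary.Permutation.Propositional using (_↭_; ↭-sym)
import Data.List.Relation.Binary.Permutation.Propositional.Properties as Perm
open import Data.List.Relation.Binary.Subset.Propositional using (_⊆_)
open import Data.List.Relation.Unary.All as All using ([]; _∷_)
import Data.List.Relation.Unary.All.Properties as Allₚ
open import Data.List.Relation.Unary.AllPairs using ([]; _∷_)
open import Data.List.Relation.Unary.Any as Any using (here; there)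
open import Data.List.Relation.Unary.Unique.Propositional using (Unique)
import Data.List.Relation.Unary.Unique.Propositional.Properties as Unique
open import Data.Maybe.Base using (is-just; fromMaybe)
open import Data.Nat.Base as ℕ using (ℕ; zero; suc; NonZero; s≤s; z≤n)
open import Data.Nat.Divisibility using (_∣_)
open import Data.Nat.DivMod using (_mod_; _%_; m≡m%n+[m/n]*n; m<n*o⇒m/o<n; m%n%n≡m%n; %-distribˡ-+)
open import Data.Nat.GeneralisedArithmetic using (fold)
import Data.Nat.Properties as ℕₚ
import Data.Nat.Solver
open import Data.Product using (Σ-syntax; ∃-syntax; _×_; _,_; proj₁; proj₂)
open import Data.Product.Properties using (,-injective; ,-injectiveˡ; ,-injectiveʳ; ≡-dec)
import Data.Rational.Unnormalised.Base as ℚ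
open import Data.Sum using (_⊎_; inj₁; inj₂)
open import Data.Unit.Base using (⊤; tt)
open import Data.Vec.Base as Vec using (Vec; []; _∷_; lookup; here; there)
open import Data.Vec.Properties using (lookup-map; []=⇒lookup; lookup⇒[]=; lookup∘tabulate; tabulate∘lookup; tabulate-cong)
open import Data.Vec.Properties.WithK using ([]=-irrelevant)
open import Function using (_∘_; id; _↔_; Inverse; Equivalence; mk⇔)
open import Relation.Binary.PropositionalEquality hiding (J)
open import Relation.Nullary using (¬_; Dec; yes; no; contradiction)
open import Relation.Nullary.Decidable using (¬?; _×-dec_; map′; decidable-stable)
open import Relation.Unary using (Decidable)

open Cell using (row; col; position)

-- Finite counting

-- The entries of a random array of the family are far from independent, and the family itself is
-- never counted. Probabilities are therefore only compared: an array satisfying a list of equations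
-- is joined to its exchanges at one cell, the `pivot` of the newest equation, and these links are
-- counted from both ends. Several equations can be imposed in a row because the pivot of each
-- avoids the cells of those imposed before, so that an exchange there leaves them intact. The
-- number three of bad exchanges arises because the entry at the pivot may occur up to three times
-- in an equation, and because `l · x = κ` can have `l` solutions in ℤᵥ when v is not prime. The
-- hypotheses h, k ≥ 3 enter twice. Row and column cycles of length at least three keep a nontrivial
-- φ from fixing the cells of both `x` and `rotate x`; and they give m + n ≤ 2nk/3, which leaves
-- room for exchanges, since every row and every column may spoil one of them.

length-⊆ : {A : Set} {xs ys : List A} → Unique xs → xs ⊆ ys → length xs ℕ.≤ length ys
length-⊆ [] _ = z≤n
length-⊆ {xs = x ∷ xs} (x∉ ∷ xs!) xs⊆ with ∈-∃++ (xs⊆ (here refl))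
... | ls , rs , refl = ℕₚ.≤-trans (s≤s (length-⊆ xs! xs⊆′))
        (ℕₚ.≤-reflexive (trans (cong suc (length-++ ls)) (sym (trans (length-++ ls) (ℕₚ.+-suc _ _)))))
  where
  xs⊆′ : xs ⊆ ls ++ rs
  xs⊆′ {y} y∈ with ∈-++⁻ ls (xs⊆ (there y∈))
  ... | inj₁ y∈ls         = ∈-++⁺ˡ y∈ls
  ... | inj₂ (here y≡x)   = contradiction (sym y≡x) (All.lookup x∉ y∈)
  ... | inj₂ (there y∈rs) = ∈-++⁺ʳ ls y∈rs

length-cartesianProduct : {A B : Set} (xs : List A) (ys : List B) →
                          length (cartesianProduct xs ys) ≡ length xs ℕ.* length ys
length-cartesianProduct []       ys = refl
length-cartesianProduct (x ∷ xs) ys = trans (length-++ (map (x ,_) ys))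
  (cong₂ ℕ._+_ (length-map (x ,_) ys) (length-cartesianProduct xs ys))

module _ {A B : Set} (f : A → List B) where

  *-length-concatMap : ∀ w b xs → (∀ {x} → x ∈ xs → w ℕ.* length (f x) ℕ.≤ b) →
                       w ℕ.* length (concatMap f xs) ℕ.≤ length xs ℕ.* b
  *-length-concatMap w b []       _ = ℕₚ.≤-reflexive (ℕₚ.*-zeroʳ w)
  *-length-concatMap w b (x ∷ xs) h = begin
    w ℕ.* length (f x ++ concatMap f xs)                ≡⟨ cong (w ℕ.*_) (length-++ (f x)) ⟩
    w ℕ.* (length (f x) ℕ.+ length (concatMap f xs))      ≡⟨ ℕₚ.*-distribˡ-+ w (length (f x)) _ ⟩
    w ℕ.* length (f x) ℕ.+ w ℕ.* length (concatMap f xs)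
      ≤⟨ ℕₚ.+-mono-≤ (h (here refl)) (*-length-concatMap w b xs (h ∘ there)) ⟩
    b ℕ.+ length xs ℕ.* b                                 ∎
    where open ℕₚ.≤-Reasoning

  length-concatMap-≤ : ∀ b xs → (∀ {x} → x ∈ xs → length (f x) ℕ.≤ b) → length (concatMap f xs) ℕ.≤ length xs ℕ.* b
  length-concatMap-≤ b xs h = subst (ℕ._≤ length xs ℕ.* b) (ℕₚ.*-identityˡ _)
    (*-length-concatMap 1 b xs (λ x∈ → subst (ℕ._≤ b) (sym (ℕₚ.*-identityˡ _)) (h x∈)))

  length-concatMap-≥ : ∀ b xs → (∀ {x} → x ∈ xs → b ℕ.≤ length (f x)) → length xs ℕ.* b ℕ.≤ length (concatMap f xs)
  length-concatMap-≥ b []       _ = z≤n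
  length-concatMap-≥ b (x ∷ xs) h = ℕₚ.≤-trans
    (ℕₚ.+-mono-≤ (h (here refl)) (length-concatMap-≥ b xs (h ∘ there)))
    (ℕₚ.≤-reflexive (sym (length-++ (f x))))

  ∈-concatMap : ∀ {x y xs} → x ∈ xs → y ∈ f x → y ∈ concatMap f xs
  ∈-concatMap x∈ y∈ = ∈-concatMap⁺ f (lose x∈ y∈)

  concatMap-unique : (∀ {x x′ y} → y ∈ f x → y ∈ f x′ → x ≡ x′) → (∀ x → Unique (f x)) →
                     ∀ {xs} → Unique xs → Unique (concatMap f xs)
  concatMap-unique disjoint f! [] = []
  concatMap-unique disjoint f! {x ∷ xs} (x∉ ∷ xs!) = Unique.++⁺ (f! x) (concatMap-unique disjoint f! xs!) λ (y∈ , y∈′) →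
    let x′ , x′∈ , y∈″ = find (∈-concatMap⁻ f {xs = xs} y∈′) in All.lookup x∉ x′∈ (disjoint y∈ y∈″)

count : {A : Set} {P : A → Set} → Decidable P → List A → ℕ
count P? xs = length (filter P? xs)

count-mono : {A : Set} {P Q : A → Set} (P? : Decidable P) (Q? : Decidable Q) {xs : List A} → Unique xs →
             (∀ {x} → x ∈ xs → P x → Q x) → count P? xs ℕ.≤ count Q? xs
count-mono P? Q? {xs} xs! P⇒Q = length-⊆ (Unique.filter⁺ P? xs!) λ y∈ →
  let y∈xs , py = ∈-filter⁻ P? {xs = xs} y∈ in ∈-filter⁺ Q? y∈xs (P⇒Q y∈xs py)

-- The weight `w` is a cleared denominator: all probabilities are kept as inequalities between
-- products in ℕ, with `w` a power of the number of cells and `b` a multiple of the size of the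
-- family.
union-bound : {A C : Set} {P : A → Set} (P? : Decidable P) {Q : C → A → Set} (Q? : ∀ c → Decidable (Q c)) →
              ∀ {xs} → Unique xs → ∀ cs → (∀ {x} → x ∈ xs → P x → ∃[ c ] c ∈ cs × Q c x) →
              ∀ w b → (∀ {c} → c ∈ cs → w ℕ.* count (Q? c) xs ℕ.≤ b) →
              w ℕ.* count P? xs ℕ.≤ length cs ℕ.* b
union-bound P? Q? {xs} xs! cs cover w b h = ℕₚ.≤-trans
  (ℕₚ.*-monoʳ-≤ w (length-⊆ (Unique.filter⁺ P? xs!) λ y∈ →
    let y∈xs , py = ∈-filter⁻ P? {xs = xs} y∈
        c , c∈ , qcy = cover y∈xs py
    in ∈-concatMap (λ c → filter (Q? c) xs) c∈ (∈-filter⁺ (Q? c) y∈xs qcy)))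
  (*-length-concatMap (λ c → filter (Q? c) xs) w b cs h)

module _ {A B : Set} {R S : A → B → Set} (R? : ∀ x → Decidable (R x)) (S? : ∀ x → Decidable (S x)) where

  pairs : {T : A → B → Set} → (∀ x → Decidable (T x)) → List A → List B → List (A × B)
  pairs T? xs bs = concatMap (λ x → map (x ,_) (filter (T? x) bs)) xs

  pairs-unique : {T : A → B → Set} (T? : ∀ x → Decidable (T x)) {xs : List A} {bs : List B} →
                 Unique xs → Unique bs → Unique (pairs T? xs bs)
  pairs-unique T? xs! bs! = concatMap-unique _
    (λ y∈ y∈′ → let _ , _ , eq = ∈-map⁻ _ y∈ ; _ , _ , eq′ = ∈-map⁻ _ y∈′ in ,-injectiveˡ (trans (sym eq) eq′))
    (λ x → Unique.map⁺ ,-injectiveʳ (Unique.filter⁺ (T? x) bs!)) xs!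

  -- The linked pairs are counted from both ends. Different `b` may send different `x` to the same
  -- array, so the image pair keeps `b`; injectivity of each single `g b` then suffices.
  double-counting : (g : B → A → A) {xs ys : List A} {bs : List B} → Unique xs → Unique bs →
    (∀ b {x x′} → g b x ≡ g b x′ → x ≡ x′) →
    (∀ {x b} → x ∈ xs → R x b → g b x ∈ ys × S (g b x) b) →
    ∀ K M → (∀ {x} → x ∈ xs → K ℕ.≤ count (R? x) bs) → (∀ {y} → y ∈ ys → count (S? y) bs ℕ.≤ M) →
    length xs ℕ.* K ℕ.≤ length ys ℕ.* M
  double-counting g {xs} {ys} {bs} xs! bs! g-inj R⇒S K M lower upper = begin
    length xs ℕ.* K                   ≤⟨ length-concatMap-≥ _ K xs (λ {x} x∈ → ℕₚ.≤-trans (lower x∈) (ℕₚ.≤-reflexive (sym (length-map (x ,_) (filter (R? x) bs))))) ⟩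
    length (pairs R? xs bs)         ≡⟨ length-map g′ (pairs R? xs bs) ⟨
    length (map g′ (pairs R? xs bs)) ≤⟨ length-⊆ (Unique.map⁺ g′-inj (pairs-unique R? xs! bs!)) image⊆ ⟩
    length (pairs S? ys bs)         ≤⟨ length-concatMap-≤ _ M ys (λ {y} y∈ → ℕₚ.≤-trans (ℕₚ.≤-reflexive (length-map (y ,_) (filter (S? y) bs))) (upper y∈)) ⟩
    length ys ℕ.* M                   ∎
    where
    open ℕₚ.≤-Reasoning
    g′ : A × B → A × B
    g′ (x , b) = g b x , b
    g′-inj : ∀ {p q} → g′ p ≡ g′ q → p ≡ q
    g′-inj {x , b} {x′ , b′} eq with ,-injective eq
    ... | eqˣ , refl = cong (_, b) (g-inj b eqˣ)
    image⊆ : map g′ (pairs R? xs bs) ⊆ pairs S? ys bs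
    image⊆ p∈ with ∈-map⁻ g′ p∈
    ... | (x , b) , xb∈ , refl with find (∈-concatMap⁻ _ {xs = xs} xb∈)
    ...   | x′ , x′∈ , xb∈′ with ∈-map⁻ (x′ ,_) xb∈′
    ...     | _ , b∈ , refl with ∈-filter⁻ (R? x) {xs = bs} b∈
    ...       | b∈bs , rxb with R⇒S x′∈ rxb
    ...         | y∈ , s = ∈-concatMap _ y∈ (∈-map⁺ (_ ,_) (∈-filter⁺ (S? _) b∈bs s))

module _ {A : Set} (_≟_ : ∀ (x y : A) → Dec (x ≡ y)) where

  length-remove : (g : A → A) → (∀ {x y} → g x ≡ g y → x ≡ y) → ∀ z {xs} → Unique xs →
                  length xs ℕ.≤ suc (count (λ x → ¬? (g x ≟ z)) xs)
  length-remove g g-inj z [] = z≤n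
  length-remove g g-inj z {x ∷ xs} (x∉ ∷ xs!) with g x ≟ z
  ... | no _    = s≤s (length-remove g g-inj z xs!)
  ... | yes gx≡ = s≤s (ℕₚ.≤-reflexive (cong length (sym (filter-all (λ y → ¬? (g y ≟ z))
          (All.map (λ x≢y gy≡ → x≢y (g-inj (trans gx≡ (sym gy≡)))) x∉)))))

  avoid-pairs : (gzs : List ((A → A) × A)) → (∀ {g z} → (g , z) ∈ gzs → ∀ {x y} → g x ≡ g y → x ≡ y) →
                ∀ {xs} → Unique xs → length gzs ℕ.< length xs →
                ∃[ x ] x ∈ xs × (∀ {g z} → (g , z) ∈ gzs → g x ≢ z)
  avoid-pairs [] _ {x ∷ _} _ _ = x , here refl , λ ()
  avoid-pairs ((g , z) ∷ gzs) inj {xs} xs! < with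
    avoid-pairs gzs (inj ∘ there) (Unique.filter⁺ (λ x → ¬? (g x ≟ z)) xs!)
      (ℕₚ.≤-pred (ℕₚ.≤-trans < (length-remove g (inj (here refl)) z xs!)))
  ... | x , x∈ , avoids with ∈-filter⁻ (λ x → ¬? (g x ≟ z)) {xs = xs} x∈
  ...   | x∈xs , gx≢z = x , x∈xs , λ { (here refl) → gx≢z ; (there gz∈) → avoids gz∈ }

  abstract

    -- Each pair of an injective map and a forbidden value excludes at most one point.
    avoid : (gs : List (A → A)) → (∀ {g} → g ∈ gs → ∀ {x y} → g x ≡ g y → x ≡ y) → ∀ zs →
            ∀ {xs : List A} → Unique xs → length gs ℕ.* length zs ℕ.< length xs →
            ∃[ x ] (∀ {g z} → g ∈ gs → z ∈ zs → g x ≢ z)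
    avoid gs inj zs xs! < with avoid-pairs (cartesianProduct gs zs) (inj ∘ proj₁ ∘ ∈-cartesianProduct⁻ gs zs) xs!
                                 (subst (ℕ._< _) (sym (length-cartesianProduct gs zs)) <)
    ... | x , _ , avoids = x , λ g∈ z∈ → avoids (∈-cartesianProduct⁺ g∈ z∈)

-- Maps that commute with a cyclic rotation or reverse it

module Rotation {S : Set} (R R⁻¹ : S → S) (R-R⁻¹ : ∀ x → R (R⁻¹ x) ≡ x) (R⁻¹-R : ∀ x → R⁻¹ (R x) ≡ x)
                (R-cyclic : SingleCycle R) where

  turn : Bool → S → S
  turn true  = R
  turn false = R⁻¹

  power : Bool → ℕ → S → S
  power o e x = fold x (turn o) e

  turn-inverse : ∀ o x → turn o (turn (not o) x) ≡ x
  turn-inverse true  = R-R⁻¹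
  turn-inverse false = R⁻¹-R

  turn-comm : ∀ o o′ x → turn o (turn o′ x) ≡ turn o′ (turn o x)
  turn-comm true  true  x = refl
  turn-comm true  false x = trans (R-R⁻¹ x) (sym (R⁻¹-R x))
  turn-comm false true  x = trans (R⁻¹-R x) (sym (R-R⁻¹ x))
  turn-comm false false x = refl

  power-turn : ∀ o o′ e x → power o e (turn o′ x) ≡ turn o′ (power o e x)
  power-turn o o′ zero    x = refl
  power-turn o o′ (suc e) x = trans (cong (turn o) (power-turn o o′ e x)) (turn-comm o o′ (power o e x))

  power-comm : ∀ o o′ p q x → power o p (power o′ q x) ≡ power o′ q (power o p x)
  power-comm o o′ p zero    x = refl
  power-comm o o′ p (suc q) x = trans (power-turn o o′ p (power o′ q x)) (cong (turn o′) (power-comm o o′ p q x))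

  power-inverse : ∀ o p x → power o p (power (not o) p x) ≡ x
  power-inverse o zero    x = refl
  power-inverse o (suc p) x = trans (cong (turn o) (power-turn o (not o) p (power (not o) p x)))
    (trans (turn-inverse o _) (power-inverse o p x))

  power-inverse′ : ∀ o p x → power (not o) p (power o p x) ≡ x
  power-inverse′ true  = power-inverse false
  power-inverse′ false = power-inverse true

  module _ (p q : ℕ) where

    -- This is congruence of `p` and `q` modulo the length of the cycle, expressed without naming
    -- the length. Since powers commute, it depends neither on the point nor on the direction
    -- (`same-power`).
    SamePower : Bool → S → Set
    SamePower o x = power o p x ≡ power o q x

    same-everywhere : ∀ o {x} → SamePower o x → ∀ y → SamePower o y
    same-everywhere o {x} eq y with R-cyclic x y
    ... | e , refl = trans (power-comm o true p e x) (trans (cong (power true e) eq) (sym (power-comm o true q e x)))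

    same-reverse : ∀ o → (∀ y → SamePower o y) → ∀ y → SamePower (not o) y
    same-reverse o eq y = begin
      power (not o) p y                                  ≡⟨ cong (power (not o) p) (power-inverse o q y) ⟨
      power (not o) p (power o q (power (not o) q y))    ≡⟨ cong (power (not o) p) (eq (power (not o) q y)) ⟨
      power (not o) p (power o p (power (not o) q y))    ≡⟨ power-inverse′ o p _ ⟩
      power (not o) q y                                  ∎
      where open ≡-Reasoning

    same-power : ∀ o o′ {x} y → SamePower o x → SamePower o′ y
    same-power true  true  y eq = same-everywhere true eq y
    same-power true  false y eq = same-reverse true (same-everywhere true eq) y
    same-power false true  y eq = same-reverse false (same-everywhere false eq) y
    same-power false false y eq = same-everywhere false eq y

  Equivariant : Bool → (S → S) → Set
  Equivariant o φ = ∀ x → φ (R x) ≡ turn o (φ x)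

  module _ (o : Bool) (φ : S → S) (eqv : Equivariant o φ) where

    equivariant-power : ∀ e x → φ (power true e x) ≡ power o e (φ x)
    equivariant-power zero    x = refl
    equivariant-power (suc e) x = trans (eqv _) (cong (turn o) (equivariant-power e x))

    -- If `y` is `e` steps from `x`, equality of the images says that `e` is congruent to 0 modulo
    -- the cycle length, in whichever direction it was read; hence `y` is `x` again.
    equivariant-injective : ∀ {x y} → φ x ≡ φ y → x ≡ y
    equivariant-injective {x} {y} eq with R-cyclic x y
    ... | e , refl = sym (same-power e 0 o true x (trans (sym (equivariant-power e x)) (sym eq)))

    equivariant-unique : ∀ ψ → Equivariant o ψ → ∀ x → φ x ≡ ψ x → φ ≗ ψ
    equivariant-unique ψ eqv′ x eq y with R-cyclic x y
    ... | e , refl = trans (equivariant-power e x) (trans (cong (power o e) eq) (sym (ψ-power e)))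
      where
      ψ-power : ∀ e → ψ (power true e x) ≡ power o e (ψ x)
      ψ-power zero    = refl
      ψ-power (suc e) = trans (eqv′ _) (cong (turn o) (ψ-power e))

  -- The one map of orientation `o` that sends `x` to `y`. The number of steps supplied by
  -- `R-cyclic` is arbitrary, but any two choices are congruent modulo the cycle length. With
  -- `equivariant-unique`, an orientation and one value parametrise all equivariant maps.
  extend : Bool → S → S → S → S
  extend o x y x′ = power o (proj₁ (R-cyclic x x′)) y

  extend-base : ∀ o x y → extend o x y x ≡ y
  extend-base o x y = same-power (proj₁ (R-cyclic x x)) 0 true o y (proj₂ (R-cyclic x x))

  extend-equivariant : ∀ o x y → Equivariant o (extend o x y)
  extend-equivariant o x y x′ with R-cyclic x x′ | R-cyclic x (R x′)
  -- Both `e′` and `suc e` steps lead from `x` to `R x′`, so they are congruent.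
  ... | e , refl | e′ , eq = same-power e′ (suc e) true o y eq

-- Cells and signed cells

members : ∀ {n} (p : Subset n) → List (∃[ i ] i Subset.∈ p)
members []          = []
members (true ∷ p)  = (zero , here) ∷ map (λ (i , i∈) → suc i , there i∈) (members p)
members (false ∷ p) = map (λ (i , i∈) → suc i , there i∈) (members p)

length-members : ∀ {n} (p : Subset n) → length (members p) ≡ ∣ p ∣
length-members []          = refl
length-members (true ∷ p)  = cong suc (trans (length-map _ (members p)) (length-members p))
length-members (false ∷ p) = trans (length-map _ (members p)) (length-members p)

∈-members : ∀ {n} (p : Subset n) {i} (i∈ : i Subset.∈ p) → (i , i∈) ∈ members p
∈-members (true ∷ p)  here       = here refl
∈-members (true ∷ p)  (there i∈) = there (∈-map⁺ _ (∈-members p i∈))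
∈-members (false ∷ p) (there i∈) = ∈-map⁺ _ (∈-members p i∈)

members-unique : ∀ {n} (p : Subset n) → Unique (members p)
members-unique []          = []
members-unique (true ∷ p)  = Allₚ.map⁺ (All.universal (λ _ ()) (members p)) ∷ Unique.map⁺ (λ { refl → refl }) (members-unique p)
members-unique (false ∷ p) = Unique.map⁺ (λ { refl → refl }) (members-unique p)

module _ {m n : ℕ} {B : Cells m n} where

  _≟ᶜ_ : (a b : Cell B) → Dec (a ≡ b)
  a ≟ᶜ b = map′ Cell-≡ (cong position) (≡-dec _≟ᶠ_ _≟ᶠ_ (position a) (position b))

  rowCells : Fin m → List (Cell B)
  rowCells i = map (λ (j , j∈) → cell i j j∈) (members (lookup B i))

  columnCells : Fin n → List (Cell B)
  columnCells j = map (λ (i , i∈) → cell i j (lookup⇒[]= j (lookup B i)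
    (trans (sym (lookup-map i (λ r → lookup r j) B)) ([]=⇒lookup i∈)))) (members (column B j))

  rowCells-row : ∀ {i a} → a ∈ rowCells i → row a ≡ i
  rowCells-row a∈ with ∈-map⁻ _ a∈
  ... | _ , _ , refl = refl

  columnCells-col : ∀ {j a} → a ∈ columnCells j → col a ≡ j
  columnCells-col a∈ with ∈-map⁻ _ a∈
  ... | _ , _ , refl = refl

  ∈-columnCells : ∀ a → a ∈ columnCells (col a)
  ∈-columnCells (cell i j j∈) = subst (_∈ columnCells j) (Cell-≡ refl) (∈-map⁺ _ (∈-members (column B j)
    (lookup⇒[]= i (column B j) (trans (lookup-map i (λ r → lookup r j) B) ([]=⇒lookup j∈)))))

  rowCells-unique : ∀ i → Unique (rowCells i)
  rowCells-unique i = Unique.map⁺ (λ { refl → refl }) (members-unique (lookup B i))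

  columnCells-unique : ∀ j → Unique (columnCells j)
  columnCells-unique j = Unique.map⁺ (λ { {_ , p} {_ , q} eq → pair-≡ (cong row eq) }) (members-unique (column B j))
    where
    pair-≡ : ∀ {x y : ∃[ i ] i Subset.∈ column B j} → proj₁ x ≡ proj₁ y → x ≡ y
    pair-≡ {_ , p} {_ , q} refl = cong (_ ,_) ([]=-irrelevant p q)

  cells : List (Cell B)
  cells = concatMap columnCells (allFin n)

  ∈-cells : ∀ a → a ∈ cells
  ∈-cells a = ∈-concatMap columnCells (∈-allFin (col a)) (∈-columnCells a)

  cells-unique : Unique cells
  cells-unique = concatMap-unique columnCells
    (λ a∈ a∈′ → trans (sym (columnCells-col a∈)) (columnCells-col a∈′)) columnCells-unique (Unique.allFin⁺ n)

  module _ {k : ℕ} (regular : ∀ j → ∣ column B j ∣ ≡ k) where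

    length-columnCells : ∀ j → length (columnCells j) ≡ k
    length-columnCells j = trans (length-map _ (members (column B j))) (trans (length-members (column B j)) (regular j))

    length-cells-columns : length cells ≡ n ℕ.* k
    length-cells-columns = trans (ℕₚ.≤-antisym
      (length-concatMap-≤ columnCells k (allFin n) (λ {j} _ → ℕₚ.≤-reflexive (length-columnCells j)))
      (length-concatMap-≥ columnCells k (allFin n) (λ {j} _ → ℕₚ.≤-reflexive (sym (length-columnCells j)))))
      (cong (ℕ._* k) (length-tabulate {n = n} id))

  module _ {h : ℕ} (regular : ∀ i → ∣ lookup B i ∣ ≡ h) where

    length-rowCells : ∀ i → length (rowCells i) ≡ h
    length-rowCells i = trans (length-map _ (members (lookup B i))) (trans (length-members (lookup B i)) (regular i))

    -- With `h ≥ 3` this gives 3m ≤ N, one half of the bound on m + n behind `switch-count`.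
    length-cells-rows : m ℕ.* h ℕ.≤ length cells
    length-cells-rows = ℕₚ.≤-trans (ℕₚ.≤-reflexive (cong (ℕ._* h) (sym (length-tabulate {n = m} id))))
      (ℕₚ.≤-trans (length-concatMap-≥ rowCells h (allFin m) (λ {i} _ → ℕₚ.≤-reflexive (sym (length-rowCells i))))
        (length-⊆ (concatMap-unique rowCells (λ a∈ a∈′ → trans (sym (rowCells-row a∈)) (rowCells-row a∈′))
            rowCells-unique (Unique.allFin⁺ m))
          (λ _ → ∈-cells _)))

fold-involutive : {A : Set} (f : A → A) {a : A} → f (f a) ≡ a → ∀ s → fold a f s ∈ a ∷ f a ∷ []
fold-involutive f ffa≡a zero    = here refl
fold-involutive f ffa≡a (suc s) with fold-involutive f ffa≡a s
... | here eq         = there (here (cong f eq))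
... | there (here eq) = here (trans (cong f eq) ffa≡a)

-- The orbit of `a` is its whole fibre; were `a` fixed by two steps, the orbit would have at most
-- two points.
no-2-cycle : {A I : Set} {f : A → I} {π : A ↔ A} → CyclesAlong f π → ∀ a {xs} → Unique xs →
             (∀ {x} → x ∈ xs → f x ≡ f a) → length xs ℕ.≥ 3 → Inverse.to π (Inverse.to π a) ≢ a
no-2-cycle {π = π} cyc a {xs} xs! along 3≤ ππa≡a = contradiction
  (ℕₚ.≤-trans 3≤ (length-⊆ xs! xs⊆)) (λ { (s≤s (s≤s ())) })
  where
  xs⊆ : xs ⊆ a ∷ Inverse.to π a ∷ []
  xs⊆ x∈ with CyclesAlong.transitive cyc a _ (sym (along x∈))
  ... | s , eq = subst (_∈ _) eq (fold-involutive (Inverse.to π) ππa≡a s)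

from-preserves : {A I : Set} {f : A → I} {π : A ↔ A} → CyclesAlong f π → ∀ x → f (Inverse.from π x) ≡ f x
from-preserves {f = f} {π} cyc x =
  trans (sym (CyclesAlong.preserves cyc _)) (cong f (Inverse.strictlyInverseˡ π x))

-- A signed cell stands for plus or minus the entry it holds. For `D` in the family these are the
-- neighbours of 0, but the type does not mention `D`: one list of maps of signed cells serves all
-- arrays in the union bound.
data SignedCell {m n} (B : Cells m n) : Set where
  plus minus : Cell B → SignedCell B

module _ {m n : ℕ} {B : Cells m n} where

  neg : SignedCell B → SignedCell B
  neg (plus a)  = minus a
  neg (minus a) = plus a

  ∣_∣ᶜ : SignedCell B → Cell B
  ∣ plus a ∣ᶜ  = a
  ∣ minus a ∣ᶜ = a

  same-cell : ∀ {x y} → ∣ x ∣ᶜ ≡ ∣ y ∣ᶜ → x ≡ y ⊎ x ≡ neg y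
  same-cell {plus a}  {plus a}  refl = inj₁ refl
  same-cell {plus a}  {minus a} refl = inj₂ refl
  same-cell {minus a} {plus a}  refl = inj₂ refl
  same-cell {minus a} {minus a} refl = inj₁ refl

  _≟ˢ_ : (x y : SignedCell B) → Dec (x ≡ y)
  plus a  ≟ˢ plus b  = map′ (cong plus) (λ { refl → refl }) (a ≟ᶜ b)
  plus a  ≟ˢ minus b = no λ ()
  minus a ≟ˢ plus b  = no λ ()
  minus a ≟ˢ minus b = map′ (cong minus) (λ { refl → refl }) (a ≟ᶜ b)

  signedCells : List (SignedCell B)
  signedCells = map plus cells ++ map minus cells

  ∈-signedCells : ∀ x → x ∈ signedCells
  ∈-signedCells (plus a)  = ∈-++⁺ˡ (∈-map⁺ plus (∈-cells a))
  ∈-signedCells (minus a) = ∈-++⁺ʳ (map plus cells) (∈-map⁺ minus (∈-cells a))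

  signedCells-unique : Unique signedCells
  signedCells-unique = Unique.++⁺ (Unique.map⁺ (λ { refl → refl }) cells-unique)
    (Unique.map⁺ (λ { refl → refl }) cells-unique) disjoint
    where
    disjoint : ∀ {x} → ¬ (x ∈ map plus cells × x ∈ map minus cells)
    disjoint (x∈ , x∈′) with ∈-map⁻ plus x∈ | ∈-map⁻ minus x∈′
    ... | _ , _ , refl | _ , _ , ()

  length-signedCells : length signedCells ≡ 2 ℕ.* length (cells {B = B})
  length-signedCells = trans (length-++ (map plus (cells {B = B}))) (cong₂ ℕ._+_ (length-map plus (cells {B = B}))
    (trans (length-map minus (cells {B = B})) (sym (ℕₚ.+-identityʳ _))))

module SignedRotation {m n : ℕ} {B : Cells m n} (αr : RowOrdering B) (αc : ColumnOrdering B)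
                      (compatible : Compatible αr αc) where

  open Inverse (proj₁ αr) public using () renaming
    (to to r; from to r⁻¹; strictlyInverseˡ to r-r⁻¹; strictlyInverseʳ to r⁻¹-r)
  open Inverse (proj₁ αc) public using () renaming
    (to to c; from to c⁻¹; strictlyInverseˡ to c-c⁻¹; strictlyInverseʳ to c⁻¹-c)

  -- The rotation `ρ₀` at the vertex 0, read on signed cells; `ρ-sval` identifies the two.
  rotate rotate⁻¹ : SignedCell B → SignedCell B
  rotate (plus a)    = minus (r a)
  rotate (minus a)   = plus (c a)
  rotate⁻¹ (plus a)  = minus (c⁻¹ a)
  rotate⁻¹ (minus a) = plus (r⁻¹ a)

  rotate-rotate⁻¹ : ∀ x → rotate (rotate⁻¹ x) ≡ x
  rotate-rotate⁻¹ (plus a)  = cong plus (c-c⁻¹ a)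
  rotate-rotate⁻¹ (minus a) = cong minus (r-r⁻¹ a)

  rotate⁻¹-rotate : ∀ x → rotate⁻¹ (rotate x) ≡ x
  rotate⁻¹-rotate (plus a)  = cong plus (r⁻¹-r a)
  rotate⁻¹-rotate (minus a) = cong minus (c⁻¹-c a)

  -- Two steps lead from `minus a` through `plus (c a)` to `minus (r (c a))`, so compatibility makes
  -- all of `minus` one orbit of the squared rotation.
  minus-to-minus : ∀ a b → ∃[ s ] fold (minus a) rotate s ≡ minus b
  minus-to-minus a b with compatible a b
  ... | s , eq = s ℕ.+ s , trans (fold-twice rotate (r ∘ c) minus (λ _ → refl) a s) (cong minus eq)

  from-minus : ∀ a y → ∃[ s ] fold (minus a) rotate s ≡ y
  from-minus a (minus b) = minus-to-minus a b
  from-minus a (plus b) with minus-to-minus a (c⁻¹ b)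
  ... | s , eq = suc s , trans (cong rotate eq) (cong plus (c-c⁻¹ b))

  rotate-cyclic : SingleCycle rotate
  rotate-cyclic (minus a) y = from-minus a y
  rotate-cyclic (plus a) y with from-minus (r a) y
  ... | s , eq = suc s , trans (sym (fold-suc rotate (plus a) s)) eq

  open Rotation rotate rotate⁻¹ rotate-rotate⁻¹ rotate⁻¹-rotate rotate-cyclic public

  module _ {h k : ℕ} (h≥3 : h ℕ.≥ 3) (k≥3 : k ℕ.≥ 3)
           (regular : (∀ i → ∣ lookup B i ∣ ≡ h) × (∀ j → ∣ column B j ∣ ≡ k)) where

    r²≢ : ∀ a → r (r a) ≢ a
    r²≢ a = no-2-cycle (proj₂ αr) a (rowCells-unique (row a)) (rowCells-row {B = B})
      (subst (ℕ._≥ 3) (sym (length-rowCells {B = B} (proj₁ regular) (row a))) h≥3)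

    c²≢ : ∀ a → c (c a) ≢ a
    c²≢ a = no-2-cycle (proj₂ αc) a (columnCells-unique (col a)) (columnCells-col {B = B})
      (subst (ℕ._≥ 3) (sym (length-columnCells {B = B} (proj₂ regular) (col a))) k≥3)

    r≢ : ∀ a → r a ≢ a
    r≢ a eq = r²≢ a (trans (cong r eq) eq)

    c≢ : ∀ a → c a ≢ a
    c≢ a eq = c²≢ a (trans (cong c eq) eq)

    -- A row and a column meet in one cell only, so a step along the row of `a` and a step along its
    -- column never lead to the same cell unless they stay at `a`.
    crossing : ∀ {a x y : Cell B} → row x ≡ row a → col y ≡ col a → x ≡ y → x ≡ a
    crossing rx cy refl = Cell-≡ (cong₂ _,_ rx cy)

    r≢c : ∀ a → r a ≢ c a
    r≢c a eq = r≢ a (crossing (CyclesAlong.preserves (proj₂ αr) a) (CyclesAlong.preserves (proj₂ αc) a) eq)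

    r≢c⁻¹ : ∀ a → r a ≢ c⁻¹ a
    r≢c⁻¹ a eq = r≢ a (crossing (CyclesAlong.preserves (proj₂ αr) a) (from-preserves (proj₂ αc) a) eq)

    r⁻¹≢c : ∀ a → r⁻¹ a ≢ c a
    r⁻¹≢c a eq = c≢ a (trans (sym eq) (crossing (from-preserves (proj₂ αr) a) (CyclesAlong.preserves (proj₂ αc) a) eq))

    rotate-neg : ∀ x → rotate (neg x) ≢ neg (rotate x)
    rotate-neg (plus a)  eq = r≢c a (cong ∣_∣ᶜ (sym eq))
    rotate-neg (minus a) eq = r≢c a (cong ∣_∣ᶜ eq)

    rotate⁻¹≢rotate : ∀ x → rotate⁻¹ x ≢ rotate x
    rotate⁻¹≢rotate (plus a)  eq = r≢c⁻¹ a (cong ∣_∣ᶜ (sym eq))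
    rotate⁻¹≢rotate (minus a) eq = r⁻¹≢c a (cong ∣_∣ᶜ eq)

    rotate⁻¹≢neg-rotate : ∀ x → rotate⁻¹ x ≢ neg (rotate x)
    rotate⁻¹≢neg-rotate (plus a)  ()
    rotate⁻¹≢neg-rotate (minus a) ()

    rotate⁻¹-neg : ∀ x → rotate⁻¹ (neg x) ≢ neg (rotate x)
    rotate⁻¹-neg (plus a)  eq = r²≢ a (trans (cong (r ∘ ∣_∣ᶜ) (sym eq)) (r-r⁻¹ a))
    rotate⁻¹-neg (minus a) eq = c²≢ a (trans (cong (c ∘ ∣_∣ᶜ) (sym eq)) (c-c⁻¹ a))

    rotate⁻¹-neg≢rotate : ∀ x → rotate⁻¹ (neg x) ≢ rotate x
    rotate⁻¹-neg≢rotate (plus a)  ()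
    rotate⁻¹-neg≢rotate (minus a) ()

    Moves : (SignedCell B → SignedCell B) → SignedCell B → Set
    Moves φ x = φ x ≢ x × φ x ≢ neg x

    -- If `φ` keeps the cell of `x`, equivariance turns `φ (rotate x)` into `rotate (neg x)`,
    -- `rotate⁻¹ x` or `rotate⁻¹ (neg x)`, apart from the excluded fixed point. None of these lies
    -- in the cell of `rotate x`; for the last one this says that `r` and `c` have no 2-cycles.
    moves-x-or-rotate : ∀ {o φ} → Equivariant o φ → (o ≡ true → ∀ x → φ x ≢ x) → ∀ x → Moves φ x ⊎ Moves φ (rotate x)
    moves-x-or-rotate {o} {φ} eqv nontrivial x with φ x ≟ˢ x | φ x ≟ˢ neg x
    ... | no ≢x | no ≢neg = inj₁ (≢x , ≢neg)
    moves-x-or-rotate {true}  eqv nontrivial x | yes ≡x | _ = contradiction ≡x (nontrivial refl x)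
    moves-x-or-rotate {false} eqv nontrivial x | yes ≡x | _ = inj₂
      ( (λ eq → rotate⁻¹≢rotate x (trans (trans (cong rotate⁻¹ (sym ≡x)) (sym (eqv x))) eq))
      , (λ eq → rotate⁻¹≢neg-rotate x (trans (trans (cong rotate⁻¹ (sym ≡x)) (sym (eqv x))) eq)) )
    moves-x-or-rotate {true}  eqv nontrivial x | _ | yes ≡neg = inj₂
      ( nontrivial refl (rotate x)
      , (λ eq → rotate-neg x (trans (trans (cong rotate (sym ≡neg)) (sym (eqv x))) eq)) )
    moves-x-or-rotate {false} eqv nontrivial x | _ | yes ≡neg = inj₂
      ( (λ eq → rotate⁻¹-neg≢rotate x (trans (trans (cong rotate⁻¹ (sym ≡neg)) (sym (eqv x))) eq))
      , (λ eq → rotate⁻¹-neg x (trans (trans (cong rotate⁻¹ (sym ≡neg)) (sym (eqv x))) eq)) )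

-- Automorphisms as maps of the signed cells

module SignedValues (v t : ℕ) .{{_ : NonZero v}} .{{_ : NonZero t}} {m n : ℕ} {B : Cells m n} where

  open Heffter v t
  open ModularArithmetic v using (ℤ/)
  open CommutativeRing ℤ/ using (-_)
  open import Algebra.Properties.Ring (CommutativeRing.ring ℤ/) using (-‿involutive)

  val : PFArray m n → Cell B → ℤᵥ
  val D a = value D (position a)

  sval : PFArray m n → SignedCell B → ℤᵥ
  sval D (plus a)  = val D a
  sval D (minus a) = - val D a

  sval-neg : ∀ D x → sval D (neg x) ≡ - sval D x
  sval-neg D (plus a)  = refl
  sval-neg D (minus a) = sym (-‿involutive (val D a))

module Automorphisms (v t : ℕ) .{{_ : NonZero v}} .{{_ : NonZero t}} {m n : ℕ} {B : Cells m n}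
    (αr : RowOrdering B) (αc : ColumnOrdering B) (compatible : Compatible αr αc) where

  open Heffter v t
  open ModularArithmetic v using (ℤ/; mod-toℕ; mod-cong; mod-⊕; +-modˡ; toℕ-mod)
  open CommutativeRing ℤ/ hiding (refl; sym; trans)
  open import Algebra.Properties.Ring ring using (-‿involutive; -0#≈0#)
  open SignedRotation αr αc compatible
  open SignedValues v t {B = B}

  module _ (D : PFArray m n) where

    module A = Archdeacon D αr αc

    -- Both sides are the image of sval D u + sval D i, reached by rotating about
    -- the vertex sval D u and about the vertex sval D i.
    Exchange : Bool → (SignedCell B → SignedCell B) → SignedCell B → SignedCell B → Set
    Exchange o φ u i = sval D (φ u) + sval D (extend o (neg u) (neg (φ u)) i) ≡
                       sval D (φ i) + sval D (extend o (neg i) (neg (φ i)) u)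

    Scaling : (SignedCell B → SignedCell B) → ℤᵥ → SignedCell B → Set
    Scaling φ c i = sval D (φ i) ≡ c * sval D i

  x-0≡x : ∀ x → x - 0# ≡ x
  x-0≡x x = trans (cong (x +_) -0#≈0#) (+-identityʳ x)

  J-+ : ∀ {x y} → J x → J y → J (x + y)
  J-+ (c , refl) (d , refl) = c + d , sym (distribʳ _ c d)

  J-*ˡ : ∀ {x} y → J x → J (y * x)
  J-*ˡ y (c , refl) = y * c , sym (*-assoc y c _)

  J-cancel : ∀ {x y} → J y → ¬ J x → ¬ J (y - x)
  J-cancel {x} {y} jy ¬jx j = ¬jx (subst J y-[y-x]≡x (J-+ jy (J-neg j)))
    where
    y-[y-x]≡x : y - (y - x) ≡ x
    y-[y-x]≡x = trans (cong (y +_) (-[y-x]≡x-y x y)) (x+[y-x]≡y y x)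

  module _ {h k : ℕ} {D : PFArray m n} (qh : IsQH h k D) (skel≡B : skel D ≡ B) where

    sval∉J : ∀ x → ¬ J (sval D x)
    sval∉J (plus a)  = A.val∉J D qh skel≡B a
    sval∉J (minus a) = A.-val∉J D qh skel≡B a

    ∉J⇒sval : ∀ {x} → ¬ J x → ∃[ y ] x ≡ sval D y
    ∉J⇒sval ¬j with A.∉J⇒signed D qh skel≡B ¬j
    ... | A.pos a = plus a , refl
    ... | A.neg a = minus a , refl

    sval-injective : ∀ {x y} → sval D x ≡ sval D y → x ≡ y
    sval-injective {plus a}  {plus b}  eq = cong plus (A.val-injective D qh skel≡B eq)
    sval-injective {plus a}  {minus b} eq = contradiction eq (A.val≢-val D qh skel≡B {a} {b})
    sval-injective {minus a} {plus b}  eq = contradiction (sym eq) (A.val≢-val D qh skel≡B {b} {a})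
    sval-injective {minus a} {minus b} eq = cong minus (A.val-injective D qh skel≡B
      (trans (sym (-‿involutive _)) (trans (cong -_ eq) (-‿involutive _))))

    ρ : Bool → ℤᵥ → ℤᵥ
    ρ true  = A.ρ₀ D
    ρ false = A.ρ₀⁻¹ D

    ρ-sval : ∀ o x → ρ o (sval D x) ≡ sval D (turn o x)
    ρ-sval true  (plus a)  = A.ρ₀-pos D qh skel≡B a
    ρ-sval true  (minus a) = A.ρ₀-neg D qh skel≡B a
    ρ-sval false (plus a)  = A.ρ₀⁻¹-pos D qh skel≡B a
    ρ-sval false (minus a) = A.ρ₀⁻¹-neg D qh skel≡B a

    module Fixing0 (x₀ : SignedCell B) (o : Bool) (f : ℤᵥ → ℤᵥ) (f0 : f 0# ≡ 0#)
                   (commutes : ∀ x y → ¬ J (y - x) → f (x + ρ true (y - x)) ≡ f x + ρ o (f y - f x))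
                   (φ : SignedCell B → SignedCell B) (f-sval : ∀ x → f (sval D x) ≡ sval D (φ x)) where

      -- The map induced at the vertex `sval D u`, whose neighbours are `sval D u + sval D i`. It is
      -- pinned down by its value at `neg u`: that neighbour is 0, which `f` fixes.
      around : SignedCell B → SignedCell B → SignedCell B
      around u = extend o (neg u) (neg (φ u))

      -- Induction along the rotation about `sval D u`, started at the neighbour 0; each step is one
      -- use of `commutes`.
      f-power : ∀ u e → f (sval D u + sval D (power true e (neg u))) ≡ sval D (φ u) + sval D (power o e (neg (φ u)))
      f-power u zero = trans (cong f (cancel u)) (trans f0 (sym (cancel (φ u))))
        where
        cancel : ∀ x → sval D x + sval D (neg x) ≡ 0#
        cancel x = trans (cong (sval D x +_) (sval-neg D x)) (-‿inverseʳ _)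
      f-power u (suc e) = begin
        f (su + sval D (rotate z))                   ≡⟨ cong (λ w → f (su + w)) (ρ-sval true z) ⟨
        f (su + ρ true (sval D z))                   ≡⟨ cong (λ w → f (su + ρ true w)) y-su ⟨
        f (su + ρ true (y - su))                     ≡⟨ commutes su y (subst (¬_ ∘ J) (sym y-su) (sval∉J z)) ⟩
        f su + ρ o (f y - f su)                      ≡⟨ cong (λ w → w + ρ o (f y - w)) (f-sval u) ⟩
        sval D (φ u) + ρ o (f y - sval D (φ u))      ≡⟨ cong (λ w → sval D (φ u) + ρ o (w - sval D (φ u))) (f-power u e) ⟩
        sval D (φ u) + ρ o (sval D (φ u) + sval D z′ - sval D (φ u))
                                                     ≡⟨ cong (λ w → sval D (φ u) + ρ o w) ([x+a]-x≡a _ _) ⟩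
        sval D (φ u) + ρ o (sval D z′)               ≡⟨ cong (sval D (φ u) +_) (ρ-sval o z′) ⟩
        sval D (φ u) + sval D (turn o z′)            ∎
        where
        open ≡-Reasoning
        su = sval D u
        z  = power true e (neg u)
        z′ = power o e (neg (φ u))
        y  = su + sval D z
        y-su : y - su ≡ sval D z
        y-su = [x+a]-x≡a su (sval D z)

      f-+ : ∀ u i → f (sval D u + sval D i) ≡ sval D (φ u) + sval D (around u i)
      f-+ u i = trans (cong (λ z → f (sval D u + sval D z)) (sym (proj₂ (rotate-cyclic (neg u) i)))) (f-power u (proj₁ (rotate-cyclic (neg u) i)))

      exchange : ∀ u i → Exchange D o φ u i
      exchange u i = trans (sym (f-+ u i)) (trans (cong f (+-comm (sval D u) (sval D i))) (f-+ i u))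

      φ-equivariant : Equivariant o φ
      φ-equivariant x = sval-injective (begin
        sval D (φ (rotate x))                ≡⟨ f-sval (rotate x) ⟨
        f (sval D (rotate x))                ≡⟨ cong f (ρ-sval true x) ⟨
        f (ρ true (sval D x))                ≡⟨ cong f (+-identityˡ _) ⟨
        f (0# + ρ true (sval D x))           ≡⟨ cong (λ z → f (0# + ρ true z)) (x-0≡x (sval D x)) ⟨
        f (0# + ρ true (sval D x - 0#))      ≡⟨ commutes 0# (sval D x) (subst (¬_ ∘ J) (sym (x-0≡x (sval D x))) (sval∉J x)) ⟩
        f 0# + ρ o (f (sval D x) - f 0#)     ≡⟨ cong (λ z → z + ρ o (f (sval D x) - z)) f0 ⟩
        0# + ρ o (f (sval D x) - 0#)         ≡⟨ +-identityˡ _ ⟩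
        ρ o (f (sval D x) - 0#)              ≡⟨ cong (ρ o) (x-0≡x (f (sval D x))) ⟩
        ρ o (f (sval D x))                   ≡⟨ cong (ρ o) (f-sval x) ⟩
        ρ o (sval D (φ x))                   ≡⟨ ρ-sval o (φ x) ⟩
        sval D (turn o (φ x))                ∎)
        where open ≡-Reasoning

      -- Outside J this is uniqueness at the vertex 0. Elements of J are not neighbours of 0, but
      -- they are neighbours of `sval D x₀`, and the map induced there fixes `neg x₀`, hence is the
      -- identity too.
      identity : o ≡ true → φ x₀ ≡ x₀ → ∀ y → f y ≡ y
      identity refl φx₀≡x₀ y with J? y
      ... | no ¬j with ∉J⇒sval ¬j
      ...   | x , refl = trans (f-sval x) (cong (sval D) (equivariant-unique true φ φ-equivariant id (λ _ → refl) x₀ φx₀≡x₀ x))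
      identity refl φx₀≡x₀ y | yes j with ∉J⇒sval (J-cancel j (sval∉J x₀))
      ... | i , eq = begin
        f y                                  ≡⟨ cong f split ⟩
        f (sval D x₀ + sval D i)             ≡⟨ f-+ x₀ i ⟩
        sval D (φ x₀) + sval D (around x₀ i) ≡⟨ cong₂ (λ x z → sval D x + sval D z) φx₀≡x₀
          (equivariant-unique true (around x₀) (extend-equivariant true (neg x₀) (neg (φ x₀))) id (λ _ → refl) (neg x₀)
            (trans (extend-base true (neg x₀) _) (cong neg φx₀≡x₀)) i) ⟩
        sval D x₀ + sval D i                 ≡⟨ split ⟨
        y                                    ∎
        where
        open ≡-Reasoning
        split : y ≡ sval D x₀ + sval D i
        split = sym (trans (cong (sval D x₀ +_) (sym eq)) (x+[y-x]≡y (sval D x₀) y))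

      module _ (odd : ∀ u → φ (neg u) ≡ neg (φ u)) where

        -- Both maps have orientation `o`, and oddness makes them agree at `neg u`.
        around≗φ : ∀ u → around u ≗ φ
        around≗φ u = equivariant-unique o (around u) (extend-equivariant o (neg u) (neg (φ u))) φ φ-equivariant (neg u)
          (trans (extend-base o (neg u) _) (sym (odd u)))

        additive : ∀ {x y} → ¬ J x → ¬ J y → f (x + y) ≡ f x + f y
        additive ¬jx ¬jy with ∉J⇒sval ¬jx | ∉J⇒sval ¬jy
        ... | u , refl | i , refl = trans (f-+ u i)
          (cong₂ _+_ (sym (f-sval u)) (trans (cong (sval D) (around≗φ u i)) (sym (f-sval i))))

        f-neg : ∀ {x} → ¬ J x → f (- x) ≡ - f x
        f-neg ¬j with ∉J⇒sval ¬j
        ... | u , refl = begin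
          f (- sval D u)           ≡⟨ cong f (sval-neg D u) ⟨
          f (sval D (neg u))       ≡⟨ f-sval (neg u) ⟩
          sval D (φ (neg u))       ≡⟨ cong (sval D) (odd u) ⟩
          sval D (neg (φ u))       ≡⟨ sval-neg D (φ u) ⟩
          - sval D (φ u)           ≡⟨ cong -_ (f-sval u) ⟨
          - f (sval D u)           ∎
          where open ≡-Reasoning

        -- J is an ideal, so if it contained 1 it would contain the entries as well.
        1∉J : ¬ J 1#
        1∉J j = sval∉J x₀ (subst J (*-identityʳ _) (J-*ˡ (sval D x₀) j))

        -1∉J : ¬ J (- 1#)
        -1∉J j = 1∉J (subst J (-‿involutive 1#) (J-neg j))

        -- `additive` only covers summands outside J. For `y` in J it is applied to `y + 1#` and
        -- `- 1#` instead, which are outside J and sum to `y`. From here linearity follows by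
        -- induction, 1 being a generator.
        f-+1 : ∀ y → f (y + 1#) ≡ f y + f 1#
        f-+1 y with J? y
        ... | no ¬j = additive ¬j 1∉J
        ... | yes j = sym (begin
          f y + f 1#                         ≡⟨ cong (λ z → f z + f 1#) (sym (y+1-1 y)) ⟩
          f (y + 1# - 1#) + f 1#             ≡⟨ cong (_+ f 1#) (additive y+1∉J -1∉J) ⟩
          f (y + 1#) + f (- 1#) + f 1#       ≡⟨ cong (λ z → f (y + 1#) + z + f 1#) (f-neg 1∉J) ⟩
          f (y + 1#) - f 1# + f 1#           ≡⟨ +-assoc _ _ _ ⟩
          f (y + 1#) + (- f 1# + f 1#)       ≡⟨ cong (f (y + 1#) +_) (-‿inverseˡ (f 1#)) ⟩
          f (y + 1#) + 0#                    ≡⟨ +-identityʳ _ ⟩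
          f (y + 1#)                         ∎)
          where
          open ≡-Reasoning
          y+1-1 : ∀ y → y + 1# - 1# ≡ y
          y+1-1 y = trans (+-assoc y 1# _) (trans (cong (y +_) (-‿inverseʳ 1#)) (+-identityʳ y))
          y+1∉J : ¬ J (y + 1#)
          y+1∉J = subst (¬_ ∘ J) (cong (y +_) (-‿involutive 1#)) (J-cancel j -1∉J)

        linear-mod : ∀ a → f (a mod v) ≡ f 1# * (a mod v)
        linear-mod zero    = trans f0 (sym (zeroʳ (f 1#)))
        linear-mod (suc a) = begin
          f (suc a mod v)                    ≡⟨ cong f suc-mod ⟩
          f (a mod v + 1#)                   ≡⟨ f-+1 (a mod v) ⟩
          f (a mod v) + f 1#                 ≡⟨ cong₂ _+_ (linear-mod a) (sym (*-identityʳ (f 1#))) ⟩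
          f 1# * (a mod v) + f 1# * 1#       ≡⟨ distribˡ (f 1#) _ _ ⟨
          f 1# * (a mod v + 1#)              ≡⟨ cong (f 1# *_) suc-mod ⟨
          f 1# * (suc a mod v)               ∎
          where
          open ≡-Reasoning
          suc-mod : suc a mod v ≡ a mod v + 1#
          suc-mod = sym (trans (mod-⊕ a 1#) (trans
            (cong (λ z → (a ℕ.+ z) mod v) (toℕ-mod 1))
            (mod-cong (trans (cong (_% v) (ℕₚ.+-comm a (1 % v))) (+-modˡ 1 a)))))

        scaling : ∃[ c ] ∀ i → Scaling D φ c i
        scaling = f 1# , λ i → trans (sym (f-sval i)) (linear (sval D i))
          where
          linear : ∀ x → f x ≡ f 1# * x
          linear x = subst (λ z → f z ≡ f 1# * z) (mod-toℕ x) (linear-mod (toℕ x))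

  -- What a nontrivial automorphism fixing 0 forces on the entries of D, where
  -- φ is the permutation it induces on the signed cells.
  record Symmetry (D : PFArray m n) (x₀ : SignedCell B) (o : Bool) (y : SignedCell B) : Set where
    φ : SignedCell B → SignedCell B
    φ = extend o x₀ y
    field
      nontrivial : o ≡ true → y ≢ x₀
      exchange   : ∀ u i → Exchange D o φ u i
      scaling    : (∀ u → φ (neg u) ≡ neg (φ u)) → ∃[ c ] ∀ i → Scaling D φ c i

  module _ {h k : ℕ} {D : PFArray m n} (x₀ : SignedCell B) where

    symmetry : (qh : IsQH h k D) (skel≡B : skel D ≡ B) → ∀ o (f : ℤᵥ → ℤᵥ) →
               (∀ x y → ¬ J (y - x) → ¬ J (f y - f x)) →
               (∀ x y → ¬ J (y - x) → f (x + ρ qh skel≡B true (y - x)) ≡ f x + ρ qh skel≡B o (f y - f x)) →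
               ¬ (∃[ a ] ∀ x → f x ≡ x + a) → ∃[ y ] Symmetry D x₀ o y
    symmetry qh skel≡B o f adj commutes ¬translation =
      normalised (λ x → proj₁ (f₀-sval x)) (λ x → proj₂ (f₀-sval x))
      where
      g = f 0#
      f₀ : ℤᵥ → ℤᵥ
      f₀ x = f x - g
      f₀-sval : ∀ x → ∃[ y ] f₀ (sval D x) ≡ sval D y
      f₀-sval x = ∉J⇒sval qh skel≡B (adj 0# (sval D x) (subst (¬_ ∘ J) (sym (x-0≡x (sval D x))) (sval∉J qh skel≡B x)))
      f₀-diff : ∀ x y → f₀ y - f₀ x ≡ f y - f x
      -- The rotations see only differences, which are untouched by subtracting `g`.
      f₀-diff x y = trans (cong (f y - g +_) (-[y-x]≡x-y g (f x)))
        (trans (+-assoc (f y) (- g) (g - f x)) (cong (f y +_)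
          (trans (sym (+-assoc (- g) g (- f x))) (trans (cong (_- f x) (-‿inverseˡ g)) (+-identityˡ (- f x))))))
      f≡f₀+g : ∀ x → f₀ x + g ≡ f x
      f≡f₀+g x = trans (+-assoc (f x) (- g) g) (trans (cong (f x +_) (-‿inverseˡ g)) (+-identityʳ (f x)))
      f₀-commutes : ∀ x y → ¬ J (y - x) → f₀ (x + ρ qh skel≡B true (y - x)) ≡ f₀ x + ρ qh skel≡B o (f₀ y - f₀ x)
      f₀-commutes x y xy = begin
        f (x + ρ qh skel≡B true (y - x)) - g ≡⟨ cong (_- g) (commutes x y xy) ⟩
        f x + w - g                          ≡⟨ +-assoc (f x) w (- g) ⟩
        f x + (w - g)                        ≡⟨ cong (f x +_) (+-comm w (- g)) ⟩
        f x + (- g + w)                      ≡⟨ +-assoc (f x) (- g) w ⟨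
        f₀ x + w                             ≡⟨ cong (λ z → f₀ x + ρ qh skel≡B o z) (f₀-diff x y) ⟨
        f₀ x + ρ qh skel≡B o (f₀ y - f₀ x)   ∎
        where
        open ≡-Reasoning
        w = ρ qh skel≡B o (f y - f x)
      normalised : (φ : SignedCell B → SignedCell B) → (∀ x → f₀ (sval D x) ≡ sval D (φ x)) → ∃[ y ] Symmetry D x₀ o y
      normalised φ f-sval = φ x₀ , record
        { nontrivial = λ o≡ φx₀≡ → ¬translation (g , λ x → trans (sym (f≡f₀+g x)) (cong (_+ g) (F.identity o≡ φx₀≡ x)))
        ; exchange   = λ u i → subst₂ _≡_
            (cong₂ (λ a b → sval D a + sval D (extend o (neg u) (neg b) i)) (ψ≗ u) (ψ≗ u))
            (cong₂ (λ a b → sval D a + sval D (extend o (neg i) (neg b) u)) (ψ≗ i) (ψ≗ i))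
            (F.exchange u i)
        ; scaling    = λ odd → let c , sc = F.scaling (λ u → trans (ψ≗ (neg u)) (trans (odd u) (cong neg (sym (ψ≗ u)))))
                               in c , λ i → trans (cong (sval D) (sym (ψ≗ i))) (sc i) }
        where
        module F = Fixing0 qh skel≡B x₀ o f₀ (-‿inverseʳ g) f₀-commutes φ f-sval
        -- `φ` was read off from `f` and `D`. Replacing it by an `extend` leaves only `o` and `φ x₀`
        -- as data, which makes the candidates a list independent of `D`.
        ψ≗ : φ ≗ extend o x₀ (φ x₀)
        ψ≗ = equivariant-unique o φ F.φ-equivariant (extend o x₀ (φ x₀)) (extend-equivariant o x₀ (φ x₀)) x₀
               (sym (extend-base o x₀ (φ x₀)))

    nonTranslation⇒symmetry : HasNonTranslation h k αr αc compatible D → ∃[ o ] ∃[ y ] Symmetry D x₀ o y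
    nonTranslation⇒symmetry (qh , skel≡B , σ , aut , ¬tr) with Search.toRaw h k αr αc compatible D qh skel≡B σ aut ¬tr
    ... | _ , adj , inj₁ com , ¬translation = true , symmetry qh skel≡B true _ (λ x y → proj₁ (adj x y)) com ¬translation
    ... | _ , adj , inj₂ com , ¬translation = false , symmetry qh skel≡B false _ (λ x y → proj₁ (adj x y)) com ¬translation

-- Switching two entries within the family

module _ {A : Set} {P : A → Set} (P? : Decidable P) where

  count-≤1 : ∀ {xs} → Unique xs → (∀ {x y} → P x → P y → x ≡ y) → count P? xs ℕ.≤ 1
  count-≤1 {xs} xs! same with filter P? xs in eq
  ... | []    = z≤n
  ... | x ∷ _ = subst (λ ys → length ys ℕ.≤ 1) eq (length-⊆ {ys = x ∷ []} (Unique.filter⁺ P? xs!) λ y∈ →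
    here (same (P-filter y∈) (P-filter (subst (x ∈_) (sym eq) (here refl)))))
    where
    P-filter : ∀ {y} → y ∈ filter P? xs → P y
    P-filter y∈ = proj₂ (∈-filter⁻ P? {xs = xs} y∈)

module Transposition {A : Set} (_≟_ : ∀ (x y : A) → Dec (x ≡ y)) (a b : A) where

  transpose : A → A
  transpose x with x ≟ a | x ≟ b
  ... | yes _ | _     = b
  ... | no _  | yes _ = a
  ... | no _  | no _  = x

  transpose-a : transpose a ≡ b
  transpose-a with a ≟ a | a ≟ b
  ... | yes _  | _ = refl
  ... | no a≢a | _ = contradiction refl a≢a

  transpose-b : transpose b ≡ a
  transpose-b with b ≟ a | b ≟ b
  ... | yes b≡a | _      = b≡a
  ... | no _    | yes _  = refl
  ... | no _    | no b≢b = contradiction refl b≢b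

  transpose-≢ : ∀ {x} → x ≢ a → x ≢ b → transpose x ≡ x
  transpose-≢ {x} x≢a x≢b with x ≟ a | x ≟ b
  ... | yes x≡a | _       = contradiction x≡a x≢a
  ... | no _    | yes x≡b = contradiction x≡b x≢b
  ... | no _    | no _    = refl

  data Cases (x : A) : Set where
    is-a  : x ≡ a → Cases x
    is-b  : x ≡ b → Cases x
    other : x ≢ a → x ≢ b → Cases x

  cases : ∀ x → Cases x
  cases x with x ≟ a | x ≟ b
  ... | yes x≡a | _       = is-a x≡a
  ... | no _    | yes x≡b = is-b x≡b
  ... | no x≢a  | no x≢b  = other x≢a x≢b

  transpose-involutive : ∀ x → transpose (transpose x) ≡ x
  transpose-involutive x with cases x
  ... | is-a refl     = trans (cong transpose transpose-a) transpose-b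
  ... | is-b refl     = trans (cong transpose transpose-b) transpose-a
  ... | other x≢a x≢b = trans (cong transpose (transpose-≢ x≢a x≢b)) (transpose-≢ x≢a x≢b)

  transpose-↭ : ∀ {xs} → Unique xs → (∀ x → x ∈ xs) → map transpose xs ↭ xs
  transpose-↭ xs! all = ∼bag⇒↭ (unique∧set⇒bag
    (Unique.map⁺ (λ {x} {y} eq → trans (sym (transpose-involutive x)) (trans (cong transpose eq) (transpose-involutive y))) xs!) xs!
    (mk⇔ (λ _ → all _) (λ _ → subst (_∈ _) (transpose-involutive _) (∈-map⁺ transpose (all _)))))

lookup-ext : {A : Set} {n : ℕ} {xs ys : Vec A n} → (∀ i → lookup xs i ≡ lookup ys i) → xs ≡ ys
lookup-ext {xs = xs} {ys} eq = trans (sym (tabulate∘lookup xs)) (trans (tabulate-cong eq) (tabulate∘lookup ys))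

module _ (v : ℕ) .{{_ : NonZero v}} where

  open ModularArithmetic v using (ℤ/)
  open CommutativeRing ℤ/ hiding (refl; sym; trans)
  open import Algebra.Properties.CommutativeMonoid.Sum +-commutativeMonoid

  sum-change : ∀ {p} (f g : Fin p → Fin v) j → (∀ i → i ≢ j → f i ≡ g i) → sum f + g j ≡ sum g + f j
  sum-change {suc p} f g j f≗g = begin
    sum f + g j                          ≡⟨ cong (_+ g j) (sum-remove {i = j} f) ⟩
    f j + sum (f ∘ punchIn j) + g j      ≡⟨ cong (λ z → f j + z + g j) (sum-cong-≗ (λ i → f≗g (punchIn j i) (punchInᵢ≢i j i))) ⟩
    f j + sum (g ∘ punchIn j) + g j      ≡⟨ +-assoc (f j) _ (g j) ⟩
    f j + (sum (g ∘ punchIn j) + g j)    ≡⟨ +-comm (f j) _ ⟩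
    sum (g ∘ punchIn j) + g j + f j      ≡⟨ cong (_+ f j) (+-comm _ (g j)) ⟩
    g j + sum (g ∘ punchIn j) + f j      ≡⟨ cong (_+ f j) (sum-remove {i = j} g) ⟨
    sum g + f j                          ∎
    where open ≡-Reasoning

  -- A row or a column is an injective e : Fin p → Pos.
  module _ {Pos : Set} (_≟_ : ∀ (x y : Pos) → Dec (x ≡ y)) (a b : Pos) {p : ℕ} (e : Fin p → Pos)
           (e-injective : ∀ {i j : Fin p} → e i ≡ e j → i ≡ j) (value : Pos → Fin v) where

    open Transposition _≟_ a b

    private
      S S′ : Fin v
      S  = sum (value ∘ e)
      S′ = sum (value ∘ transpose ∘ e)

    sum-transpose-both : ∀ {i j} → e i ≡ a → e j ≡ b → S′ ≡ S
    sum-transpose-both {i} {j} ei≡a ej≡b = trans (sum-cong-≗ (cong value ∘ sym ∘ e-transpose))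
      (sym (sum-permute (value ∘ e) (permutation T.transpose T.transpose T.transpose-involutive T.transpose-involutive)))
      where
      module T = Transposition _≟ᶠ_ i j
      e-transpose : ∀ x → e (T.transpose x) ≡ transpose (e x)
      e-transpose x with T.cases x
      ... | T.is-a refl = trans (cong e T.transpose-a) (trans ej≡b (trans (sym transpose-a) (cong transpose (sym ei≡a))))
      ... | T.is-b refl = trans (cong e T.transpose-b) (trans ei≡a (trans (sym transpose-b) (cong transpose (sym ej≡b))))
      ... | T.other x≢i x≢j = trans (cong e (T.transpose-≢ x≢i x≢j)) (sym (transpose-≢
              (λ eq → x≢i (e-injective (trans eq (sym ei≡a)))) (λ eq → x≢j (e-injective (trans eq (sym ej≡b))))))

    sum-transpose-a : ∀ {i} → e i ≡ a → (∀ j → e j ≢ b) → S′ + value a ≡ S + value b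
    sum-transpose-a {i} ei≡a e≢b = subst₂ (λ x y → S′ + value x ≡ S + value y) ei≡a
      (trans (cong transpose ei≡a) transpose-a)
      (sum-change (value ∘ transpose ∘ e) (value ∘ e) i λ j j≢i → cong value
        (transpose-≢ (λ eq → j≢i (e-injective (trans eq (sym ei≡a)))) (e≢b j)))

    sum-transpose-b : ∀ {j} → e j ≡ b → (∀ i → e i ≢ a) → S′ + value b ≡ S + value a
    sum-transpose-b {j} ej≡b e≢a = subst₂ (λ x y → S′ + value x ≡ S + value y) ej≡b
      (trans (cong transpose ej≡b) transpose-b)
      (sum-change (value ∘ transpose ∘ e) (value ∘ e) j λ i i≢j → cong value
        (transpose-≢ (e≢a i) (λ eq → i≢j (e-injective (trans eq (sym ej≡b))))))

    -- A line through both cells, or through neither, keeps its sum. A line through exactly one has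
    -- its sum shifted by the difference of the two values, with the sign depending on the cell, so
    -- it vanishes for a single value of `value b`.
    sum-transpose≢0 : S ≢ 0# → (∀ i → e i ≡ a → value b ≢ value a - S) → (∀ j → e j ≡ b → value b ≢ value a + S) →
                      S′ ≢ 0#
    sum-transpose≢0 S≢0 fromA fromB S′≡0 with any? (λ i → e i ≟ a) | any? (λ j → e j ≟ b)
    ... | yes (i , ei≡a) | yes (j , ej≡b) = S≢0 (trans (sym (sum-transpose-both ei≡a ej≡b)) S′≡0)
    ... | yes (i , ei≡a) | no e≢b = fromA i ei≡a (begin
      value b              ≡⟨ +-identityʳ (value b) ⟨
      value b + 0#         ≡⟨ cong (value b +_) (-‿inverseʳ S) ⟨
      value b + (S - S)    ≡⟨ +-assoc (value b) S (- S) ⟨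
      value b + S - S      ≡⟨ cong (_- S) (trans (+-comm (value b) S) (sym (sum-transpose-a ei≡a (λ j eq → e≢b (j , eq))))) ⟩
      S′ + value a - S     ≡⟨ cong (λ z → z + value a - S) S′≡0 ⟩
      0# + value a - S     ≡⟨ cong (_- S) (+-identityˡ (value a)) ⟩
      value a - S          ∎)
      where open ≡-Reasoning
    ... | no e≢a | yes (j , ej≡b) = fromB j ej≡b (begin
      value b              ≡⟨ +-identityˡ (value b) ⟨
      0# + value b         ≡⟨ cong (_+ value b) S′≡0 ⟨
      S′ + value b         ≡⟨ sum-transpose-b ej≡b (λ i eq → e≢a (i , eq)) ⟩
      S + value a          ≡⟨ +-comm S (value a) ⟩
      value a + S          ∎)
      where open ≡-Reasoning
    ... | no e≢a | no e≢b = S≢0 (trans (sum-cong-≗ λ i → cong value (sym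
            (transpose-≢ (λ eq → e≢a (i , eq)) (λ eq → e≢b (i , eq))))) S′≡0)

occurrences-↭ : {A : Set} (_≟_ : ∀ (x y : A) → Dec (x ≡ y)) → ∀ {xs ys} → xs ↭ ys → ∀ x → occurrences _≟_ x xs ≡ occurrences _≟_ x ys
occurrences-↭ _≟_ xs↭ys x = Perm.↭-length (Perm.filter-↭ (x ≟_) xs↭ys)

module Switching (v t : ℕ) .{{_ : NonZero v}} .{{_ : NonZero t}} {m n h k : ℕ} {B : Cells m n} (Ω : Subset v)
    (αr : RowOrdering B) (αc : ColumnOrdering B) where

  open Heffter v t
  open ModularArithmetic v using (ℤ/)
  open CommutativeRing ℤ/ hiding (refl; sym; trans)
  open SignedValues v t {B = B}

  _≟ᵖ_ : (x y : Fin m × Fin n) → Dec (x ≡ y)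
  _≟ᵖ_ = ≡-dec _≟ᶠ_ _≟ᶠ_

  entry-ext : ∀ {A A′ : PFArray m n} → (∀ ij → entry A ij ≡ entry A′ ij) → A ≡ A′
  entry-ext eq = lookup-ext λ i → lookup-ext λ j → eq (i , j)

  lookup-skel : ∀ (A : PFArray m n) i j → lookup (lookup (skel A) i) j ≡ is-just (entry A (i , j))
  lookup-skel A i j = trans (cong (λ w → lookup w j) (lookup-map i (Vec.map is-just) A)) (lookup-map j is-just (lookup A i))

  filled-is-just : ∀ {D} → skel D ≡ B → ∀ (a : Cell B) → is-just (entry D (position a)) ≡ true
  filled-is-just {D} skel≡B (cell i j j∈) = trans (sym (lookup-skel D i j))
    (trans (cong (λ S → lookup (lookup S i) j) skel≡B) ([]=⇒lookup j∈))

  module _ (a b : Cell B) where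

    private module T = Transposition _≟ᵖ_ (position a) (position b)

    switch : PFArray m n → PFArray m n
    switch D = Vec.tabulate λ i → Vec.tabulate λ j → entry D (T.transpose (i , j))

    entry-switch : ∀ D ij → entry (switch D) ij ≡ entry D (T.transpose ij)
    entry-switch D (i , j) = trans (cong (λ w → lookup w j) (lookup∘tabulate _ i)) (lookup∘tabulate _ j)

    switch-involutive : ∀ D → switch (switch D) ≡ D
    switch-involutive D = entry-ext λ ij → trans (entry-switch (switch D) ij)
      (trans (entry-switch D (T.transpose ij)) (cong (entry D) (T.transpose-involutive ij)))

    switch-injective : ∀ {D D′} → switch D ≡ switch D′ → D ≡ D′
    switch-injective {D} {D′} eq = trans (sym (switch-involutive D)) (trans (cong switch eq) (switch-involutive D′))

    value-switch : ∀ D ij → value (switch D) ij ≡ value D (T.transpose ij)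
    value-switch D ij = cong (fromMaybe 0#) (entry-switch D ij)

    val-switch-a : ∀ D → val (switch D) a ≡ val D b
    val-switch-a D = trans (value-switch D _) (cong (value D) T.transpose-a)

    val-switch-≢ : ∀ D {x} → x ≢ a → x ≢ b → val (switch D) x ≡ val D x
    val-switch-≢ D x≢a x≢b = trans (value-switch D _)
      (cong (value D) (T.transpose-≢ (x≢a ∘ Cell-≡) (x≢b ∘ Cell-≡)))

    skel-switch : ∀ {D} → skel D ≡ B → skel (switch D) ≡ B
    skel-switch {D} skel≡B = trans (lookup-ext λ i → lookup-ext λ j → trans (lookup-skel (switch D) i j)
      (trans (cong is-just (entry-switch D (i , j))) (trans (same (i , j)) (sym (lookup-skel D i j))))) skel≡B
      where
      same : ∀ ij → is-just (entry D (T.transpose ij)) ≡ is-just (entry D ij)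
      same ij with T.cases ij
      ... | T.is-a refl = trans (cong (is-just ∘ entry D) T.transpose-a)
                            (trans (filled-is-just skel≡B b) (sym (filled-is-just skel≡B a)))
      ... | T.is-b refl = trans (cong (is-just ∘ entry D) T.transpose-b)
                            (trans (filled-is-just skel≡B a) (sym (filled-is-just skel≡B b)))
      ... | T.other ≢a ≢b = cong (is-just ∘ entry D) (T.transpose-≢ ≢a ≢b)

    entries-switch : ∀ D → entries (switch D) ↭ entries D
    entries-switch D = subst (_↭ entries D)
      (trans (mapMaybe-map (entry D) T.transpose grid) (sym (mapMaybe-cong (entry-switch D) grid)))
      (Perm.mapMaybe-↭ (entry D) (T.transpose-↭
        (Unique.cartesianProduct⁺ (Unique.allFin⁺ m) (Unique.allFin⁺ n))
        (λ (i , j) → ∈-cartesianProduct⁺ (∈-allFin i) (∈-allFin j))))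
      where grid = cartesianProduct (allFin m) (allFin n)

    covers-switch : ∀ {D} → CoversOnce (entries D) → CoversOnce (entries (switch D))
    covers-switch {D} covers x = (λ ¬j → trans (same x) (proj₁ (covers x) ¬j)) , (λ j → trans (same x) (proj₂ (covers x) j))
      where
      same : ∀ x → occurrences _≟ᶠ_ x (signed (entries (switch D))) ≡ occurrences _≟ᶠ_ x (signed (entries D))
      same = occurrences-↭ _≟ᶠ_ (Perm.++⁺ (entries-switch D) (Perm.map⁺ -_ (entries-switch D)))

    switch-inFamily : ∀ {D} → InFamily h k B Ω D →
      val D b ≢ val D a - rowSum D (row a) → val D b ≢ val D a + rowSum D (row b) →
      val D b ≢ val D a - columnSum D (col a) → val D b ≢ val D a + columnSum D (col b) →
      InFamily h k B Ω (switch D)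
    switch-inFamily {D} (((regular , covers) , rows≢0 , columns≢0) , skel≡B , entries⇔Ω) rowa rowb cola colb =
      ( (subst (Regular h k) (trans skel≡B (sym (skel-switch skel≡B))) regular , covers-switch {D} covers)
      , (λ i sum≡0 → sum-transpose≢0 v _≟ᵖ_ (position a) (position b) (i ,_) (λ { refl → refl }) (value D) (rows≢0 i)
          (λ { _ refl → rowa }) (λ { _ refl → rowb }) (trans (sym (sum-cong-≗ (λ j → value-switch D (i , j)))) sum≡0))
      , (λ j sum≡0 → sum-transpose≢0 v _≟ᵖ_ (position a) (position b) (_, j) (λ { refl → refl }) (value D) (columns≢0 j)
          (λ { _ refl → cola }) (λ { _ refl → colb }) (trans (sym (sum-cong-≗ (λ i → value-switch D (i , j)))) sum≡0)) )
      , skel-switch skel≡B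
      , λ x → mk⇔ (Equivalence.to (entries⇔Ω x) ∘ Perm.∈-resp-↭ (entries-switch D))
                  (Perm.∈-resp-↭ (↭-sym (entries-switch D)) ∘ Equivalence.from (entries⇔Ω x))
      where open import Algebra.Properties.CommutativeMonoid.Sum +-commutativeMonoid using (sum-cong-≗)

  Family : PFArray m n → Set
  Family = InFamily h k B Ω

  Family? : Decidable Family
  Family? = InFamily? h k B Ω

  val-injective : ∀ {D} → Family D → ∀ {a b} → val D a ≡ val D b → a ≡ b
  val-injective {D} ((qh , _) , skel≡B , _) = Archdeacon.val-injective D αr αc qh skel≡B

  fam : List (PFArray m n)
  fam = family h k B Ω

  fam-unique : Unique fam
  fam-unique = Unique.filter⁺ Family? (arrays-unique m n)

  ∈-fam : ∀ {D} → Family D → D ∈ fam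
  ∈-fam {D} D∈ = ∈-filter⁺ Family? (∈-arrays D) D∈

  fam⇒Family : ∀ {D} → D ∈ fam → Family D
  fam⇒Family = proj₂ ∘ ∈-filter⁻ Family? {xs = arrays m n}

  _∈ᶜ?_ : ∀ (b : Cell B) xs → Dec (b ∈ xs)
  _∈ᶜ?_ = member? _≟ᶜ_

  module _ (a : Cell B) (Ex : List (Cell B)) where

    Good? : ∀ D → Decidable (λ b → b ∉ Ex × Family (switch a b D))
    Good? D b = ¬? (b ∈ᶜ? Ex) ×-dec Family? (switch a b D)

    -- Entries are distinct, so each forbidden value excludes at most one cell. The row and the
    -- column of `a` forbid one value each, which gives the 2. The lines through `b` vary with `b`,
    -- so the value forbidden by every row and every column is excluded, at the cost of m + n.
    many-good : ∀ {D} → Family D → length (cells {B = B}) ℕ.≤ count (Good? D) cells ℕ.+ (length Ex ℕ.+ (2 ℕ.+ (m ℕ.+ n)))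
    many-good {D} D∈ = begin
      length (cells {B = B})                                                     ≤⟨ length-⊆ cells-unique (λ {b} _ → cover b (b ∈ᶜ? bad)) ⟩
      length (good ++ Ex ++ bad₁ ++ bad₂ ++ bad₃ ++ bad₄)                        ≡⟨ lengths ⟩
      length good ℕ.+ (length Ex ℕ.+ (length bad₁ ℕ.+ (length bad₂ ℕ.+ (length bad₃ ℕ.+ length bad₄))))
        ≤⟨ ℕₚ.+-monoʳ-≤ (length good) (ℕₚ.+-monoʳ-≤ (length Ex) (ℕₚ.+-mono-≤ bad₁≤ (ℕₚ.+-mono-≤ bad₂≤ (ℕₚ.+-mono-≤ bad₃≤ bad₄≤)))) ⟩
      length good ℕ.+ (length Ex ℕ.+ (2 ℕ.+ (m ℕ.+ n)))                          ∎
      where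
      open ℕₚ.≤-Reasoning
      has : ℤᵥ → List (Cell B)
      has x = filter (λ b → val D b ≟ᶠ x) cells
      good = filter (Good? D) cells
      bad₁ = has (val D a - rowSum D (row a))
      bad₂ = has (val D a - columnSum D (col a))
      bad-row : Fin m → List (Cell B)
      bad-row i = has (val D a + rowSum D i)
      bad-column : Fin n → List (Cell B)
      bad-column j = has (val D a + columnSum D j)
      bad₃ = concatMap bad-row (allFin m)
      bad₄ = concatMap bad-column (allFin n)
      has≤1 : ∀ x → length (has x) ℕ.≤ 1
      has≤1 x = count-≤1 (λ b → val D b ≟ᶠ x) cells-unique (λ eq eq′ → val-injective D∈ (trans eq (sym eq′)))
      bad₁≤ = has≤1 (val D a - rowSum D (row a))
      bad₂≤ = has≤1 (val D a - columnSum D (col a))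
      bad₃≤ : length bad₃ ℕ.≤ m
      bad₃≤ = ℕₚ.≤-trans (length-concatMap-≤ bad-row 1 (allFin m) (λ {i} _ → has≤1 (val D a + rowSum D i)))
        (ℕₚ.≤-reflexive (trans (ℕₚ.*-identityʳ _) (length-tabulate {n = m} id)))
      bad₄≤ : length bad₄ ℕ.≤ n
      bad₄≤ = ℕₚ.≤-trans (length-concatMap-≤ bad-column 1 (allFin n) (λ {j} _ → has≤1 (val D a + columnSum D j)))
        (ℕₚ.≤-reflexive (trans (ℕₚ.*-identityʳ _) (length-tabulate {n = n} id)))
      lengths : length (good ++ Ex ++ bad₁ ++ bad₂ ++ bad₃ ++ bad₄) ≡
                length good ℕ.+ (length Ex ℕ.+ (length bad₁ ℕ.+ (length bad₂ ℕ.+ (length bad₃ ℕ.+ length bad₄))))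
      lengths = trans (length-++ good) (cong (length good ℕ.+_) (trans (length-++ Ex) (cong (length Ex ℕ.+_)
        (trans (length-++ bad₁) (cong (length bad₁ ℕ.+_) (trans (length-++ bad₂) (cong (length bad₂ ℕ.+_) (length-++ bad₃))))))))
      ∈-has : ∀ {b x} → val D b ≡ x → b ∈ has x
      ∈-has {b} {x} eq = ∈-filter⁺ (λ b → val D b ≟ᶠ x) (∈-cells b) eq
      bad : List (Cell B)
      bad = Ex ++ bad₁ ++ bad₂ ++ bad₃ ++ bad₄
      cover : ∀ b → Dec (b ∈ bad) → b ∈ good ++ bad
      cover b (yes b∈) = ∈-++⁺ʳ good b∈
      cover b (no b∉)  = ∈-++⁺ˡ (∈-filter⁺ (Good? D) (∈-cells b) (b∉ ∘ ∈-++⁺ˡ , switch-inFamily a b D∈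
        (b∉ ∘ ∈-++⁺ʳ Ex ∘ ∈-++⁺ˡ ∘ ∈-has)
        (b∉ ∘ ∈-++⁺ʳ Ex ∘ ∈-++⁺ʳ bad₁ ∘ ∈-++⁺ʳ bad₂ ∘ ∈-++⁺ˡ ∘ ∈-concatMap bad-row (∈-allFin (row b)) ∘ ∈-has)
        (b∉ ∘ ∈-++⁺ʳ Ex ∘ ∈-++⁺ʳ bad₁ ∘ ∈-++⁺ˡ ∘ ∈-has)
        (b∉ ∘ ∈-++⁺ʳ Ex ∘ ∈-++⁺ʳ bad₁ ∘ ∈-++⁺ʳ bad₂ ∘ ∈-++⁺ʳ bad₃ ∘ ∈-concatMap bad-column (∈-allFin (col b)) ∘ ∈-has)))

    -- `P` collects the equations already imposed and `Q` is the new one. An array with both has at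
    -- least `K` exchanges that stay in the family and keep `P`; an array with `P` has at most `M`
    -- exchanges that lead to `Q`.
    switching : ∀ {P Q : PFArray m n → Set} (P? : Decidable P) (Q? : Decidable Q) →
      (∀ {D b} → b ∉ Ex → P D → P (switch a b D)) →
      ∀ M → (∀ {D} → Family D → count (λ b → ¬? (b ∈ᶜ? Ex) ×-dec Q? (switch a b D)) cells ℕ.≤ M) →
      ∀ K → K ℕ.+ (length Ex ℕ.+ (2 ℕ.+ (m ℕ.+ n))) ℕ.≤ length (cells {B = B}) →
      count (λ D → P? D ×-dec Q? D) fam ℕ.* K ℕ.≤ count P? fam ℕ.* M
    switching {P} {Q} P? Q? preserved M few K K≤ = double-counting Good? Q-after? (switch a)
      (Unique.filter⁺ PQ? fam-unique) cells-unique (switch-injective a) switched K M lower upper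
      where
      PQ? : Decidable (λ D → P D × Q D)
      PQ? D = P? D ×-dec Q? D
      Q-after? : ∀ D → Decidable (λ b → b ∉ Ex × Q (switch a b D))
      Q-after? D b = ¬? (b ∈ᶜ? Ex) ×-dec Q? (switch a b D)
      switched : ∀ {D b} → D ∈ filter PQ? fam → b ∉ Ex × Family (switch a b D) →
                 switch a b D ∈ filter P? fam × (b ∉ Ex × Q (switch a b (switch a b D)))
      switched {D} {b} D∈ (b∉ , fam′) with ∈-filter⁻ PQ? {xs = fam} D∈
      -- Exchanging twice restores `D`, so seen from its exchange, `D` is an array reached with `Q`.
      ... | _ , pD , qD = ∈-filter⁺ P? (∈-fam fam′) (preserved b∉ pD) , b∉ , subst Q (sym (switch-involutive a b D)) qD
      lower : ∀ {D} → D ∈ filter PQ? fam → K ℕ.≤ count (Good? D) cells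
      lower {D} D∈ = ℕₚ.+-cancelʳ-≤ (length Ex ℕ.+ (2 ℕ.+ (m ℕ.+ n))) K (count (Good? D) cells)
        (ℕₚ.≤-trans K≤ (many-good (fam⇒Family (proj₁ (∈-filter⁻ PQ? {xs = fam} D∈)))))
      upper : ∀ {D} → D ∈ filter P? fam → count (Q-after? D) cells ℕ.≤ M
      upper D∈ = few (fam⇒Family (proj₁ (∈-filter⁻ P? {xs = fam} D∈)))

-- Equations on the entries

module _ (v : ℕ) .{{_ : NonZero v}} where

  open ModularArithmetic v using (ℤ/; toℕ-mod)
  open CommutativeRing ℤ/ hiding (refl; sym; trans)
  open import Algebra.Properties.Monoid.Mult +-monoid using () renaming (_×_ to _·_)

  toℕ-· : ∀ k x → toℕ (k · x) ≡ (k ℕ.* toℕ x) % v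
  toℕ-· zero    x = toℕ-mod 0
  toℕ-· (suc k) x = begin
    toℕ (x + k · x)                                ≡⟨ toℕ-mod (toℕ x ℕ.+ toℕ (k · x)) ⟩
    (toℕ x ℕ.+ toℕ (k · x)) % v                    ≡⟨ cong (λ z → (toℕ x ℕ.+ z) % v) (toℕ-· k x) ⟩
    (toℕ x ℕ.+ (k ℕ.* toℕ x) % v) % v              ≡⟨ %-distribˡ-+ (toℕ x) _ v ⟩
    (toℕ x % v ℕ.+ (k ℕ.* toℕ x) % v % v) % v      ≡⟨ cong (λ z → (toℕ x % v ℕ.+ z) % v) (m%n%n≡m%n (k ℕ.* toℕ x) v) ⟩
    (toℕ x % v ℕ.+ (k ℕ.* toℕ x) % v) % v          ≡⟨ %-distribˡ-+ (toℕ x) _ v ⟨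
    (toℕ x ℕ.+ k ℕ.* toℕ x) % v                    ∎
    where open ≡-Reasoning

  ·-injective : ∀ k .{{_ : NonZero k}} {x y} → k · x ≡ k · y → (k ℕ.* toℕ x) ℕ./ v ≡ (k ℕ.* toℕ y) ℕ./ v → x ≡ y
  ·-injective k {x} {y} eq quotient = toℕ-injective (ℕₚ.*-cancelˡ-≡ (toℕ x) (toℕ y) k (begin
    k ℕ.* toℕ x                                              ≡⟨ m≡m%n+[m/n]*n (k ℕ.* toℕ x) v ⟩
    (k ℕ.* toℕ x) % v ℕ.+ (k ℕ.* toℕ x) ℕ./ v ℕ.* v            ≡⟨ cong₂ (λ r q → r ℕ.+ q ℕ.* v) remainder quotient ⟩
    (k ℕ.* toℕ y) % v ℕ.+ (k ℕ.* toℕ y) ℕ./ v ℕ.* v            ≡⟨ m≡m%n+[m/n]*n (k ℕ.* toℕ y) v ⟨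
    k ℕ.* toℕ y                                              ∎))
    where
    open ≡-Reasoning
    remainder : (k ℕ.* toℕ x) % v ≡ (k ℕ.* toℕ y) % v
    remainder = trans (sym (toℕ-· k x)) (trans (cong toℕ eq) (toℕ-· k y))

  -- Multiplication by `k` need not be injective modulo v. But the product taken in ℕ is below k v,
  -- so its quotient by v has at most `k` values, and the quotient together with the residue
  -- determines the factor.
  count-·-solutions : ∀ k .{{_ : NonZero k}} {A : Set} (g : A → Fin v) → (∀ {a b} → g a ≡ g b → a ≡ b) →
                      ∀ κ {xs} → Unique xs → count (λ a → k · g a ≟ᶠ κ) xs ℕ.≤ k
  count-·-solutions k g g-inj κ {xs} xs! = subst₂ ℕ._≤_ (ℕₚ.*-identityˡ _) (trans (ℕₚ.*-identityʳ _) (length-upTo k))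
    (union-bound (λ a → k · g a ≟ᶠ κ) Q? xs! (upTo k)
      (λ {a} _ eq → quotient a , ∈-upTo⁺ (quotient<k a) , eq , refl)
      1 1 (λ {q} _ → ℕₚ.≤-trans (ℕₚ.≤-reflexive (ℕₚ.*-identityˡ _)) (count-≤1 (Q? q) xs! λ (eq , q≡) (eq′ , q≡′) →
        g-inj (·-injective k (trans eq (sym eq′)) (trans q≡ (sym q≡′))))))
    where
    quotient : _ → ℕ
    quotient a = (k ℕ.* toℕ (g a)) ℕ./ v
    quotient<k : ∀ a → quotient a ℕ.< k
    quotient<k a = m<n*o⇒m/o<n {k ℕ.* toℕ (g a)} {k} {v} (ℕₚ.*-monoʳ-< k (toℕ<n (g a)))
    Q? : ∀ q → Decidable (λ a → k · g a ≡ κ × quotient a ≡ q)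
    Q? q a = (k · g a ≟ᶠ κ) ×-dec (quotient a ℕₚ.≟ q)

-- Systems of equations and what each equation costs

module Constraints (v t : ℕ) .{{_ : NonZero v}} .{{_ : NonZero t}} {m n : ℕ} (h k : ℕ) {B : Cells m n} (Ω : Subset v)
    (αr : RowOrdering B) (αc : ColumnOrdering B) (compatible : Compatible αr αc) where

  open Heffter v t
  open ModularArithmetic v using (ℤ/)
  open CommutativeRing ℤ/ hiding (refl; sym; trans)
  open import Algebra.Properties.Monoid.Mult +-monoid using () renaming (_×_ to _·_)
  open import Algebra.Properties.Ring ring using (-‿injective)
  open SignedRotation αr αc compatible
  open SignedValues v t {B = B}
  open Automorphisms v t αr αc compatible using (Exchange; Scaling)
  open Switching v t {h = h} {k = k} Ω αr αc

  on : SignedCell B → Cell B → SignedCell B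
  on (plus _)  b = plus b
  on (minus _) b = minus b

  on-injective : ∀ {D} → Family D → ∀ x {a b} → sval D (on x a) ≡ sval D (on x b) → a ≡ b
  on-injective D∈ (plus _)  eq = val-injective D∈ eq
  on-injective D∈ (minus _) eq = val-injective D∈ (-‿injective eq)

  sval-switch-a : ∀ D x b → sval (switch ∣ x ∣ᶜ b D) x ≡ sval D (on x b)
  sval-switch-a D (plus a)  b = val-switch-a a b D
  sval-switch-a D (minus a) b = cong -_ (val-switch-a a b D)

  sval-switch-≢ : ∀ a b D x → ∣ x ∣ᶜ ≢ a → ∣ x ∣ᶜ ≢ b → sval (switch a b D) x ≡ sval D x
  sval-switch-≢ a b D (plus x)  x≢a x≢b = val-switch-≢ a b D x≢a x≢b
  sval-switch-≢ a b D (minus x) x≢a x≢b = cong -_ (val-switch-≢ a b D x≢a x≢b)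

  -- An equation between finitely many entries, to be broken by exchanging the entry of `pivot`. In
  -- `few` the excluded set may exceed the support, because it also has to protect the other
  -- equations of a list.
  record Constraint : Set₁ where
    field
      Holds   : PFArray m n → Set
      holds?  : Decidable Holds
      support : List (Cell B)
      pivot   : Cell B
      stable  : ∀ {a b D} → a ∉ support → b ∉ support → Holds D → Holds (switch a b D)
      few     : ∀ {D} → Family D → ∀ Ex → (∀ {a} → a ∈ support → a ∈ Ex) →
                count (λ b → ¬? (b ∈ᶜ? Ex) ×-dec holds? (switch pivot b D)) cells ℕ.≤ 3

  open Constraint

  supports : List Constraint → List (Cell B)
  supports = concatMap support

  -- The head of the list is the equation imposed last; the pairing has the shape that `switching`
  -- expects.
  AllHold : List Constraint → PFArray m n → Set
  AllHold []       D = ⊤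
  AllHold (q ∷ qs) D = AllHold qs D × Holds q D

  allHold? : ∀ qs → Decidable (AllHold qs)
  allHold? []       D = yes tt
  allHold? (q ∷ qs) D = allHold? qs D ×-dec holds? q D

  -- A triangular condition: exchanging the pivot of `q` must not disturb `qs`, while the support of
  -- `q` may overlap those of `qs`. The number `s` limits the excluded cells.
  Independent : ℕ → List Constraint → Set
  Independent s []       = ⊤
  Independent s (q ∷ qs) = Independent s qs × pivot q ∉ supports qs × length (supports (q ∷ qs)) ℕ.≤ s

  allHold-stable : ∀ qs {a b D} → a ∉ supports qs → b ∉ supports qs → AllHold qs D → AllHold qs (switch a b D)
  allHold-stable []       _ _ _ = tt
  allHold-stable (q ∷ qs) a∉ b∉ (hs , h) =
    allHold-stable qs (a∉ ∘ ∈-++⁺ʳ (support q)) (b∉ ∘ ∈-++⁺ʳ (support q)) hs ,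
    stable q (a∉ ∘ ∈-++⁺ˡ) (b∉ ∘ ∈-++⁺ˡ) h

  module _ (s K : ℕ) (K≤ : K ℕ.+ (s ℕ.+ (2 ℕ.+ (m ℕ.+ n))) ℕ.≤ length (cells {B = B})) where

    count-allHold : ∀ qs → Independent s qs → count (allHold? qs) fam ℕ.* K ℕ.^ length qs ℕ.≤ length fam ℕ.* 3 ℕ.^ length qs
    count-allHold []       _ = ℕₚ.*-monoˡ-≤ 1 (length-filter (allHold? []) fam)
    count-allHold (q ∷ qs) (ind , pivot∉ , ≤s) = begin
      count (allHold? (q ∷ qs)) fam ℕ.* (K ℕ.* K ℕ.^ length qs)   ≡⟨ ℕₚ.*-assoc (count (allHold? (q ∷ qs)) fam) K _ ⟨
      count (allHold? (q ∷ qs)) fam ℕ.* K ℕ.* K ℕ.^ length qs     ≤⟨ ℕₚ.*-monoˡ-≤ (K ℕ.^ length qs) step ⟩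
      count (allHold? qs) fam ℕ.* 3 ℕ.* K ℕ.^ length qs           ≡⟨ swap₂₃ (count (allHold? qs) fam) 3 _ ⟩
      count (allHold? qs) fam ℕ.* K ℕ.^ length qs ℕ.* 3           ≤⟨ ℕₚ.*-monoˡ-≤ 3 (count-allHold qs ind) ⟩
      length fam ℕ.* 3 ℕ.^ length qs ℕ.* 3                        ≡⟨ swap₂₃ (length fam) _ 3 ⟩
      length fam ℕ.* 3 ℕ.* 3 ℕ.^ length qs                        ≡⟨ ℕₚ.*-assoc (length fam) 3 _ ⟩
      length fam ℕ.* (3 ℕ.* 3 ℕ.^ length qs)                      ∎
      where
      open ℕₚ.≤-Reasoning
      swap₂₃ : ∀ x y z → x ℕ.* y ℕ.* z ≡ x ℕ.* z ℕ.* y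
      swap₂₃ x y z = trans (ℕₚ.*-assoc x y z) (trans (cong (x ℕ.*_) (ℕₚ.*-comm y z)) (sym (ℕₚ.*-assoc x z y)))
      step : count (allHold? (q ∷ qs)) fam ℕ.* K ℕ.≤ count (allHold? qs) fam ℕ.* 3
      step = switching (pivot q) (supports (q ∷ qs)) (allHold? qs) (holds? q)
        (λ b∉ → allHold-stable qs pivot∉ (b∉ ∘ ∈-++⁺ʳ (support q)))
        3 (λ D∈ → few q D∈ (supports (q ∷ qs)) ∈-++⁺ˡ)
        K (ℕₚ.≤-trans (ℕₚ.+-monoʳ-≤ K (ℕₚ.+-monoˡ-≤ (2 ℕ.+ (m ℕ.+ n)) ≤s)) K≤)

  module _ (φ : SignedCell B → SignedCell B) (c : ℤᵥ) (i : SignedCell B) (moved : ∣ φ i ∣ᶜ ≢ ∣ i ∣ᶜ) where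

    -- Since `φ i` lies outside the cell of `i`, an exchange at the pivot leaves the right-hand side
    -- alone, so the equation prescribes the new entry.
    scalingConstraint : Constraint
    scalingConstraint = record
      { Holds   = λ D → Scaling D φ c i
      ; holds?  = holds?ˢ
      ; support = ∣ φ i ∣ᶜ ∷ ∣ i ∣ᶜ ∷ []
      ; pivot   = ∣ φ i ∣ᶜ
      ; stable  = λ {a} {b} {D} a∉ b∉ eq → subst₂ _≡_
          (sym (sval-switch-≢ a b D (φ i) (λ { refl → a∉ (here refl) }) (λ { refl → b∉ (here refl) })))
          (cong (c *_) (sym (sval-switch-≢ a b D i (λ { refl → a∉ (there (here refl)) }) (λ { refl → b∉ (there (here refl)) }))))
          eq
      ; few     = λ {D} D∈ Ex ⊆Ex → ℕₚ.≤-trans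
          (count-≤1 (λ b → ¬? (b ∈ᶜ? Ex) ×-dec holds?ˢ (switch ∣ φ i ∣ᶜ b D)) cells-unique λ (b∉ , eq) (b′∉ , eq′) →
            on-injective D∈ (φ i) (trans (forced Ex ⊆Ex b∉ eq) (sym (forced Ex ⊆Ex b′∉ eq′))))
          (s≤s z≤n) }
      where
      holds?ˢ : Decidable (λ D → Scaling D φ c i)
      holds?ˢ D = sval D (φ i) ≟ᶠ c * sval D i
      forced : ∀ {D b} Ex → (∀ {a} → a ∈ ∣ φ i ∣ᶜ ∷ ∣ i ∣ᶜ ∷ [] → a ∈ Ex) → b ∉ Ex →
               Scaling (switch ∣ φ i ∣ᶜ b D) φ c i → sval D (on (φ i) b) ≡ c * sval D i
      forced {D} {b} Ex ⊆Ex b∉ eq = trans (sym (sval-switch-a D (φ i) b)) (trans eq (cong (c *_)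
        (sval-switch-≢ ∣ φ i ∣ᶜ b D i (moved ∘ sym) (λ i≡b → b∉ (subst (_∈ Ex) i≡b (⊆Ex (there (here refl))))))))

  module _ (w x y z : SignedCell B) (∣w∣≢∣y∣ : ∣ w ∣ᶜ ≢ ∣ y ∣ᶜ) (x≢y : x ≢ y) (z≢neg-y : z ≢ neg y) where

    Balanced : PFArray m n → Set
    Balanced D = sval D w + sval D x ≡ sval D y + sval D z

    balanced? : Decidable Balanced
    balanced? D = sval D w + sval D x ≟ᶠ sval D y + sval D z

    four : List (Cell B)
    four = ∣ w ∣ᶜ ∷ ∣ x ∣ᶜ ∷ ∣ y ∣ᶜ ∷ ∣ z ∣ᶜ ∷ []

    private
      transfer : ∀ {y z a} → a ≡ y + z → y ≡ a - z
      transfer {y} {z} refl = sym (trans (+-assoc y z (- z)) (trans (cong (y +_) (-‿inverseʳ z)) (+-identityʳ y)))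

      undo : ∀ {w y q} → w - y ≡ q → y + q ≡ w
      undo {w} {y} refl = x+[y-x]≡y y w

    -- sval D y occurs in the switched equation once, twice (if x is neg y or z is y) or three times.
    multiple : ∀ D → ∃[ l ] ∃[ κ ] l ℕ.≤ 2 ×
      (∀ {b} → b ∉ four → Balanced (switch ∣ y ∣ᶜ b D) → suc l · sval D (on y b) ≡ κ)
    multiple D = by-cases (∣ x ∣ᶜ ≟ᶜ ∣ y ∣ᶜ) (∣ z ∣ᶜ ≟ᶜ ∣ y ∣ᶜ)
      where
      Y : Cell B → ℤᵥ
      Y b = sval D (on y b)
      balance : ∀ {b X Z} → b ∉ four → sval (switch ∣ y ∣ᶜ b D) x ≡ X → sval (switch ∣ y ∣ᶜ b D) z ≡ Z →
                Balanced (switch ∣ y ∣ᶜ b D) → sval D w + X ≡ Y b + Z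
      balance {b} b∉ refl refl eq = trans (cong (_+ sval (switch ∣ y ∣ᶜ b D) x)
          (sym (sval-switch-≢ ∣ y ∣ᶜ b D w ∣w∣≢∣y∣ (λ { refl → b∉ (here refl) }))))
        (trans eq (cong (_+ sval (switch ∣ y ∣ᶜ b D) z) (sval-switch-a D y b)))
      kept-x : ∀ {b} → b ∉ four → ∣ x ∣ᶜ ≢ ∣ y ∣ᶜ → sval (switch ∣ y ∣ᶜ b D) x ≡ sval D x
      kept-x {b} b∉ x≢ = sval-switch-≢ ∣ y ∣ᶜ b D x x≢ (λ { refl → b∉ (there (here refl)) })
      kept-z : ∀ {b} → b ∉ four → ∣ z ∣ᶜ ≢ ∣ y ∣ᶜ → sval (switch ∣ y ∣ᶜ b D) z ≡ sval D z
      kept-z {b} b∉ z≢ = sval-switch-≢ ∣ y ∣ᶜ b D z z≢ (λ { refl → b∉ (there (there (there (here refl)))) })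
      opposite : ∀ {b} → ∣ x ∣ᶜ ≡ ∣ y ∣ᶜ → sval (switch ∣ y ∣ᶜ b D) x ≡ - Y b
      opposite {b} eq with same-cell eq
      ... | inj₁ x≡y     = contradiction x≡y x≢y
      ... | inj₂ x≡neg-y = trans (cong (sval (switch ∣ y ∣ᶜ b D)) x≡neg-y)
        (trans (sval-neg (switch ∣ y ∣ᶜ b D) y) (cong -_ (sval-switch-a D y b)))
      equal : ∀ {b} → ∣ z ∣ᶜ ≡ ∣ y ∣ᶜ → sval (switch ∣ y ∣ᶜ b D) z ≡ Y b
      equal {b} eq with same-cell eq
      ... | inj₁ z≡y     = trans (cong (sval (switch ∣ y ∣ᶜ b D)) z≡y) (sval-switch-a D y b)
      ... | inj₂ z≡neg-y = contradiction z≡neg-y z≢neg-y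
      by-cases : Dec (∣ x ∣ᶜ ≡ ∣ y ∣ᶜ) → Dec (∣ z ∣ᶜ ≡ ∣ y ∣ᶜ) → ∃[ l ] ∃[ κ ] l ℕ.≤ 2 ×
        (∀ {b} → b ∉ four → Balanced (switch ∣ y ∣ᶜ b D) → suc l · Y b ≡ κ)
      by-cases (no x≢) (no z≢) = 0 , sval D w + sval D x - sval D z , z≤n , λ {b} b∉ eq →
        trans (+-identityʳ (Y b)) (transfer (balance b∉ (kept-x b∉ x≢) (kept-z b∉ z≢) eq))
      by-cases (yes x≡) (no z≢) = 1 , sval D w - sval D z , s≤s z≤n , λ {b} b∉ eq →
        trans (cong (Y b +_) (+-identityʳ (Y b))) (transfer (sym (trans (+-assoc (Y b) (Y b) (sval D z))
          (undo (balance b∉ (opposite x≡) (kept-z b∉ z≢) eq)))))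
      by-cases (no x≢) (yes z≡) = 1 , sval D w + sval D x , s≤s z≤n , λ {b} b∉ eq →
        trans (cong (Y b +_) (+-identityʳ (Y b))) (sym (balance b∉ (kept-x b∉ x≢) (equal z≡) eq))
      by-cases (yes x≡) (yes z≡) = 2 , sval D w , s≤s (s≤s z≤n) , λ {b} b∉ eq →
        trans (cong (λ q → Y b + (Y b + q)) (+-identityʳ (Y b))) (undo (balance b∉ (opposite x≡) (equal z≡) eq))

    -- The hypotheses keep the entry at the pivot from cancelling: `w` lies in another cell, and in
    -- the cell of `y` only `x = neg y` and `z = y` are possible, both of which raise the
    -- coefficient. It is thus 1, 2 or 3, and `count-·-solutions` applies.
    balancedConstraint : Constraint
    balancedConstraint = record
      { Holds   = Balanced
      ; holds?  = balanced?
      ; support = four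
      ; pivot   = ∣ y ∣ᶜ
      ; stable  = λ {a} {b} {D} a∉ b∉ eq →
          let same : ∀ s → ∣ s ∣ᶜ ∈ four → sval (switch a b D) s ≡ sval D s
              same s s∈ = sval-switch-≢ a b D s (λ { refl → a∉ s∈ }) (λ { refl → b∉ s∈ })
          in trans (cong₂ _+_ (same w (here refl)) (same x (there (here refl)))) (trans eq
               (sym (cong₂ _+_ (same y (there (there (here refl)))) (same z (there (there (there (here refl))))))))
      ; few     = fewᵇ }
      where
      fewᵇ : ∀ {D} → Family D → ∀ Ex → (∀ {a} → a ∈ four → a ∈ Ex) →
             count (λ b → ¬? (b ∈ᶜ? Ex) ×-dec balanced? (switch ∣ y ∣ᶜ b D)) cells ℕ.≤ 3
      fewᵇ {D} D∈ Ex ⊆Ex with multiple D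
      ... | l , κ , l≤2 , forced = ℕₚ.≤-trans (count-mono
              (λ b → ¬? (b ∈ᶜ? Ex) ×-dec balanced? (switch ∣ y ∣ᶜ b D)) (λ b → suc l · sval D (on y b) ≟ᶠ κ) cells-unique
              (λ _ (b∉ , eq) → forced (b∉ ∘ ⊆Ex) eq))
            (ℕₚ.≤-trans (count-·-solutions v (suc l) (sval D ∘ on y) (on-injective D∈ y) κ cells-unique) (s≤s l≤2))

-- The union bound

opaque

  -- 18 = 6 · 3: three exchanges at most lead to a solution, and at least a sixth of the cells can
  -- be used for exchanging.
  18^ : ℕ → ℕ
  18^ s = 18 ℕ.^ s

  18^-mono : ∀ {a b} → a ℕ.≤ b → 18^ a ℕ.≤ 18^ b
  18^-mono = ℕₚ.^-monoʳ-≤ 18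

  6^*3^≡18^ : ∀ s → 6 ℕ.^ s ℕ.* 3 ℕ.^ s ≡ 18^ s
  6^*3^≡18^ zero    = refl
  6^*3^≡18^ (suc s) = trans (ℕₚ.[m*n]*[o*p]≡[m*o]*[n*p] 6 (6 ℕ.^ s) 3 (3 ℕ.^ s)) (cong (18 ℕ.*_) (6^*3^≡18^ s))

^-distribʳ-* : ∀ a b s → (a ℕ.* b) ℕ.^ s ≡ a ℕ.^ s ℕ.* b ℕ.^ s
^-distribʳ-* a b zero    = refl
^-distribʳ-* a b (suc s) = trans (cong (a ℕ.* b ℕ.*_) (^-distribʳ-* a b s))
  (ℕₚ.[m*n]*[o*p]≡[m*o]*[n*p] a b (a ℕ.^ s) (b ℕ.^ s))

-- Choosing equations for a given map φ

module Choice {m n : ℕ} {B : Cells m n} (αr : RowOrdering B) (αc : ColumnOrdering B) (compatible : Compatible αr αc) where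

  open SignedRotation αr αc compatible

  different-cells : ∀ {x y : SignedCell B} → x ≢ y → x ≢ neg y → ∣ x ∣ᶜ ≢ ∣ y ∣ᶜ
  different-cells x≢y x≢neg-y same with same-cell same
  ... | inj₁ x≡y     = x≢y x≡y
  ... | inj₂ x≡neg-y = x≢neg-y x≡neg-y

  avoid-cells : (gs : List (SignedCell B → SignedCell B)) → (∀ {g} → g ∈ gs → ∀ {x y} → g x ≡ g y → x ≡ y) →
                ∀ zs → length gs ℕ.* (length zs ℕ.+ length zs) ℕ.< length (signedCells {B = B}) →
                ∃[ x ] (∀ {g z} → g ∈ gs → z ∈ zs → ∣ g x ∣ᶜ ≢ ∣ z ∣ᶜ)
  avoid-cells gs inj zs < =
    let x , avoids = avoid _≟ˢ_ gs inj (zs ++ map neg zs) (signedCells-unique {B = B})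
          (subst (λ l → length gs ℕ.* l ℕ.< length (signedCells {B = B}))
            (sym (trans (length-++ zs) (cong (length zs ℕ.+_) (length-map neg zs)))) <)
    in x , λ {g} {z} g∈ z∈ → different-cells {g x} {z} (avoids g∈ (∈-++⁺ˡ z∈)) (avoids g∈ (∈-++⁺ʳ zs (∈-map⁺ neg z∈)))

  module _ {h k : ℕ} (h≥3 : h ℕ.≥ 3) (k≥3 : k ℕ.≥ 3) (regular : (∀ i → ∣ lookup B i ∣ ≡ h) × (∀ j → ∣ column B j ∣ ≡ k))
           {o : Bool} {φ : SignedCell B → SignedCell B} (φ-equivariant : Equivariant o φ) (nontrivial : o ≡ true → ∀ x → φ x ≢ x) where

    -- Which of `x` and `rotate x` is moved is not known in advance, so the images of both are made
    -- to avoid `zs`.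
    choose-moved : ∀ zs → 2 ℕ.* (length zs ℕ.+ length zs) ℕ.< length (signedCells {B = B}) →
                   ∃[ x ] ∣ φ x ∣ᶜ ≢ ∣ x ∣ᶜ × (∀ {z} → z ∈ zs → ∣ φ x ∣ᶜ ≢ ∣ z ∣ᶜ)
    choose-moved zs < = pick (avoid-cells (φ ∷ φ ∘ rotate ∷ []) inj zs <)
      where
      inj : ∀ {g} → g ∈ φ ∷ φ ∘ rotate ∷ [] → ∀ {x y} → g x ≡ g y → x ≡ y
      inj (here refl)         eq = equivariant-injective o φ φ-equivariant eq
      inj (there (here refl)) eq = trans (sym (rotate⁻¹-rotate _))
        (trans (cong rotate⁻¹ (equivariant-injective o φ φ-equivariant eq)) (rotate⁻¹-rotate _))
      pick : ∃[ x ] (∀ {g z} → g ∈ φ ∷ φ ∘ rotate ∷ [] → z ∈ zs → ∣ g x ∣ᶜ ≢ ∣ z ∣ᶜ) →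
             ∃[ x ] ∣ φ x ∣ᶜ ≢ ∣ x ∣ᶜ × (∀ {z} → z ∈ zs → ∣ φ x ∣ᶜ ≢ ∣ z ∣ᶜ)
      pick (x , avoids) with moves-x-or-rotate h≥3 k≥3 regular φ-equivariant nontrivial x
      ... | inj₁ (≢x , ≢neg) = x , different-cells ≢x ≢neg , avoids (here refl)
      ... | inj₂ (≢x , ≢neg) = rotate x , different-cells ≢x ≢neg , avoids (there (here refl))

module Bounds (v t : ℕ) .{{_ : NonZero v}} .{{_ : NonZero t}} {m n : ℕ} (h k : ℕ) {B : Cells m n} (Ω : Subset v)
    (αr : RowOrdering B) (αc : ColumnOrdering B) (compatible : Compatible αr αc)
    (h≥3 : h ℕ.≥ 3) (k≥3 : k ℕ.≥ 3) (regular : (∀ i → ∣ lookup B i ∣ ≡ h) × (∀ j → ∣ column B j ∣ ≡ k))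
    (T : ℕ) (v≤ : v ℕ.≤ T ℕ.* length (cells {B = B}))
    (L : ℕ) (L≤ : L ℕ.+ (8 ℕ.+ (2 ℕ.+ (m ℕ.+ n))) ℕ.≤ length (cells {B = B})) (≤6L : length (cells {B = B}) ℕ.≤ 6 ℕ.* L)
    (60≤ : 60 ℕ.≤ length (cells {B = B})) where

  open Heffter v t
  open SignedRotation αr αc compatible
  open SignedValues v t {B = B}
  open Automorphisms v t αr αc compatible using (Exchange; Scaling; Symmetry; nonTranslation⇒symmetry)
  open Switching v t {h = h} {k = k} Ω αr αc using (fam; fam-unique)
  open Constraints v t h k Ω αr αc compatible
  open Choice αr αc compatible

  N : ℕ
  N = length (cells {B = B})

  -- There are at least 2 · 60 signed cells, while the choices below avoid at most 20 values; the
  -- threshold 60 itself comes from `switch-count`.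
  enough : ∀ {l} → l ℕ.< 120 → l ℕ.< length (signedCells {B = B})
  enough l< = ℕₚ.<-≤-trans l< (ℕₚ.≤-trans (ℕₚ.*-monoʳ-≤ 2 60≤) (ℕₚ.≤-reflexive (sym (length-signedCells {B = B}))))

  -- The 8 accommodates both systems used: two exchange equations on four cells each, or three
  -- scaling equations on two cells each.
  count-allHold-N : ∀ qs → Independent 8 qs →
                    N ℕ.^ length qs ℕ.* count (allHold? qs) fam ℕ.≤ 18^ (length qs) ℕ.* length fam
  count-allHold-N qs ind = begin
    N ℕ.^ s ℕ.* x                          ≤⟨ ℕₚ.*-monoˡ-≤ x (ℕₚ.^-monoˡ-≤ s ≤6L) ⟩
    (6 ℕ.* L) ℕ.^ s ℕ.* x                  ≡⟨ cong (ℕ._* x) (^-distribʳ-* 6 L s) ⟩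
    6 ℕ.^ s ℕ.* L ℕ.^ s ℕ.* x              ≡⟨ ℕₚ.*-assoc (6 ℕ.^ s) (L ℕ.^ s) x ⟩
    6 ℕ.^ s ℕ.* (L ℕ.^ s ℕ.* x)            ≡⟨ cong (6 ℕ.^ s ℕ.*_) (ℕₚ.*-comm (L ℕ.^ s) x) ⟩
    6 ℕ.^ s ℕ.* (x ℕ.* L ℕ.^ s)            ≤⟨ ℕₚ.*-monoʳ-≤ (6 ℕ.^ s) (count-allHold 8 L L≤ qs ind) ⟩
    6 ℕ.^ s ℕ.* (length fam ℕ.* 3 ℕ.^ s)   ≡⟨ cong (6 ℕ.^ s ℕ.*_) (ℕₚ.*-comm (length fam) (3 ℕ.^ s)) ⟩
    6 ℕ.^ s ℕ.* (3 ℕ.^ s ℕ.* length fam)   ≡⟨ ℕₚ.*-assoc (6 ℕ.^ s) (3 ℕ.^ s) (length fam) ⟨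
    6 ℕ.^ s ℕ.* 3 ℕ.^ s ℕ.* length fam     ≡⟨ cong (ℕ._* length fam) (6^*3^≡18^ s) ⟩
    18^ s ℕ.* length fam                   ∎
    where
    open ℕₚ.≤-Reasoning
    s = length qs
    x = count (allHold? qs) fam

  -- The summand 1 lets `W` dominate `18^ 2` whatever `T` is, so that one bound covers the odd and
  -- the non-odd maps.
  W : ℕ
  W = (1 ℕ.+ T) ℕ.* 18^ 3

  module _ {o : Bool} {φ : SignedCell B → SignedCell B} (φ-equivariant : Equivariant o φ) where

    φ-injective : ∀ {x y} → φ x ≡ φ y → x ≡ y
    φ-injective = equivariant-injective o φ φ-equivariant

    around : SignedCell B → SignedCell B → SignedCell B
    around u = extend o (neg u) (neg (φ u))

    module _ {u : SignedCell B} (not-odd : φ (neg u) ≢ neg (φ u)) where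

      -- Two equivariant maps of the same orientation that agree once agree everywhere; at `neg u`
      -- that would be oddness at `u`.
      around≢φ : ∀ i → around u i ≢ φ i
      around≢φ i eq = not-odd (sym (trans (sym (extend-base o (neg u) (neg (φ u))))
        (equivariant-unique o (around u) (extend-equivariant o (neg u) (neg (φ u))) φ φ-equivariant i eq (neg u))))

      -- `around i` takes the value `neg (φ i)` at `neg i`, and by injectivity only there; but `u`
      -- is not in the cell of `i`.
      around≢neg : ∀ {i} → ∣ i ∣ᶜ ≢ ∣ u ∣ᶜ → around i u ≢ neg (φ i)
      around≢neg {i} i≢u eq = i≢u (trans (neg-cell i) (cong ∣_∣ᶜ (sym
        (equivariant-injective o (around i) (extend-equivariant o (neg i) (neg (φ i)))
          (trans eq (sym (extend-base o (neg i) (neg (φ i)))))))))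
        where
        neg-cell : ∀ x → ∣ x ∣ᶜ ≡ ∣ neg {B = B} x ∣ᶜ
        neg-cell (plus _)  = refl
        neg-cell (minus _) = refl

      exchangeConstraint : ∀ i → ∣ i ∣ᶜ ≢ ∣ u ∣ᶜ → ∣ φ i ∣ᶜ ≢ ∣ φ u ∣ᶜ → Constraint
      exchangeConstraint i i≢u φi≢φu =
        balancedConstraint (φ u) (around u i) (φ i) (around i u) (φi≢φu ∘ sym) (around≢φ i) (around≢neg i≢u)

      choose : ∀ zs → 2 ℕ.* (length zs ℕ.+ length zs) ℕ.< 120 →
               ∃[ i ] (∀ {z} → z ∈ zs → ∣ i ∣ᶜ ≢ ∣ z ∣ᶜ × ∣ φ i ∣ᶜ ≢ ∣ z ∣ᶜ)
      choose zs < =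
        let i , avoids = avoid-cells (id ∷ φ ∷ []) (λ { (here refl) → id ; (there (here refl)) → φ-injective }) zs (enough <)
        in i , λ z∈ → avoids (here refl) z∈ , avoids (there (here refl)) z∈

      -- Both equations keep the `u` at which oddness fails; only the second index varies.
      few-exchange : ∃[ qs ] length qs ≡ 2 × Independent 8 qs × (∀ {D} → (∀ i → Exchange D o φ u i) → AllHold qs D)
      few-exchange = first (choose (u ∷ φ u ∷ []) (ℕₚ.m≤m+n 9 111))
        where
        Result = ∃[ qs ] length qs ≡ 2 × Independent 8 qs × (∀ {D} → (∀ i → Exchange D o φ u i) → AllHold qs D)
        Apart : SignedCell B → List (SignedCell B) → Set
        Apart i zs = ∀ {z} → z ∈ zs → ∣ i ∣ᶜ ≢ ∣ z ∣ᶜ × ∣ φ i ∣ᶜ ≢ ∣ z ∣ᶜ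
        q : ∀ i {zs} → Apart i (u ∷ φ u ∷ zs) → Constraint
        q i apart = exchangeConstraint i (proj₁ (apart {u} (here refl))) (proj₂ (apart {φ u} (there (here refl))))
        second : ∀ i → Apart i (u ∷ φ u ∷ []) →
                 ∃[ j ] Apart j (u ∷ φ u ∷ around u i ∷ φ i ∷ around i u ∷ []) → Result
        second i i∉ (j , j∉) = q j j∉ ∷ q i i∉ ∷ [] , refl , ((tt , (λ ()) , ℕₚ.m≤m+n 4 4) , φj∉ , ℕₚ.≤-refl) ,
                               λ ex → (tt , ex i) , ex j
          where
          φj∉ : ∣ φ j ∣ᶜ ∉ supports (q i i∉ ∷ [])
          φj∉ a∈ = let z , z∈ , eq = ∈-map⁻ ∣_∣ᶜ {xs = φ u ∷ around u i ∷ φ i ∷ around i u ∷ []} a∈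
                   in proj₂ (j∉ {z} (there z∈)) eq
        first : ∃[ i ] Apart i (u ∷ φ u ∷ []) → Result
        -- Beyond `u`, the list consists of the signed cells in the first equation, so the pivot
        -- `φ j` of the second avoids its support.
        first (i , i∉) = second i i∉ (choose (u ∷ φ u ∷ around u i ∷ φ i ∷ around i u ∷ []) (ℕₚ.m≤m+n 21 99))

    module _ (nontrivial : o ≡ true → ∀ x → φ x ≢ x) where

      few-scaling : ∃[ qs ] (∀ c → length (qs c) ≡ 3 × Independent 8 (qs c)) ×
                    (∀ {D c} → (∀ i → Scaling D φ c i) → AllHold (qs c) D)
      few-scaling = first (choose-φ-moved [] (ℕₚ.m≤m+n 1 119))
        where
        Result = ∃[ qs ] (∀ c → length (qs c) ≡ 3 × Independent 8 (qs c)) ×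
                 (∀ {D c} → (∀ i → Scaling D φ c i) → AllHold (qs c) D)
        Moved : List (SignedCell B) → Set
        Moved zs = ∃[ x ] ∣ φ x ∣ᶜ ≢ ∣ x ∣ᶜ × (∀ {z} → z ∈ zs → ∣ φ x ∣ᶜ ≢ ∣ z ∣ᶜ)
        choose-φ-moved : ∀ zs → 2 ℕ.* (length zs ℕ.+ length zs) ℕ.< 120 → Moved zs
        choose-φ-moved zs < = choose-moved h≥3 k≥3 regular φ-equivariant nontrivial zs (enough <)
        pivot∉ : ∀ {x zs} → (∀ {z} → z ∈ zs → ∣ φ x ∣ᶜ ≢ ∣ z ∣ᶜ) → ∣ φ x ∣ᶜ ∉ map ∣_∣ᶜ zs
        pivot∉ avoids a∈ = let z , z∈ , eq = ∈-map⁻ ∣_∣ᶜ a∈ in avoids {z} z∈ eq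
        third : ∀ i₁ → ∣ φ i₁ ∣ᶜ ≢ ∣ i₁ ∣ᶜ → ∀ i₂ → ∣ φ i₂ ∣ᶜ ≢ ∣ i₂ ∣ᶜ →
                (∀ {z} → z ∈ φ i₁ ∷ i₁ ∷ [] → ∣ φ i₂ ∣ᶜ ≢ ∣ z ∣ᶜ) → Moved (φ i₂ ∷ i₂ ∷ φ i₁ ∷ i₁ ∷ []) → Result
        third i₁ moved₁ i₂ moved₂ avoid₂ (i₃ , moved₃ , avoid₃) =
          (λ c → scalingConstraint φ c i₃ moved₃ ∷ scalingConstraint φ c i₂ moved₂ ∷ scalingConstraint φ c i₁ moved₁ ∷ [])
          , (λ c → refl , ((tt , (λ ()) , ℕₚ.m≤m+n 2 6)
              , pivot∉ {i₂} {φ i₁ ∷ i₁ ∷ []} avoid₂ , ℕₚ.m≤m+n 4 4)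
              , pivot∉ {i₃} {φ i₂ ∷ i₂ ∷ φ i₁ ∷ i₁ ∷ []} avoid₃ , ℕₚ.m≤m+n 6 2)
          , λ sc → ((tt , sc i₁) , sc i₂) , sc i₃
        second : ∀ i₁ → ∣ φ i₁ ∣ᶜ ≢ ∣ i₁ ∣ᶜ → Moved (φ i₁ ∷ i₁ ∷ []) → Result
        second i₁ moved₁ (i₂ , moved₂ , avoid₂) = third i₁ moved₁ i₂ moved₂ avoid₂
          (choose-φ-moved (φ i₂ ∷ i₂ ∷ φ i₁ ∷ i₁ ∷ []) (ℕₚ.m≤m+n 17 103))
        first : Moved [] → Result
        first (i₁ , moved₁ , _) = second i₁ moved₁ (choose-φ-moved (φ i₁ ∷ i₁ ∷ []) (ℕₚ.m≤m+n 9 111))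

  module _ (x₀ : SignedCell B) where

    -- `Symmetry` is traded for a decidable consequence `P`, which differs between odd and non-odd
    -- maps but in both cases has probability at most W / N².
    Candidate : Bool → SignedCell B → Set₁
    Candidate o y = Σ[ P ∈ (PFArray m n → Set) ] Σ[ P? ∈ Decidable P ]
      (∀ {D} → Symmetry D x₀ o y → P D) × N ℕ.^ 2 ℕ.* count P? fam ℕ.≤ W ℕ.* length fam

    18^2≤W : 18^ 2 ℕ.≤ W
    18^2≤W = ℕₚ.≤-trans (18^-mono (ℕₚ.n≤1+n 2)) (ℕₚ.m≤m+n (18^ 3) (T ℕ.* 18^ 3))

    module _ {o : Bool} {y : SignedCell B} (nontrivial : o ≡ true → y ≢ x₀) where

      private
        φ : SignedCell B → SignedCell B
        φ = extend o x₀ y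

        φ-equivariant : Equivariant o φ
        φ-equivariant = extend-equivariant o x₀ y

      -- A map commuting with the rotation and having a fixed point is the identity, so it would fix
      -- `x₀`.
      φ-moves : o ≡ true → ∀ x → φ x ≢ x
      φ-moves refl x φx≡x = nontrivial refl (trans (sym (extend-base true x₀ y))
        (equivariant-unique true φ φ-equivariant id (λ _ → refl) x φx≡x x₀))

      not-odd-candidate : ∀ {u} → φ (neg u) ≢ neg (φ u) → Candidate o y
      not-odd-candidate {u} not-odd =
        let qs , length≡2 , ind , hold = few-exchange {o} {φ} φ-equivariant not-odd
        in AllHold qs , allHold? qs , (λ S → hold (Symmetry.exchange S u)) , ℕₚ.≤-trans
          (subst (λ l → N ℕ.^ l ℕ.* count (allHold? qs) fam ℕ.≤ 18^ l ℕ.* length fam) length≡2 (count-allHold-N qs ind))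
          (ℕₚ.*-monoˡ-≤ (length fam) 18^2≤W)

      odd-candidate : (∀ u → φ (neg u) ≡ neg (φ u)) → Candidate o y
      odd-candidate odd = P , P? , symmetric , ℕₚ.*-cancelˡ-≤ N {{N≢0}} (begin
        N ℕ.* (N ℕ.^ 2 ℕ.* count P? fam)             ≡⟨ ℕₚ.*-assoc N (N ℕ.^ 2) _ ⟨
        N ℕ.^ 3 ℕ.* count P? fam                     ≤⟨ union-bound P? (λ c → allHold? (qs c)) fam-unique (allFin v)
          (λ _ (c , holds) → c , ∈-allFin c , holds) (N ℕ.^ 3) (18^ 3 ℕ.* length fam) (λ {c} _ → bound c) ⟩
        length (allFin v) ℕ.* (18^ 3 ℕ.* length fam) ≡⟨ cong (ℕ._* (18^ 3 ℕ.* length fam)) (length-tabulate {n = v} id) ⟩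
        -- The values of `c` cost one factor N; it is paid by the third equation and cancelled
        -- against N³.
        v ℕ.* (18^ 3 ℕ.* length fam)              ≤⟨ ℕₚ.*-monoˡ-≤ (18^ 3 ℕ.* length fam) v≤ ⟩
        T ℕ.* N ℕ.* (18^ 3 ℕ.* length fam)        ≤⟨ ℕₚ.*-monoˡ-≤ (18^ 3 ℕ.* length fam) (ℕₚ.*-monoˡ-≤ N (ℕₚ.n≤1+n T)) ⟩
        (1 ℕ.+ T) ℕ.* N ℕ.* (18^ 3 ℕ.* length fam) ≡⟨ cong (ℕ._* (18^ 3 ℕ.* length fam)) (ℕₚ.*-comm (1 ℕ.+ T) N) ⟩
        N ℕ.* (1 ℕ.+ T) ℕ.* (18^ 3 ℕ.* length fam) ≡⟨ ℕₚ.*-assoc N (1 ℕ.+ T) _ ⟩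
        N ℕ.* ((1 ℕ.+ T) ℕ.* (18^ 3 ℕ.* length fam)) ≡⟨ cong (N ℕ.*_) (ℕₚ.*-assoc (1 ℕ.+ T) (18^ 3) (length fam)) ⟨
        N ℕ.* (W ℕ.* length fam)                     ∎)
        where
        open ℕₚ.≤-Reasoning
        N≢0 : NonZero N
        N≢0 = ℕ.>-nonZero (ℕₚ.≤-trans (s≤s z≤n) 60≤)
        scalings = few-scaling {o} {φ} φ-equivariant φ-moves
        qs = proj₁ scalings
        P : PFArray m n → Set
        P D = ∃[ c ] AllHold (qs c) D
        P? : Decidable P
        P? D = any? λ c → allHold? (qs c) D
        symmetric : ∀ {D} → Symmetry D x₀ o y → P D
        symmetric S = let c , sc = Symmetry.scaling S odd in c , proj₂ (proj₂ scalings) {c = c} sc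
        bound : ∀ c → N ℕ.^ 3 ℕ.* count (allHold? (qs c)) fam ℕ.≤ 18^ 3 ℕ.* length fam
        bound c = subst (λ l → N ℕ.^ l ℕ.* count (allHold? (qs c)) fam ℕ.≤ 18^ l ℕ.* length fam)
          (proj₁ (proj₁ (proj₂ scalings) c)) (count-allHold-N (qs c) (proj₂ (proj₁ (proj₂ scalings) c)))

      nontrivial-candidate : Candidate o y
      nontrivial-candidate = by-oddness (Any.any? (λ u → ¬? (φ (neg u) ≟ˢ neg (φ u))) signedCells)
        where
        by-oddness : Dec (Any.Any (λ u → φ (neg u) ≢ neg (φ u)) signedCells) → Candidate o y
        by-oddness (yes some) = not-odd-candidate (proj₂ (Any.satisfied some))
        by-oddness (no none)  = odd-candidate λ u → decidable-stable (φ (neg u) ≟ˢ neg (φ u))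
          λ not-odd → none (lose (∈-signedCells u) not-odd)

    abstract

      candidate : ∀ o y → Candidate o y
      candidate false y = nontrivial-candidate λ ()
      candidate true  y = by-image (y ≟ˢ x₀)
        where
        by-image : Dec (y ≡ x₀) → Candidate true y
        by-image (no y≢x₀)  = nontrivial-candidate λ _ → y≢x₀
        -- This candidate is the identity map, which no `Symmetry` allows, so the empty event
        -- serves.
        by-image (yes y≡x₀) = (λ _ → ⊥) , (λ _ → no id) , (λ S → Symmetry.nontrivial S refl y≡x₀) ,
          ℕₚ.≤-trans (ℕₚ.≤-reflexive (trans (cong (λ xs → N ℕ.^ 2 ℕ.* length xs) (filter-none (λ _ → no id) (All.universal (λ _ → id) fam)))
            (ℕₚ.*-zeroʳ (N ℕ.^ 2)))) z≤n

    -- The candidates are an orientation and an image of the base point `x₀`: 2 · 2N of them, each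
    -- of probability at most W / N².
    count-nonTranslation : N ℕ.* count (HasNonTranslation? h k αr αc compatible) fam ℕ.≤ 4 ℕ.* W ℕ.* length fam
    count-nonTranslation = ℕₚ.*-cancelˡ-≤ N {{N≢0}} (begin
      N ℕ.* (N ℕ.* bad)                           ≡⟨ ℕₚ.*-assoc N N bad ⟨
      N ℕ.* N ℕ.* bad                             ≡⟨ cong (λ z → N ℕ.* z ℕ.* bad) (ℕₚ.*-identityʳ N) ⟨
      N ℕ.^ 2 ℕ.* bad                             ≤⟨ union-bound (HasNonTranslation? h k αr αc compatible)
        (λ (o , y) → proj₁ (proj₂ (candidate o y))) fam-unique candidates cover (N ℕ.^ 2) (W ℕ.* length fam)
        (λ { {o , y} _ → proj₂ (proj₂ (proj₂ (candidate o y))) }) ⟩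
      length candidates ℕ.* (W ℕ.* length fam)    ≡⟨ cong (ℕ._* (W ℕ.* length fam)) length-candidates ⟩
      N ℕ.* 4 ℕ.* (W ℕ.* length fam)              ≡⟨ ℕₚ.*-assoc N 4 _ ⟩
      N ℕ.* (4 ℕ.* (W ℕ.* length fam))            ≡⟨ cong (N ℕ.*_) (ℕₚ.*-assoc 4 W (length fam)) ⟨
      N ℕ.* (4 ℕ.* W ℕ.* length fam)              ∎)
      where
      open ℕₚ.≤-Reasoning
      N≢0 : NonZero N
      N≢0 = ℕ.>-nonZero (ℕₚ.≤-trans (s≤s z≤n) 60≤)
      bad = count (HasNonTranslation? h k αr αc compatible) fam
      candidates : List (Bool × SignedCell B)
      candidates = cartesianProduct (true ∷ false ∷ []) signedCells
      length-candidates : length candidates ≡ N ℕ.* 4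
      length-candidates = trans (length-cartesianProduct (true ∷ false ∷ []) (signedCells {B = B}))
        (trans (cong (2 ℕ.*_) (length-signedCells {B = B})) (trans (sym (ℕₚ.*-assoc 2 2 N)) (ℕₚ.*-comm 4 N)))
      ∈-Bool : ∀ o → o ∈ true ∷ false ∷ []
      ∈-Bool true  = here refl
      ∈-Bool false = there (here refl)
      cover : ∀ {D} → D ∈ fam → HasNonTranslation h k αr αc compatible D →
              ∃[ oy ] oy ∈ candidates × proj₁ (candidate (proj₁ oy) (proj₂ oy)) D
      cover {D} _ nt with nonTranslation⇒symmetry {D = D} x₀ nt
      ... | o , y , S = (o , y) , ∈-cartesianProduct⁺ (∈-Bool o) (∈-signedCells y) ,
                        proj₁ (proj₂ (proj₂ (candidate o y))) S

-- Numerical bounds and the constant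

/-mono : ∀ a b c d .{{_ : NonZero b}} .{{_ : NonZero d}} → a ℕ.* d ℕ.≤ c ℕ.* b → (ℤ.+ a) ℚ./ b ℚ.≤ (ℤ.+ c) ℚ./ d
/-mono a (suc b) c (suc d) le = ℚ.*≤* (subst₂ ℤ._≤_ (ℤₚ.pos-* a (suc d)) (ℤₚ.pos-* c (suc b)) (ℤ.+≤+ le))

module _ {m n N : ℕ} (3m≤N : m ℕ.* 3 ℕ.≤ N) (3n≤N : n ℕ.* 3 ℕ.≤ N) (60≤N : 60 ℕ.≤ N) where

  private
    3[m+n]≤2N : (m ℕ.+ n) ℕ.* 3 ℕ.≤ N ℕ.+ N
    3[m+n]≤2N = ℕₚ.≤-trans (ℕₚ.≤-reflexive (ℕₚ.*-distribʳ-+ 3 m n)) (ℕₚ.+-mono-≤ 3m≤N 3n≤N)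

    excluded : ℕ
    excluded = 8 ℕ.+ (2 ℕ.+ (m ℕ.+ n))

    6excluded≤5N : 6 ℕ.* excluded ℕ.≤ 5 ℕ.* N
    6excluded≤5N = begin
      6 ℕ.* (10 ℕ.+ (m ℕ.+ n))                ≡⟨ ℕₚ.*-distribˡ-+ 6 10 (m ℕ.+ n) ⟩
      60 ℕ.+ 6 ℕ.* (m ℕ.+ n)                  ≡⟨ cong (60 ℕ.+_) (trans (ℕₚ.*-assoc 2 3 (m ℕ.+ n)) (cong (2 ℕ.*_) (ℕₚ.*-comm 3 (m ℕ.+ n)))) ⟩
      60 ℕ.+ 2 ℕ.* ((m ℕ.+ n) ℕ.* 3)          ≤⟨ ℕₚ.+-mono-≤ 60≤N (ℕₚ.*-monoʳ-≤ 2 3[m+n]≤2N) ⟩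
      N ℕ.+ 2 ℕ.* (N ℕ.+ N)                   ≡⟨ solve 1 (λ N → N :+ con 2 :* (N :+ N) := con 5 :* N) refl N ⟩
      5 ℕ.* N                                 ∎
      where
      open ℕₚ.≤-Reasoning
      open Data.Nat.Solver.+-*-Solver

  -- m + n ≤ 2N / 3, and 60 ≤ N absorbs the ten further excluded cells.
  switch-count : ∃[ L ] L ℕ.+ excluded ℕ.≤ N × N ℕ.≤ 6 ℕ.* L
  switch-count = N ℕ.∸ excluded , ℕₚ.≤-reflexive (ℕₚ.m∸n+n≡m excluded≤N) ,
    ℕₚ.+-cancelʳ-≤ (5 ℕ.* N) N _ (begin
      N ℕ.+ 5 ℕ.* N                              ≡⟨ cong (6 ℕ.*_) (ℕₚ.m∸n+n≡m excluded≤N) ⟨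
      6 ℕ.* (N ℕ.∸ excluded ℕ.+ excluded)        ≡⟨ ℕₚ.*-distribˡ-+ 6 (N ℕ.∸ excluded) excluded ⟩
      6 ℕ.* (N ℕ.∸ excluded) ℕ.+ 6 ℕ.* excluded  ≤⟨ ℕₚ.+-monoʳ-≤ (6 ℕ.* (N ℕ.∸ excluded)) 6excluded≤5N ⟩
      6 ℕ.* (N ℕ.∸ excluded) ℕ.+ 5 ℕ.* N         ∎)
    where
    open ℕₚ.≤-Reasoning
    excluded≤N : excluded ℕ.≤ N
    excluded≤N = ℕₚ.*-cancelˡ-≤ 6 (ℕₚ.≤-trans 6excluded≤5N (ℕₚ.*-monoˡ-≤ N (ℕₚ.n≤1+n 5)))

module _ (t : ℕ) .{{t≢0 : NonZero t}} where

  -- The first summand is 4 `W` with T = 2 + t and serves for N ≥ 60. The 60 covers N < 60, where a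
  -- probability is at most 1 and hence at most 60 / N.
  constant : ℕ
  constant = 4 ℕ.* ((1 ℕ.+ (2 ℕ.+ t)) ℕ.* 18^ 3) ℕ.+ 60

  module _ (m n h k : ℕ) .{{_ : NonZero (n ℕ.* k)}} (h≥3 : h ℕ.≥ 3) (k≥3 : k ℕ.≥ 3) where

    private
      N v : ℕ
      N = n ℕ.* k
      v = 2 ℕ.* N ℕ.+ t
      instance
        v≢0 : NonZero v
        v≢0 = modulus-nonZero {2 ℕ.* N} {{t≢0}}

    open Heffter v t {{v≢0}} {{t≢0}}

    module _ (B : Cells m n) (regular : Regular h k B) (αr : RowOrdering B) (αc : ColumnOrdering B)
             (compatible : Compatible αr αc) (Ω : Subset v) where

      private
        W bad : ℕ
        W   = (1 ℕ.+ (2 ℕ.+ t)) ℕ.* 18^ 3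
        bad = count (HasNonTranslation? h k αr αc compatible) (family h k B Ω)
        fam = family h k B Ω

        length-cells : length (cells {B = B}) ≡ N
        length-cells = length-cells-columns {B = B} (proj₂ regular)

        -- As N ≥ 1, the summand t of v is at most t N. Here the constant acquires its dependence on
        -- `t`.
        v≤ : v ℕ.≤ (2 ℕ.+ t) ℕ.* length (cells {B = B})
        v≤ = ℕₚ.≤-trans (ℕₚ.+-monoʳ-≤ (2 ℕ.* N) (ℕₚ.m≤m*n t N))
          (ℕₚ.≤-reflexive (trans (sym (ℕₚ.*-distribʳ-+ N 2 t)) (cong ((2 ℕ.+ t) ℕ.*_) (sym length-cells))))

        large : 60 ℕ.≤ length (cells {B = B}) → ∃[ a ] a ∈ cells {B = B} →
                length (cells {B = B}) ℕ.* bad ℕ.≤ 4 ℕ.* W ℕ.* length fam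
        large 60≤ (a , _) =
          let L , L≤ , ≤6L = switch-count {m} {n}
                (ℕₚ.≤-trans (ℕₚ.*-monoʳ-≤ m h≥3) (length-cells-rows {B = B} (proj₁ regular)))
                (ℕₚ.≤-trans (ℕₚ.*-monoʳ-≤ n k≥3) (ℕₚ.≤-reflexive (sym length-cells))) 60≤
          in Bounds.count-nonTranslation v t {{v≢0}} {{t≢0}} h k Ω αr αc compatible h≥3 k≥3 regular
               (2 ℕ.+ t) v≤ L L≤ ≤6L 60≤ (plus a)

        nonempty : ∀ {xs : List (Cell B)} → 60 ℕ.≤ length xs → ∃[ a ] a ∈ xs
        nonempty {a ∷ _} _ = a , here refl

        by-size : Dec (60 ℕ.≤ N) → N ℕ.* bad ℕ.≤ constant ℕ.* length fam
        by-size (yes 60≤N) = ℕₚ.≤-trans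
          (subst (λ l → l ℕ.* bad ℕ.≤ 4 ℕ.* W ℕ.* length fam) length-cells (large 60≤ (nonempty 60≤)))
          (ℕₚ.*-monoˡ-≤ (length fam) (ℕₚ.m≤m+n (4 ℕ.* W) 60))
          where
          60≤ : 60 ℕ.≤ length (cells {B = B})
          60≤ = subst (60 ℕ.≤_) (sym length-cells) 60≤N
        by-size (no 60≰N) = ℕₚ.≤-trans
          (ℕₚ.*-mono-≤ (ℕₚ.<⇒≤ (ℕₚ.≰⇒> 60≰N)) (length-filter (HasNonTranslation? h k αr αc compatible) fam))
          (ℕₚ.*-monoˡ-≤ (length fam) (ℕₚ.m≤n+m 60 (4 ℕ.* W)))

      Pr-nonTranslation : .{{_ : NonZero (length (family h k B Ω))}} →
        Pr (HasNonTranslation? h k αr αc compatible) (family h k B Ω) ℚ.≤ (ℤ.+ constant) ℚ./ (n ℕ.* k)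
      Pr-nonTranslation = /-mono bad (length fam) constant N
        (ℕₚ.≤-trans (ℕₚ.≤-reflexive (ℕₚ.*-comm bad N)) (by-size (60 ℕₚ.≤? N)))

open import Data.Integer.Base using (+_)
open import Data.Nat.Base using (_+_; _*_; _≥_)
open import Data.Rational.Unnormalised.Base using (_≤_; _/_)

theorem3p14 : ∀ (t : ℕ) .{{t≢0 : NonZero t}} → ∃[ C ]
    (∀ (m n h k : ℕ) .{{_ : NonZero (n * k)}} →
    t ∣ 2 * (n * k) → h ≥ 3 → k ≥ 3 →
    let v = 2 * (n * k) + t
        open Heffter v t {{modulus-nonZero {2 * (n * k)} {{t≢0}}}} {{t≢0}}
    in
    (B : Cells m n) → Regular h k B →
    (αr : RowOrdering B) (αc : ColumnOrdering B) (compatible : Compatible αr αc) →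
    (Ω : Subset v) → CoversOnce (elements Ω) →
    .{{_ : NonZero (length (family h k B Ω))}} →
    Pr (HasNonTranslation? h k αr αc compatible) (family h k B Ω) ≤ (+ C) / (n * k))
theorem3p14 t = constant t , λ m n h k _ h≥3 k≥3 B regular αr αc compatible Ω _ →
  Pr-nonTranslation t m n h k h≥3 k≥3 B regular αr αc compatible Ω
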